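{- (1) Let $2<m<n<\omega$. Then the class of $\mathsf{CA}_m$s having $(n+1)$-smooth relativized representations is a variety that is not finitely axiomatizable over the class of $\mathsf{CA}_m$s having $n$-smooth relativized representations. (2) For finite $m>2$ and finite $n\ge m+3$, the class of $\mathsf{CA}_m$s having complete $n$-smooth relativized representations is not even elementary.
   Context: $\mathsf{CA}_m$ is the class of cylindric algebras of dimension $m$. A class $\mathsf L$ is finitely axiomatizable over $\mathsf L'\supseteq\mathsf L$ if there is a finite set $\Sigma$ of first order sentences with $\mathsf L=\mathsf L'\cap\mathrm{Mod}(\Sigma)$. A relativized representation of $\mathfrak A\in\mathsf{CA}_m$ is a set $M$ with $V\subseteq{}^mM$, $M=\bigcup_{s\in V}\mathrm{rng}(s)$, and an injective homomorphism $f:\mathfrak A\to\wp(V)$ (Boolean operations relative to $V$, $c_iX=\{s\in V:\exists t\in X,\ t_j=s_j\ \forall j\ne i\}$, $d_{ij}=\{s\in V:s_i=s_j\}$); $M\models a(\bar s)$ means $\bar s\in f(a)$. It is complete if $f$ carries arbitrary existing suprema to unions. A clique is $C\subseteq M$ with ${}^mC\subseteq V$; $C^t(M)$ is the set of $t$-tuples of $M$ whose range is a clique. $M$ is $n$-square if whenever $\bar x\in C^n(M)$, $a\in A$, $i<m$, $l:m\to n$, $k\in n\setminus\{l(j):j\ne i\}$ and $M\models c_ia(x_{l(0)},\dots,x_{l(m-1)})$, there is $\bar y\in C^n(M)$ agreeing with $\bar x$ off $k$ such that $M\models a(y_{l'(0)},\dots,y_{l'(m-1)})$, where $l'$ is $l$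 changed so that $l'(i)=k$. $M$ is $n$-smooth if it is $n$-square and there are equivalence relations $E^t$ on $C^t(M)$ ($1\le t\le n$) such that $\Theta=\{(x_i\mapsto y_i)_{i<t}:(\bar x,\bar y)\in E^t,\ 1\le t\le n\}$ is an $n$-back-and-forth system of partial isomorphisms: its members are injective partial maps preserving and reflecting all $a\in A$, it is closed under restrictions, and for $\theta\in\Theta$ with $|\theta|<n$ and $x\in M$ with $\mathrm{dom}\,\theta\cup\{x\}$ a clique there is $\theta'\supseteq\theta$ in $\Theta$ with $x\in\mathrm{dom}\,\theta'$, and symmetrically for ranges. -}

module Defs where

open import Algebra.Definitions using (Congruent₁; Congruent₂)
open import Algebra.Lattice.Structures using (IsBooleanAlgebra)
open import Data.Empty.Polymorphic using (⊥)
open import Data.Fin.Base using (Fin)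
open import Data.List.Base using (List)
open import Data.List.Relation.Unary.All using (All)
open import Data.Nat.Base using (ℕ; suc; _≤_; _<_)
open import Data.Product using (Σ-syntax; ∃; ∃-syntax; _×_; _,_; proj₁; proj₂)
open import Data.Vec.Functional using (updateAt) renaming (_∷_ to _▹_)
open import Function.Base using (_∘_; const)
open import Function.Bundles using (_⇔_)
open import Function.Definitions using (Injective)
open import Level using (Level) renaming (suc to lsuc)
open import Relation.Binary.Core using (Rel)
open import Relation.Binary.PropositionalEquality.Core using (_≡_; _≢_)
open import Relation.Binary.Structures using (IsEquivalence)
open import Relation.Nullary.Negation using (¬_)
open import Relation.Unary using (Pred; _∈_; _⊆_; _≐_; _∪_; _∩_; ∅; ｛_｝)

private
  variable
    ℓ p : Level
    m k : ℕ

-- Structures for the similarity type of CA_m.  As for the bundles of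
-- Algebra.Lattice, the carrier is a setoid and _≈_ plays the role of equality,
-- also in equations and first-order formulas.

record Structure (m : ℕ) (ℓ : Level) : Set (lsuc ℓ) where
  infix  4 _≈_ _≼_
  infixr 6 _∨_
  infixr 7 _∧_
  infix  8 -_
  field
    Carrier       : Set ℓ
    _≈_           : Rel Carrier ℓ
    _∨_ _∧_       : Carrier → Carrier → Carrier
    -_            : Carrier → Carrier
    𝟙 𝟘           : Carrier
    c             : Fin m → Carrier → Carrier
    d             : Fin m → Fin m → Carrier
    isEquivalence : IsEquivalence _≈_
    ∨-cong        : Congruent₂ _≈_ _∨_
    ∧-cong        : Congruent₂ _≈_ _∧_
    -‿cong        : Congruent₁ _≈_ -_
    c-cong        : ∀ i → Congruent₁ _≈_ (c i)

  _≼_ : Rel Carrier ℓ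
  x ≼ y = x ∨ y ≈ y

  IsSupremum : Pred Carrier ℓ → Carrier → Set ℓ
  IsSupremum S a = (∀ b → b ∈ S → b ≼ a)
                 × (∀ u → (∀ b → b ∈ S → b ≼ u) → a ≼ u)

-- The usual axioms of Henkin, Monk and Tarski.

record IsCA {m ℓ} (𝔄 : Structure m ℓ) : Set ℓ where
  open Structure 𝔄
  field
    isBooleanAlgebra : IsBooleanAlgebra _≈_ _∨_ _∧_ -_ 𝟙 𝟘
    c-𝟘    : ∀ i → c i 𝟘 ≈ 𝟘
    c-incr : ∀ i x → x ≼ c i x
    c-∧    : ∀ i x y → c i (x ∧ c i y) ≈ c i x ∧ c i y
    c-comm : ∀ i j x → c i (c j x) ≈ c j (c i x)
    d-refl : ∀ i → d i i ≈ 𝟙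
    d-comp : ∀ i j k → k ≢ i → k ≢ j → d i j ≈ c k (d i k ∧ d k j)
    d-sep  : ∀ i j x → i ≢ j → c i (d i j ∧ x) ∧ c i (d i j ∧ - x) ≈ 𝟘

data Term (m : ℕ) (X : Set) : Set where
  var       : X → Term m X
  _∨ᵗ_ _∧ᵗ_ : Term m X → Term m X → Term m X
  -ᵗ_       : Term m X → Term m X
  𝟙ᵗ 𝟘ᵗ     : Term m X
  cᵗ        : Fin m → Term m X → Term m X
  dᵗ        : Fin m → Fin m → Term m X

module _ (𝔄 : Structure m ℓ) where
  open Structure 𝔄

  eval : {X : Set} → (X → Carrier) → Term m X → Carrier
  eval ρ (var x)  = ρ x
  eval ρ (s ∨ᵗ t) = eval ρ s ∨ eval ρ t
  eval ρ (s ∧ᵗ t) = eval ρ s ∧ eval ρ t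
  eval ρ (-ᵗ t)   = - eval ρ t
  eval ρ 𝟙ᵗ       = 𝟙
  eval ρ 𝟘ᵗ       = 𝟘
  eval ρ (cᵗ i t) = c i (eval ρ t)
  eval ρ (dᵗ i j) = d i j

Equation : ℕ → Set
Equation m = Term m ℕ × Term m ℕ

infix 4 _⊨ᵉ_

_⊨ᵉ_ : Structure m ℓ → Equation m → Set ℓ
𝔄 ⊨ᵉ (s , t) = ∀ ρ → eval 𝔄 ρ s ≈ eval 𝔄 ρ t
  where open Structure 𝔄

-- First-order formulas with k free variables, in de Bruijn style; the other
-- connectives and ∃ are the classical abbreviations.

infixr 5 _⇒ᶠ_
infix  6 _≈ᶠ_

data Formula (m : ℕ) (k : ℕ) : Set where
  _≈ᶠ_ : Term m (Fin k) → Term m (Fin k) → Formula m k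
  ⊥ᶠ   : Formula m k
  _⇒ᶠ_ : Formula m k → Formula m k → Formula m k
  ∀ᶠ   : Formula m (suc k) → Formula m k

Sentence : ℕ → Set
Sentence m = Formula m 0

module _ (𝔄 : Structure m ℓ) where
  open Structure 𝔄

  Sat : (Fin k → Carrier) → Formula m k → Set ℓ
  Sat ρ (s ≈ᶠ t) = eval 𝔄 ρ s ≈ eval 𝔄 ρ t
  Sat ρ ⊥ᶠ       = ⊥
  Sat ρ (φ ⇒ᶠ ψ) = Sat ρ φ → Sat ρ ψ
  Sat ρ (∀ᶠ φ)   = ∀ x → Sat (x ▹ ρ) φ

infix 4 _⊨_

_⊨_ : Structure m ℓ → Sentence m → Set ℓ
𝔄 ⊨ σ = Sat 𝔄 (λ ()) σ

Class : ℕ → (ℓ p : Level) → Set _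
Class m ℓ p = Pred (Structure m ℓ) p

-- E is matched against all structures of the type, so it must entail the
-- axioms of CA_m whenever K consists of CAs; likewise T in IsElementary.

IsVariety : Class m ℓ p → Set _
IsVariety {m} {ℓ} K =
  Σ[ E ∈ Pred (Equation m) ℓ ] (∀ 𝔄 → 𝔄 ∈ K ⇔ (∀ e → e ∈ E → 𝔄 ⊨ᵉ e))

IsElementary : Class m ℓ p → Set _
IsElementary {m} {ℓ} K =
  Σ[ T ∈ Pred (Sentence m) ℓ ] (∀ 𝔄 → 𝔄 ∈ K ⇔ (∀ σ → σ ∈ T → 𝔄 ⊨ σ))

FinitelyAxiomatizableOver : Class m ℓ p → Class m ℓ p → Set _
FinitelyAxiomatizableOver {m} L′ L =
  Σ[ T ∈ List (Sentence m) ] (∀ 𝔄 → 𝔄 ∈ L ⇔ (𝔄 ∈ L′ × All (𝔄 ⊨_) T))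

-- Tuples are functions on Fin m and V, f a are not required to respect pointwise
-- equality: function extensionality is assumed wherever these notions are used.

record RelativizedRepresentation {m ℓ} (𝔄 : Structure m ℓ) : Set (lsuc ℓ) where
  open Structure 𝔄
  field
    M : Set ℓ
    V : Pred (Fin m → M) ℓ
    f : Carrier → Pred (Fin m → M) ℓ

  Cyl : Fin m → Pred (Fin m → M) ℓ → Pred (Fin m → M) ℓ
  Cyl i X s = s ∈ V × (∃[ t ] (t ∈ X × (∀ j → j ≢ i → t j ≡ s j)))

  Diag : Fin m → Fin m → Pred (Fin m → M) ℓ
  Diag i j s = s ∈ V × s i ≡ s j

  field
    cover     : ∀ x → ∃[ s ] (s ∈ V × (∃[ i ] s i ≡ x))
    f-⊆       : ∀ a → f a ⊆ V
    f-cong    : ∀ {a b} → a ≈ b → f a ≐ f b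
    injective : ∀ {a b} → f a ≐ f b → a ≈ b
    f-∨       : ∀ a b → f (a ∨ b) ≐ f a ∪ f b
    f-∧       : ∀ a b → f (a ∧ b) ≐ f a ∩ f b
    f--       : ∀ a → f (- a) ≐ (λ s → s ∈ V × ¬ (s ∈ f a))
    f-𝟙       : f 𝟙 ≐ V
    f-𝟘       : f 𝟘 ≐ ∅
    f-c       : ∀ i a → f (c i a) ≐ Cyl i (f a)
    f-d       : ∀ i j → f (d i j) ≐ Diag i j

  IsComplete : Set (lsuc ℓ)
  IsComplete = ∀ S a → IsSupremum S a → f a ≐ (λ s → ∃[ b ] (b ∈ S × s ∈ f b))

  IsClique : Pred M ℓ → Set ℓ
  IsClique C = ∀ (s : Fin m → M) → (∀ i → s i ∈ C) → s ∈ V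

  Range : ∀ {t} → (Fin t → M) → Pred M ℓ
  Range x z = ∃[ i ] x i ≡ z

  CliqueTuple : ℕ → Set ℓ
  CliqueTuple t = Σ[ x ∈ (Fin t → M) ] IsClique (Range x)

  IsSquare : ℕ → Set ℓ
  IsSquare n =
    ∀ (x : Fin n → M) → IsClique (Range x) →
    ∀ a (i : Fin m) (l : Fin m → Fin n) (k : Fin n) →
    (∀ j → j ≢ i → k ≢ l j) →
    x ∘ l ∈ f (c i a) →
    ∃[ y ] (IsClique (Range y)
          × (∀ j → j ≢ k → y j ≡ x j)
          × y ∘ updateAt l i (const k) ∈ f a)

  -- Partial maps on M are given by their graphs.

  PartialMap : Set (lsuc ℓ)
  PartialMap = M → M → Set ℓ

  Dom Ran : PartialMap → Pred M ℓ
  Dom θ a = ∃[ b ] θ a b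
  Ran θ b = ∃[ a ] θ a b

  _↾_ : PartialMap → Pred M ℓ → PartialMap
  (θ ↾ D) a b = a ∈ D × θ a b

  HasSize : PartialMap → ℕ → Set ℓ
  HasSize θ t =
    Σ[ e ∈ (Fin t → M × M) ]
      (Injective _≡_ _≡_ e × (∀ a b → θ a b ⇔ (∃[ i ] e i ≡ (a , b))))

  _↦_ : ∀ {t} → (Fin t → M) → (Fin t → M) → PartialMap
  (x ↦ y) a b = ∃[ i ] (x i ≡ a × y i ≡ b)

  record IsPartialIsomorphism (θ : PartialMap) : Set ℓ where
    field
      functional : ∀ {a b b′} → θ a b → θ a b′ → b ≡ b′
      inj        : ∀ {a a′ b} → θ a b → θ a′ b → a ≡ a′
      preserves  : ∀ a (s s′ : Fin m → M) → (∀ i → θ (s i) (s′ i)) →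
                   s ∈ f a ⇔ s′ ∈ f a

  -- Tuples have length at least 1, so Θ below contains only nonempty maps, and
  -- closure under restrictions is about nonempty restrictions.  Adjoining the
  -- empty map would change nothing: the identity on any singleton clique
  -- extends it, by reflexivity of E¹.

  record IsBackAndForth (n : ℕ) (Θ : Pred PartialMap ℓ) : Set (lsuc ℓ) where
    field
      partialIso : ∀ {θ} → θ ∈ Θ → IsPartialIsomorphism θ
      restrict   : ∀ {θ} → θ ∈ Θ → ∀ D → ∃ (Dom (θ ↾ D)) → (θ ↾ D) ∈ Θ
      forth      : ∀ {θ} → θ ∈ Θ → ∀ t → HasSize θ t → t < n →
                   ∀ x → IsClique (Dom θ ∪ ｛ x ｝) →
                   ∃[ θ′ ] (θ′ ∈ Θ × (∀ {a b} → θ a b → θ′ a b) × x ∈ Dom θ′)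
      back       : ∀ {θ} → θ ∈ Θ → ∀ t → HasSize θ t → t < n →
                   ∀ y → IsClique (Ran θ ∪ ｛ y ｝) →
                   ∃[ θ′ ] (θ′ ∈ Θ × (∀ {a b} → θ a b → θ′ a b) × y ∈ Ran θ′)

  record IsSmooth (n : ℕ) : Set (lsuc ℓ) where
    field
      square  : IsSquare n

      -- Eᵗ is a relation on all t-tuples of which only the part on clique
      -- tuples is used; it thus cannot depend on proofs of cliqueness.
      E       : ∀ t → Rel (Fin t → M) ℓ
      E-equiv : ∀ t → 1 ≤ t → t ≤ n →
                IsEquivalence (λ (x y : CliqueTuple t) → E t (proj₁ x) (proj₁ y))

    Θ : Pred PartialMap ℓ
    Θ θ = ∃[ t ] (1 ≤ t × t ≤ n ×
            Σ[ x ∈ CliqueTuple t ] Σ[ y ∈ CliqueTuple t ]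
              (E t (proj₁ x) (proj₁ y)
              × (∀ a b → θ a b ⇔ (proj₁ x ↦ proj₁ y) a b)))

    field
      backAndForth : IsBackAndForth n Θ

open RelativizedRepresentation using (IsSmooth; IsComplete)

HasSmooth : (m n : ℕ) → Class m ℓ (lsuc ℓ)
HasSmooth m n 𝔄 =
  IsCA 𝔄 × (Σ[ R ∈ RelativizedRepresentation 𝔄 ] IsSmooth R n)

HasCompleteSmooth : (m n : ℕ) → Class m ℓ (lsuc ℓ)
HasCompleteSmooth m n 𝔄 =
  IsCA 𝔄 × (Σ[ R ∈ RelativizedRepresentation 𝔄 ] (IsComplete R × IsSmooth R n))

{-# OPTIONS --safe #-}
module Submission where

-- With every Eᵗ the identity relation, an n-square representation is n-smooth,
-- so all classes are those of n-square representations.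
--
-- Variety: let 𝔄 satisfy all equations that are valid in the class.  A finite
-- list of terms that vanish in 𝔄 can be avoided at a point of a represented
-- algebra of the class where a given term that is nonzero in 𝔄 holds.  In an
-- ultraproduct of such representations the tuples that avoid all vanishing
-- terms represent 𝔄; squareness survives as the ideal is closed under all c_i.
--
-- Non-axiomatizability: elements of the rainbow-like algebra 𝔄(H) are sets of
-- labelled structures on m points.  Over a base of m − 1 points the universal
-- player puts apices of increasing tint; red labels make the existential player
-- propose for each of them a colour among κ and a height in H.  Heights decrease
-- weakly along the tints and strictly within a colour.  If suc κ apices over a
-- base fit into q = m + κ pebbles, then two of them share a colour, and sliding
-- the window of apices forces heights down forever.  With one pebble less there
-- is always a fresh colour.  If the heights are bounded by 2^j, the existential
-- player survives about j rounds with q pebbles; if they are unbounded, any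
-- finite number of rounds.  Hence ultraproducts over j and ultrapowers have
-- complete q-square representations, while the algebra itself has no q-square
-- representation if heights are bounded, and no complete one otherwise.
-- A strategy is turned into a representation by unravelling: only squareness is
-- asked for, so a tree of networks suffices and no amalgamation is needed.

open import Defs
open import Algebra.Lattice.Structures using (IsBooleanAlgebra)
open import Algebra.Lattice.Bundles using (BooleanAlgebra)
import Algebra.Lattice.Properties.BooleanAlgebra as BooleanAlgebraₚ
open import Axiom.ExcludedMiddle using (ExcludedMiddle)
open import Axiom.Extensionality.Propositional using (Extensionality)
open import Data.Bool.Base using (Bool; true; false; not)
import Data.Bool.Base as Bool
import Data.Bool.Properties as Boolₚ
open import Data.Empty using (⊥; ⊥-elim)
open import Data.Fin.Base using (Fin; zero; suc; toℕ; fromℕ<; inject≤; splitAt; join; _↑ˡ_; _↑ʳ_; punchIn; punchOut)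
open import Data.Fin.Properties using (suc-injective; _≟_; toℕ-injective; toℕ-fromℕ<; toℕ<n; toℕ-inject≤; inject≤-injective; injective⇒≤; punchOut-injective; join-splitAt; splitAt-↑ˡ; splitAt-↑ʳ; ↑ˡ-injective; ↑ʳ-injective; pigeonhole; punchInᵢ≢i; punchIn-punchOut; punchOut-punchIn)
open import Data.List.Base using (List; []; _∷_; _++_)
open import Data.List.Relation.Unary.All using (All; []; _∷_)
open import Data.List.Relation.Unary.All.Properties using (++⁺; ++⁻)
open import Data.List.Membership.Propositional using () renaming (_∈_ to _∈ᴸ_)
open import Data.List.Relation.Unary.Any using (here; there)
open import Data.Maybe.Base using (Maybe; just; nothing; fromMaybe)
open import Data.Maybe.Properties using (just-injective)
open import Data.Nat.Base using (ℕ; zero; suc; _+_; _*_; _∸_; _^_; _≤_; _<_; z≤n; s≤s; s≤s⁻¹; nonZero)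
open import Data.Nat.Divisibility using (_∣_; divides; ∣-refl; ∣-trans; m∣m*n; ∣m∣n⇒∣m+n; _∣0)
import Data.Nat.Properties as ℕₚ
open import Data.Nat.Properties using (∸-monoˡ-≤; ≤-refl; ≤-trans; ≤-antisym; n≤1+n; 1+n≰n; ≮⇒≥; ≤-total; <-irrefl; m≤n⇒m≤1+n; m≤m+n; m≤n+m)
open import Data.Product using (Σ; Σ-syntax; ∃; ∃-syntax; _×_; _,_; proj₁; proj₂)
open import Data.Sum.Base using (_⊎_; inj₁; inj₂; [_,_]′)
open import Data.Unit.Base using (⊤; tt)
open import Data.Vec.Functional using (updateAt) renaming (_∷_ to _▹_)
open import Data.Vec.Functional.Properties using (updateAt-minimal; updateAt-updates)
open import Function.Base using (_∘_; const; id; case_of_)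
open import Function.Bundles using (_⇔_; mk⇔; Equivalence)
open import Level using (Level; Lift; lift; lower) renaming (suc to lsuc)
open import Relation.Binary.PropositionalEquality using (_≡_; _≢_; refl; sym; trans; cong; cong₂; subst; subst₂)
open import Relation.Nullary using (¬_; Dec; yes; no; does)
open import Relation.Unary using (Pred; _∈_; _⊆_; _≐_; _∪_; _∩_; ｛_｝)
open import Relation.Binary.Structures using (IsEquivalence)
import Relation.Binary.Reasoning.Setoid as SetoidReasoning

module _ {ℓ : Level} (em : ∀ {a} → ExcludedMiddle a) (fe : ∀ {a b} → Extensionality a b) where

  private variable
    ℓ₁ ℓ₂ : Level
    P : Set ℓ₁
    R : Set ℓ₂

  by-cases : (P → R) → (¬ P → R) → R
  by-cases {P = P} f g with em {P = P}
  ... | yes x = f x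
  ... | no ¬x = g ¬x

  by-cases-elim : ∀ {q} (Q : R → Set q) {f : P → R} {g : ¬ P → R} →
                  (∀ x → Q (f x)) → (∀ ¬x → Q (g ¬x)) → Q (by-cases f g)
  by-cases-elim {P = P} Q y n with em {P = P}
  ... | yes x = y x
  ... | no ¬x = n ¬x

  dne : ¬ ¬ P → P
  dne ¬¬x = by-cases id (λ ¬x → ⊥-elim (¬¬x ¬x))

  ⌊_⌋ : Set ℓ₁ → Bool
  ⌊ P ⌋ = does (em {P = P})

  ⌊⌋-intro : P → ⌊ P ⌋ ≡ true
  ⌊⌋-intro {P = P} x with em {P = P}
  ... | yes _ = refl
  ... | no ¬x = ⊥-elim (¬x x)

  ⌊⌋-elim : ⌊ P ⌋ ≡ true → P
  ⌊⌋-elim {P = P} eq with em {P = P}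
  ... | yes x = x

  ⌊⌋-false : ¬ P → ⌊ P ⌋ ≡ false
  ⌊⌋-false {P = P} ¬x with em {P = P}
  ... | yes x = ⊥-elim (¬x x)
  ... | no _  = refl

  ⌊⌋-cong : (P → R) → (R → P) → ⌊ P ⌋ ≡ ⌊ R ⌋
  ⌊⌋-cong {P = P} f g with em {P = P}
  ... | yes x = sym (⌊⌋-intro (f x))
  ... | no ¬x = sym (⌊⌋-false (¬x ∘ g))

  true≢false : ∀ {b} → b ≡ true → b ≡ false → ⊥
  true≢false refl ()

  ≢true⇒false : ∀ {b} → ¬ b ≡ true → b ≡ false
  ≢true⇒false {true}  n = ⊥-elim (n refl)
  ≢true⇒false {false} n = refl

  bool-ext : ∀ {x y : Bool} → (x ≡ true → y ≡ true) → (y ≡ true → x ≡ true) → x ≡ y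
  bool-ext {true}  f g = sym (f refl)
  bool-ext {false} {true}  f g = g refl
  bool-ext {false} {false} f g = refl

  ∨-absorb : ∀ {x y} → (x ≡ true → y ≡ true) → x Bool.∨ y ≡ y
  ∨-absorb {true}  h = sym (h refl)
  ∨-absorb {false} h = refl

  ∧-split : ∀ x {y} → x Bool.∧ y ≡ true → x ≡ true × y ≡ true
  ∧-split true e = refl , e

  ∧-join : ∀ {x y} → x ≡ true → y ≡ true → x Bool.∧ y ≡ true
  ∧-join refl e = e

  not-elim : ∀ {x} → not x ≡ true → ¬ x ≡ true
  not-elim {false} _ ()

  𝒫 : Set ℓ₁ → Set ℓ₁
  𝒫 A = A → Bool

  infix 4 _∋_ _⊑_

  _∋_ : {A : Set ℓ₁} → 𝒫 A → A → Set
  X ∋ a = X a ≡ true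

  _⊑_ : {A : Set ℓ₁} → 𝒫 A → 𝒫 A → Set ℓ₁
  X ⊑ Y = ∀ a → X ∋ a → Y ∋ a

  ⊑-antisym : {A : Set ℓ₁} {X Y : 𝒫 A} → X ⊑ Y → Y ⊑ X → X ≡ Y
  ⊑-antisym {X = X} {Y} f g = fe λ a → bool-ext (f a) (g a)

  -- Ultrafilters and ultraproducts

  Meets : {J : Set ℓ₁} → List (𝒫 J) → 𝒫 J → Set ℓ₁
  Meets xs A = ∃[ j ] (All (_∋ j) xs × A ∋ j)

  module MaximalFilter {J : Set ℓ₁} (F₀ : 𝒫 (𝒫 J))
    (fip₀ : ∀ xs → All (F₀ ∋_) xs → ∃[ j ] All (_∋ j) xs) where

    Consistent : 𝒫 (𝒫 J) → 𝒫 J → Set ℓ₁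
    Consistent F A = ∀ xs → All (F ∋_) xs → Meets xs A

    FIP : 𝒫 (𝒫 J) → Set ℓ₁
    FIP F = ∀ xs → All (F ∋_) xs → ∃[ j ] All (_∋ j) xs

    Extensible : 𝒫 (𝒫 J) → Set ℓ₁
    Extensible F = ∃[ A ] (¬ F ∋ A × Consistent F A)

    adjoin : 𝒫 (𝒫 J) → 𝒫 J → 𝒫 (𝒫 J)
    adjoin F A X = ⌊ F ∋ X ⊎ X ≡ A ⌋

    next : 𝒫 (𝒫 J) → 𝒫 (𝒫 J)
    next F = by-cases {P = Extensible F} (adjoin F ∘ proj₁) (λ _ → F)

    ⋃ : 𝒫 (𝒫 (𝒫 J)) → 𝒫 (𝒫 J)
    ⋃ C X = ⌊ F₀ ∋ X ⊎ ∃[ F ] (C ∋ F × F ∋ X) ⌋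

    -- Zorn's lemma by the Bourbaki–Witt argument: the stages of the transfinite
    -- iteration of next form a chain.
    data Stage : 𝒫 (𝒫 J) → Set ℓ₁ where
      step : ∀ {F} → Stage F → Stage (next F)
      lim  : ∀ C → (∀ F → C ∋ F → Stage F) → Stage (⋃ C)

    ⊑-next : ∀ F → F ⊑ next F
    ⊑-next F X FX with em {P = Extensible F}
    ... | yes _ = ⌊⌋-intro (inj₁ FX)
    ... | no _  = FX

    F₀⊑ : ∀ {F} → Stage F → F₀ ⊑ F
    F₀⊑ (step {F} σ) X x = ⊑-next F X (F₀⊑ σ X x)
    F₀⊑ (lim C σ)    X x = ⌊⌋-intro (inj₁ x)

    ⊑-⋃ : ∀ {C F} → C ∋ F → F ⊑ ⋃ C
    ⊑-⋃ {F = F} CF X x = ⌊⌋-intro (inj₂ (F , CF , x))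

    ⋃-⊑ : ∀ {C F} → F₀ ⊑ F → (∀ G → C ∋ G → G ⊑ F) → ⋃ C ⊑ F
    ⋃-⊑ b h X x with ⌊⌋-elim x
    ... | inj₁ x₀            = b X x₀
    ... | inj₂ (G , CG , GX) = h G CG X GX

    Extreme : 𝒫 (𝒫 J) → Set ℓ₁
    Extreme F = ∀ {G} → Stage G → G ⊑ F → F ⊑ G ⊎ next G ⊑ F

    extreme-cmp : ∀ {F} → Stage F → Extreme F → ∀ {G} → Stage G → G ⊑ F ⊎ next F ⊑ G
    extreme-cmp {F} φ ext (step {G} γ) with extreme-cmp φ ext γ
    ... | inj₂ le = inj₂ λ X x → ⊑-next G X (le X x)
    ... | inj₁ le with ext γ le
    ...   | inj₂ le′ = inj₁ le′
    ...   | inj₁ ge  = inj₂ (subst (λ H → next F ⊑ next H) (⊑-antisym ge le) (λ _ → id))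
    extreme-cmp {F} φ ext (lim C σ) = by-cases
      (λ (h : ∀ G → C ∋ G → G ⊑ F) → inj₁ (⋃-⊑ (F₀⊑ φ) h))
      (λ ¬h → by-cases
        (λ (h : ∃[ G ] (C ∋ G × next F ⊑ G)) → let (G , CG , le) = h in
           inj₂ λ X x → ⊑-⋃ CG X (le X x))
        (λ ¬h′ → ⊥-elim (¬h λ G CG →
           [ id , (λ le → ⊥-elim (¬h′ (G , CG , le))) ]′ (extreme-cmp φ ext (σ G CG)))))

    extreme : ∀ {F} → Stage F → Extreme F
    extreme (step {F} φ) {G} γ le with extreme-cmp φ (extreme φ) γ
    ... | inj₂ ge = inj₁ ge
    ... | inj₁ le′ with extreme φ γ le′
    ...   | inj₂ le″ = inj₂ λ X x → ⊑-next F X (le″ X x)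
    ...   | inj₁ ge  = inj₂ (subst (λ H → next H ⊑ next F) (⊑-antisym ge le′) (λ _ → id))
    extreme (lim C σ) {G} γ le = by-cases
      (λ (h : ∀ F → C ∋ F → F ⊑ G) → inj₁ (⋃-⊑ (F₀⊑ γ) h))
      (λ ¬h → dne λ ¬goal → ¬h λ F CF →
        [ (λ G⊑F → [ id , (λ le′ → ⊥-elim (¬goal (inj₂ λ X x → ⊑-⋃ CF X (le′ X x)))) ]′
                     (extreme (σ F CF) γ G⊑F))
        , (λ le′ X x → le′ X (⊑-next F X x)) ]′
        (extreme-cmp (σ F CF) (extreme (σ F CF)) γ))

    chain : ∀ {F G} → Stage F → Stage G → F ⊑ G ⊎ G ⊑ F
    chain {F} φ γ with extreme-cmp φ (extreme φ) γ
    ... | inj₁ le = inj₂ le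
    ... | inj₂ le = inj₁ λ X x → le X (⊑-next F X x)

    All-⊑ : ∀ {F G : 𝒫 (𝒫 J)} {xs} → F ⊑ G → All (F ∋_) xs → All (G ∋_) xs
    All-⊑ le []       = []
    All-⊑ le (x ∷ xs) = le _ x ∷ All-⊑ le xs

    All-⋃ : ∀ C → (∀ F → C ∋ F → Stage F) → ∀ xs → All (⋃ C ∋_) xs →
            All (F₀ ∋_) xs ⊎ ∃[ F ] (C ∋ F × All (F ∋_) xs)
    All-⋃ C σ [] [] = inj₁ []
    All-⋃ C σ (X ∷ xs) (x ∷ all) with ⌊⌋-elim x | All-⋃ C σ xs all
    ... | inj₁ x₀ | inj₁ rest = inj₁ (x₀ ∷ rest)
    ... | inj₁ x₀ | inj₂ (F , CF , rest) = inj₂ (F , CF , F₀⊑ (σ F CF) X x₀ ∷ rest)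
    ... | inj₂ (F , CF , FX) | inj₁ rest = inj₂ (F , CF , FX ∷ All-⊑ (F₀⊑ (σ F CF)) rest)
    ... | inj₂ (F , CF , FX) | inj₂ (G , CG , rest) with chain (σ F CF) (σ G CG)
    ...   | inj₁ le = inj₂ (G , CG , le X FX ∷ rest)
    ...   | inj₂ le = inj₂ (F , CF , FX ∷ All-⊑ le rest)

    split-adjoin : ∀ F A xs → All (adjoin F A ∋_) xs →
                   ∃[ ys ] (All (F ∋_) ys × (∀ j → All (_∋ j) ys → A ∋ j → All (_∋ j) xs))
    split-adjoin F A [] [] = [] , [] , λ _ _ _ → []
    split-adjoin F A (X ∷ xs) (x ∷ all) with ⌊⌋-elim x | split-adjoin F A xs all
    ... | inj₁ FX   | ys , Fys , h = X ∷ ys , FX ∷ Fys , λ { j (Xj ∷ r) Aj → Xj ∷ h j r Aj }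
    ... | inj₂ refl | ys , Fys , h = ys , Fys , λ j r Aj → Aj ∷ h j r Aj

    stage-FIP : ∀ {F} → Stage F → FIP F
    stage-FIP (step {F} φ) with em {P = Extensible F}
    ... | no _ = stage-FIP φ
    ... | yes (A , _ , cons) = λ xs all →
      let (ys , Fys , h) = split-adjoin F A xs all
          (j , r , Aj)   = cons ys Fys
      in j , h j r Aj
    stage-FIP (lim C σ) xs all with All-⋃ C σ xs all
    ... | inj₁ rest = fip₀ xs rest
    ... | inj₂ (F , CF , rest) = stage-FIP (σ F CF) xs rest

    top : 𝒫 (𝒫 J)
    top = ⋃ (λ F → ⌊ Stage F ⌋)

    top-stage : Stage top
    top-stage = lim _ λ F → ⌊⌋-elim

    next-top⊑top : next top ⊑ top
    next-top⊑top = ⊑-⋃ (⌊⌋-intro (step top-stage))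

    top-maximal : ∀ A → Consistent top A → top ∋ A
    top-maximal A cons = dne λ ¬A → contra (A , ¬A , cons)
      where
      contra : ¬ Extensible top
      contra ext with em {P = Extensible top} | next-top⊑top
      ... | no ¬ext | _ = ¬ext ext
      ... | yes (B , ¬B , _) | le = ¬B (le B (⌊⌋-intro (inj₂ refl)))

  record Ultrafilter {j} (J : Set j) : Set j where
    field
      mem   : 𝒫 (𝒫 J)
      mem-⋂ : ∀ xs A → All (mem ∋_) xs → (∀ j → All (_∋ j) xs → A ∋ j) → mem ∋ A
      mem-∃ : ∀ A → mem ∋ A → ∃[ j ] A ∋ j
      mem-¬ : ∀ A → mem ∋ A ⊎ mem ∋ (not ∘ A)

    U : (J → Set ℓ₁) → Set
    U P = mem ∋ (λ j → ⌊ P j ⌋)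

    module _ {P : J → Set ℓ₁} where

      U-pure : (∀ j → P j) → U P
      U-pure h = mem-⋂ [] _ [] λ j _ → ⌊⌋-intro (h j)

      U-∃ : U P → ∃ P
      U-∃ u = let (j , Pj) = mem-∃ _ u in j , ⌊⌋-elim Pj

      U-map : ∀ {r} {R : J → Set r} → (∀ j → P j → R j) → U P → U R
      U-map h u = mem-⋂ (_ ∷ []) _ (u ∷ []) λ { j (Pj ∷ []) → ⌊⌋-intro (h j (⌊⌋-elim Pj)) }

      U-zip : ∀ {r} {R : J → Set r} → U P → U R → U (λ j → P j × R j)
      U-zip u v = mem-⋂ (_ ∷ _ ∷ []) _ (u ∷ v ∷ []) λ { j (Pj ∷ Rj ∷ []) →
        ⌊⌋-intro (⌊⌋-elim Pj , ⌊⌋-elim Rj) }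

      U-em : ¬ U P → U (λ j → ¬ P j)
      U-em ¬u with mem-¬ (λ j → ⌊ P j ⌋)
      ... | inj₁ u = ⊥-elim (¬u u)
      ... | inj₂ u = mem-⋂ (_ ∷ []) _ (u ∷ []) λ { j (nPj ∷ []) →
        ⌊⌋-intro λ Pj → not-elim nPj (⌊⌋-intro Pj) }

    U-⊥ : ∀ {P : J → Set ℓ₁} → (∀ j → ¬ P j) → ¬ U P
    U-⊥ h u = let (j , Pj) = U-∃ u in h j Pj

    U-map₂ : ∀ {p r s} {P : J → Set p} {R : J → Set r} {S : J → Set s} →
             (∀ j → P j → R j → S j) → U P → U R → U S
    U-map₂ h u v = U-map (λ j (Pj , Rj) → h j Pj Rj) (U-zip u v)

    U-finite : ∀ {k} {P : Fin k → J → Set ℓ₁} → (∀ i → U (P i)) → U (λ j → ∀ i → P i j)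
    U-finite {k = zero}  h = U-pure λ _ ()
    U-finite {k = suc k} h =
      U-map₂ (λ { j P₀ Pₛ zero → P₀ ; j P₀ Pₛ (suc i) → Pₛ i }) (h zero) (U-finite (h ∘ suc))

    U-finite→ : ∀ {k t} {P : (Fin k → Fin t) → J → Set ℓ₁} →
                (∀ l → U (P l)) → U (λ j → ∀ l → P l j)
    U-finite→ {k = zero} {P = P} h =
      U-map (λ j P₀ l → subst (λ z → P z j) (fe λ ()) P₀) (h (λ ()))
    U-finite→ {k = suc k} {P = P} h =
      U-map (λ j Pₛ l → subst (λ z → P z j) (fe λ { zero → refl ; (suc _) → refl })
                              (Pₛ (l zero) (l ∘ suc)))
            (U-finite λ i → U-finite→ λ l → h (i ▹ l))

  ultrafilter : {J : Set ℓ₁} (F₀ : 𝒫 (𝒫 J)) →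
                (∀ xs → All (F₀ ∋_) xs → ∃[ j ] All (_∋ j) xs) →
                Σ[ 𝒰 ∈ Ultrafilter J ] F₀ ⊑ Ultrafilter.mem 𝒰
  ultrafilter F₀ fip₀ = 𝒰 , F₀⊑ top-stage
    where
    open MaximalFilter F₀ fip₀

    closed : ∀ xs A → All (top ∋_) xs → (∀ j → All (_∋ j) xs → A ∋ j) → top ∋ A
    closed xs A all h = top-maximal A λ ys all′ →
      let (j , r)  = stage-FIP top-stage (xs ++ ys) (++⁺ all all′)
          (r₁ , r₂) = ++⁻ xs r
      in j , r₂ , h j r₁

    refute : ∀ A → ¬ top ∋ A → ∃[ xs ] (All (top ∋_) xs × (∀ j → All (_∋ j) xs → not (A j) ≡ true))
    refute A ¬A = dne λ ¬ex → ¬A (top-maximal A λ xs all → dne λ ¬meets →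
      ¬ex (xs , all , λ j r → cong not (≢true⇒false λ Aj → ¬meets (j , r , Aj))))

    𝒰 : Ultrafilter _
    𝒰 = record
      { mem   = top
      ; mem-⋂ = closed
      ; mem-∃ = λ A a → case stage-FIP top-stage (A ∷ []) (a ∷ []) of λ { (j , Aj ∷ []) → j , Aj }
      ; mem-¬ = λ A → by-cases inj₁ λ ¬A → inj₂ (let (xs , all , h) = refute A ¬A in closed xs _ all h)
      }

  cofinite-ultrafilter : Σ[ 𝒰 ∈ Ultrafilter ℕ ] (∀ k → Ultrafilter.U 𝒰 (λ j → k ≤ j))
  cofinite-ultrafilter =
    let (𝒰 , le) = ultrafilter (λ X → ⌊ Tail X ⌋) fip
    in 𝒰 , λ k → le _ (⌊⌋-intro (k , λ j → ⌊⌋-intro))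
    where
    Tail : 𝒫 ℕ → Set
    Tail X = ∃[ k ] (∀ j → k ≤ j → X ∋ j)

    tails : ∀ xs → All (λ X → ⌊ Tail X ⌋ ≡ true) xs → ∃[ k ] (∀ j → k ≤ j → All (_∋ j) xs)
    tails []       []       = 0 , λ _ _ → []
    tails (X ∷ xs) (t ∷ ts) =
      let (k , h)   = ⌊⌋-elim t
          (k′ , h′) = tails xs ts
      in k + k′ , λ j le → h j (≤-trans (m≤m+n k k′) le) ∷ h′ j (≤-trans (m≤n+m k′ k) le)

    fip : ∀ xs → All (λ X → ⌊ Tail X ⌋ ≡ true) xs → ∃[ j ] All (_∋ j) xs
    fip xs ts = let (k , h) = tails xs ts in k , h k ≤-refl

  open RelativizedRepresentation public using (IsSquare; IsSmooth; IsComplete)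

  -- With every Eᵗ the identity, Θ consists of the identity maps of nonempty
  -- cliques, so smoothness is no stronger than squareness.
  module _ {m} {𝔄 : Structure m ℓ} (R : RelativizedRepresentation 𝔄) where
    open RelativizedRepresentation R hiding (IsSquare; IsSmooth)

    square⇒smooth : ∀ {n} → IsSquare R n → IsSmooth R n
    square⇒smooth {n} sq = record
      { square       = sq
      ; E            = λ t → _≡_
      ; E-equiv      = λ t _ _ → record { refl = refl ; sym = sym ; trans = trans }
      ; backAndForth = record
        { partialIso = partialIso
        ; restrict   = restrict
        ; forth      = λ θ t sz t<n x cl → let (θ′ , Θθ′ , ext , a , e) = extend θ t sz t<n x cl
                                           in θ′ , Θθ′ , ext , a , e
        ; back       = λ θ t sz t<n x cl →
            let (θ′ , Θθ′ , ext , a , e) =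
                  extend θ t sz t<n x (λ s h → cl s λ i → [ (λ (b , r) → inj₁ (b , swap θ r)) , inj₂ ]′ (h i))
            in θ′ , Θθ′ , ext , a , swap Θθ′ e
        }
      }
      where
      Θ : Pred PartialMap ℓ
      Θ θ = ∃[ t ] (1 ≤ t × t ≤ n × Σ[ x ∈ CliqueTuple t ] Σ[ y ∈ CliqueTuple t ]
              (proj₁ x ≡ proj₁ y × (∀ a b → θ a b ⇔ (proj₁ x ↦ proj₁ y) a b)))

      diagonal : ∀ {θ} → Θ θ → ∀ {a b} → θ a b → a ≡ b
      diagonal (t , _ , _ , (x , _) , (.x , _) , refl , gr) r
        with Equivalence.to (gr _ _) r
      ... | i , refl , refl = refl

      swap : ∀ {θ} → Θ θ → ∀ {a b} → θ a b → θ b a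
      swap {θ} Θθ r with diagonal Θθ r
      ... | refl = r

      partialIso : ∀ {θ} → Θ θ → IsPartialIsomorphism θ
      partialIso Θθ = record
        { functional = λ r r′ → trans (sym (diagonal Θθ r)) (diagonal Θθ r′)
        ; inj        = λ r r′ → trans (diagonal Θθ r) (sym (diagonal Θθ r′))
        ; preserves  = λ a s s′ h → subst (λ s″ → (s ∈ f a) ⇔ (s″ ∈ f a))
                                          (fe λ i → diagonal Θθ (h i)) (mk⇔ id id)
        }

      restrict : ∀ {θ} → Θ θ → ∀ D → ∃ (Dom (θ ↾ D)) → Θ (θ ↾ D)
      restrict {θ} (t , 1≤t , t≤n , (x , cl) , (.x , _) , refl , gr) D (a , b , Da , r)
        with Equivalence.to (gr _ _) r
      ... | i₀ , refl , refl = t , 1≤t , t≤n , (x′ , cl′) , (x′ , cl′) , refl , λ a b → mk⇔ to from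
        where
        x′ : Fin t → M
        x′ i = by-cases {P = x i ∈ D} (λ _ → x i) (λ _ → x i₀)

        x′-in : ∀ i → x′ i ∈ D × ∃[ j ] x j ≡ x′ i
        x′-in i with em {P = x i ∈ D}
        ... | yes Di = Di , i , refl
        ... | no _   = Da , i₀ , refl

        x′-≡ : ∀ i → x i ∈ D → x′ i ≡ x i
        x′-≡ i Di with em {P = x i ∈ D}
        ... | yes _  = refl
        ... | no ¬Di = ⊥-elim (¬Di Di)

        cl′ : IsClique (Range x′)
        cl′ s h = cl s λ i → let (k , e) = h i ; (_ , j , e′) = x′-in k in j , trans e′ e

        to : ∀ {a b} → (θ ↾ D) a b → (x′ ↦ x′) a b
        to (Da , r) with Equivalence.to (gr _ _) r
        ... | i , refl , refl = i , x′-≡ i Da , x′-≡ i Da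

        from : ∀ {a b} → (x′ ↦ x′) a b → (θ ↾ D) a b
        from (i , refl , refl) = let (Di , j , e) = x′-in i in Di , Equivalence.from (gr _ _) (j , e , e)

      extend : ∀ {θ} → Θ θ → ∀ t → HasSize θ t → t < n → ∀ x → IsClique (Dom θ ∪ ｛ x ｝) →
               ∃[ θ′ ] (Θ θ′ × (∀ {a b} → θ a b → θ′ a b) × x ∈ Dom θ′)
      extend {θ} Θθ t (e , _ , enum) t<n x cl =
        (z ↦ z) , (suc t , s≤s z≤n , t<n , (z , clz) , (z , clz) , refl , λ _ _ → mk⇔ id id)
        , ext , x , zero , refl , refl
        where
        z : Fin (suc t) → M
        z = x ▹ (proj₁ ∘ e)

        z-in : ∀ i → z i ∈ Dom θ ∪ ｛ x ｝
        z-in zero    = inj₂ refl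
        z-in (suc i) = inj₁ (_ , Equivalence.from (enum _ _) (i , refl))

        clz : IsClique (Range z)
        clz s h = cl s λ i → let (k , eq) = h i in subst (_∈ Dom θ ∪ ｛ x ｝) eq (z-in k)

        ext : ∀ {a b} → θ a b → (z ↦ z) a b
        ext r with diagonal Θθ r | Equivalence.to (enum _ _) r
        ... | refl | i , eq = suc i , cong proj₁ eq , cong proj₁ eq

    square-pred : ∀ {n} → IsSquare R (suc (suc n)) → IsSquare R (suc n)
    square-pred sq x cl a i l k k≢ h =
      let (y , cly , off , hy) = sq (x zero ▹ x) cl′ a i (suc ∘ l) (suc k)
                                    (λ j j≢i e → k≢ j j≢i (suc-injective e)) h
      in y ∘ suc
       , (λ s r → cly s λ j → let (b , e) = r j in suc b , e)
       , (λ j j≢k → off (suc j) (j≢k ∘ suc-injective))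
       , subst (_∈ f a) (fe λ j → cong y (updateAt-map suc l i j)) hy
      where
      cl′ : IsClique (Range (x zero ▹ x))
      cl′ s r = cl s λ j → case r j of λ { (zero , e) → zero , e ; (suc b , e) → b , e }

      updateAt-map : ∀ {A B : Set} (g : A → B) {m k} (l : Fin m → A) i j →
                     updateAt (g ∘ l) i (const (g k)) j ≡ g (updateAt l i (const k) j)
      updateAt-map g l zero    zero    = refl
      updateAt-map g l zero    (suc j) = refl
      updateAt-map g l (suc i) zero    = refl
      updateAt-map g l (suc i) (suc j) = updateAt-map g (l ∘ suc) i j

  HasSmooth-pred : ∀ {m n} → HasSmooth {ℓ} m (suc (suc n)) ⊆ HasSmooth m (suc n)
  HasSmooth-pred (ca , R , sm) = ca , R , square⇒smooth R (square-pred R (IsSmooth.square sm))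

  -- Representations from networks

  open Equivalence public using (to; from)

  updateAt-old : ∀ {a} {A : Set a} {m} (l : Fin m → A) {i j} {f : A → A} → j ≢ i → updateAt l i f j ≡ l j
  updateAt-old l j≢i = updateAt-minimal _ _ l j≢i

  other-index : ∀ {k} (i : Fin (suc (suc k))) → ∃[ j ] j ≢ i
  other-index zero    = suc zero , λ ()
  other-index (suc i) = zero , λ ()

  argmax : ∀ {k} (g : Fin (suc k) → ℕ) → ∃[ i ] (∀ j → g j ≤ g i)
  argmax {zero}  g = zero , λ { zero → ≤-refl }
  argmax {suc k} g with argmax (g ∘ suc)
  ... | i , h with ≤-total (g zero) (g (suc i))
  ...   | inj₁ le = suc i , λ { zero → le ; (suc j) → h j }
  ...   | inj₂ le = zero  , λ { zero → ≤-refl ; (suc j) → ≤-trans (h j) le }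

  endo-surjective : ∀ {k} (π : Fin k → Fin k) → (∀ {i j} → π i ≡ π j → i ≡ j) → ∀ a → ∃[ i ] π i ≡ a
  endo-surjective {suc k} π inj a = dne λ ¬hit →
    1+n≰n (injective⇒≤ {f = λ i → punchOut {i = a} {j = π i} (λ e → ¬hit (i , sym e))}
      (λ {i} {j} e → inj (punchOut-injective {i = a} (λ e → ¬hit (i , sym e)) (λ e → ¬hit (j , sym e)) e)))

  mix : ∀ {a} {A : Set a} {k} → ℕ → (Fin k → A) → (Fin k → A) → Fin k → A
  mix t f g b = by-cases {P = toℕ b < t} (λ _ → f b) (λ _ → g b)

  module _ {a} {A : Set a} {k} {f g : Fin k → A} where

    mix-< : ∀ {t b} → toℕ b < t → mix t f g b ≡ f b
    mix-< {t} {b} lt = by-cases-elim {P = toℕ b < t} (_≡ f b) (λ _ → refl) (λ ¬lt → ⊥-elim (¬lt lt))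

    mix-≥ : ∀ {t b} → ¬ toℕ b < t → mix t f g b ≡ g b
    mix-≥ {t} {b} ¬lt = by-cases-elim {P = toℕ b < t} (_≡ g b) (λ lt → ⊥-elim (¬lt lt)) (λ _ → refl)

    mix-zero : mix 0 f g ≡ g
    mix-zero = fe λ b → mix-≥ {0} {b} λ ()

    mix-all : mix k f g ≡ f
    mix-all = fe λ b → mix-< (toℕ<n b)

    mix-suc : ∀ {t b} → (toℕ b ≡ t → f b ≡ g b) → mix t f g b ≡ mix (suc t) f g b
    mix-suc {t} {b} same = by-cases {P = toℕ b < t}
      (λ lt → trans (mix-< lt) (sym (mix-< (m≤n⇒m≤1+n lt))))
      (λ ¬lt → trans (mix-≥ ¬lt) (by-cases {P = toℕ b ≡ t}
        (λ e → trans (sym (same e)) (sym (mix-< (s≤s (subst (_≤ t) (sym e) ≤-refl)))))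
        (λ n → sym (mix-≥ λ lt → n (≤-antisym (s≤s⁻¹ lt) (≮⇒≥ ¬lt))))))

  -- An n-dimensional basis of networks, without any amalgamation property.  The
  -- indices of a network that name the same point are glued.
  record Basis {m} (𝔄 : Structure m ℓ) (n : ℕ) : Set (lsuc ℓ) where
    open Structure 𝔄
    field
      Net     : Set ℓ
      sat     : Net → (Fin m → Fin n) → Carrier → Set
      glue    : Net → Fin n → Fin n → Set
      reindex : Net → (Fin n → Fin n) → Net

    Agree : Fin n → Net → Net → Set ℓ
    Agree k N N′ = ∀ l → (∀ j → l j ≢ k) → ∀ a → sat N l a ⇔ sat N′ l a

    field
      sat-reindex  : ∀ N ρ l a → sat (reindex N ρ) l a ≡ sat N (ρ ∘ l) a
      glue-reindex : ∀ N ρ i j → glue (reindex N ρ) i j ≡ glue N (ρ i) (ρ j)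
      glue-refl    : ∀ N {i} → glue N i i
      glue-sym     : ∀ N {i j} → glue N i j → glue N j i
      sat-glue     : ∀ N {l l′} → (∀ j → glue N (l j) (l′ j)) → ∀ a → sat N l a → sat N l′ a
      sat-≈        : ∀ {N l a b} → a ≈ b → sat N l a → sat N l b
      sat-∨        : ∀ {N l a b} → sat N l (a ∨ b) ⇔ (sat N l a ⊎ sat N l b)
      sat-∧        : ∀ {N l a b} → sat N l (a ∧ b) ⇔ (sat N l a × sat N l b)
      sat--        : ∀ {N l a} → sat N l (- a) ⇔ (¬ sat N l a)
      sat-𝟙        : ∀ {N l} → sat N l 𝟙
      sat-𝟘        : ∀ {N l} → ¬ sat N l 𝟘
      sat-d        : ∀ {N l i j} → sat N l (d i j) ⇔ glue N (l i) (l j)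
      sat-c        : ∀ {N l l′ i a} → (∀ j → j ≢ i → l j ≡ l′ j) → sat N l a → sat N l′ (c i a)
      sat-c-indep  : ∀ {N l l′ i a} → (∀ j → j ≢ i → l j ≡ l′ j) →
                     sat N l (c i a) → sat N l′ (c i a)
      move         : ∀ N l i k a → (∀ j → j ≢ i → k ≢ l j) → sat N l (c i a) →
                     ∃[ N′ ] (Agree k N N′ × sat N′ (updateAt l i (const k)) a)
      faithful     : ∀ {a b} → (∀ N l → sat N l a ⇔ sat N l b) → a ≈ b

  module Unravelling {m₂ n₁} (m≤n : suc (suc m₂) ≤ suc n₁)
                     (𝔄 : Structure (suc (suc m₂)) ℓ) (B : Basis 𝔄 (suc n₁)) where
    open Structure 𝔄
    open Basis B

    private
      m n : ℕ
      m = suc (suc m₂)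
      n = suc n₁

    same-glue : ∀ {N N′} {ρ ρ′ : Fin n → Fin n} i j →
                (∀ a → sat N (ρ ∘ (i ▹ const j)) a ⇔ sat N′ (ρ′ ∘ (i ▹ const j)) a) →
                glue N (ρ i) (ρ j) ⇔ glue N′ (ρ′ i) (ρ′ j)
    same-glue i j h = mk⇔ (λ g → to sat-d (to (h (d zero (suc zero))) (from sat-d g)))
                          (λ g → to sat-d (from (h (d zero (suc zero))) (from sat-d g)))

    agree-glue : ∀ {k N N′} → Agree k N N′ → ∀ i j → i ≢ k → j ≢ k → glue N i j ⇔ glue N′ i j
    agree-glue ag i j i≢k j≢k = same-glue {ρ = id} {id} i j
      (ag (i ▹ const j) λ { zero → i≢k ; (suc _) → j≢k })

    data Node : Net → Set ℓ where
      root : ∀ N → (∀ i j → glue N i j) → Node N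
      step : ∀ {N} → Node N → (ρ : Fin n → Fin n) (k : Fin n) (N′ : Net) →
             Agree k (reindex N ρ) N′ → (∀ j → j ≢ k → ¬ glue N′ j k) → Node N′

    -- A node introduces one point, with which it is identified.
    M : Set ℓ
    M = Σ Net Node

    pt : ∀ {N} → Node N → Fin n → M
    pt (root N g) i = N , root N g
    pt (step C ρ k N′ ag fr) i with i ≟ k
    ... | yes _ = N′ , step C ρ k N′ ag fr
    ... | no _  = pt C (ρ i)

    depth : ∀ {N} → Node N → ℕ
    depth (root _ _)         = 0
    depth (step C _ _ _ _ _) = suc (depth C)

    birth : M → ℕ
    birth (_ , C) = depth C

    module _ {N} (C : Node N) {ρ k N′} (ag : Agree k (reindex N ρ) N′)
             (fr : ∀ j → j ≢ k → ¬ glue N′ j k) where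

      pt-new : pt (step C ρ k N′ ag fr) k ≡ (N′ , step C ρ k N′ ag fr)
      pt-new with k ≟ k
      ... | yes _   = refl
      ... | no k≢k = ⊥-elim (k≢k refl)

      pt-old : ∀ {i} → i ≢ k → pt (step C ρ k N′ ag fr) i ≡ pt C (ρ i)
      pt-old {i} i≢k with i ≟ k
      ... | yes e = ⊥-elim (i≢k e)
      ... | no _  = refl

    birth≤depth : ∀ {N} (C : Node N) i → birth (pt C i) ≤ depth C
    birth≤depth (root N g) i = z≤n
    birth≤depth (step C ρ k N′ ag fr) i with i ≟ k
    ... | yes _ = ≤-refl
    ... | no _  = m≤n⇒m≤1+n (birth≤depth C (ρ i))

    pt≡⇒glue : ∀ {N} (C : Node N) i j → pt C i ≡ pt C j → glue N i j
    pt≡⇒glue (root N g) i j _ = g i j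
    pt≡⇒glue (step {N} C ρ k N′ ag fr) i j e with i ≟ k | j ≟ k
    ... | yes refl | yes refl = glue-refl N′
    ... | yes refl | no j≢k =
      ⊥-elim (<-irrefl refl (subst (λ x → birth x ≤ depth C) (sym e) (birth≤depth C (ρ j))))
    ... | no i≢k | yes refl =
      ⊥-elim (<-irrefl refl (subst (λ x → birth x ≤ depth C) e (birth≤depth C (ρ i))))
    ... | no i≢k | no j≢k =
      to (agree-glue ag i j i≢k j≢k) (subst id (sym (glue-reindex N ρ i j)) (pt≡⇒glue C (ρ i) (ρ j) e))

    glue⇒pt≡ : ∀ {N} (C : Node N) i j → glue N i j → pt C i ≡ pt C j
    glue⇒pt≡ (root N g) i j _ = refl
    glue⇒pt≡ (step {N} C ρ k N′ ag fr) i j h with i ≟ k | j ≟ k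
    ... | yes refl | yes refl = refl
    ... | yes refl | no j≢k = ⊥-elim (fr j j≢k (glue-sym N′ h))
    ... | no i≢k | yes refl = ⊥-elim (fr i i≢k h)
    ... | no i≢k | no j≢k =
      glue⇒pt≡ C (ρ i) (ρ j) (subst id (glue-reindex N ρ i j) (from (agree-glue ag i j i≢k j≢k) h))

    -- All points of a node that are not younger than v are points of the node
    -- of v, with the same types.
    retreat : ∀ {N} (D : Node N) i {t} (l : Fin t → Fin n) →
              let (Nᵥ , C) = pt D i in
              (∀ j → birth (pt D (l j)) ≤ birth (pt D i)) →
              ∃[ l′ ] ((∀ j → pt C (l′ j) ≡ pt D (l j))
                     × (∀ (σ : Fin m → Fin t) a → sat Nᵥ (l′ ∘ σ) a ⇔ sat N (l ∘ σ) a))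
    retreat (root N g) i l h = l , (λ j → refl) , λ σ a → mk⇔ id id
    retreat (step {N} C ρ k N′ ag fr) i l h with i ≟ k
    ... | yes refl = l , (λ j → refl) , λ σ a → mk⇔ id id
    ... | no i≢k =
      let (l′ , e , s) = retreat C (ρ i) (ρ ∘ l) λ j →
                           subst (λ x → birth x ≤ birth (pt C (ρ i))) (old j) (h′ j)
      in l′
       , (λ j → trans (e j) (sym (old j)))
       , λ σ a → let r = ag (l ∘ σ) (λ j → l≢k (σ j)) a
                     q = sat-reindex N ρ (l ∘ σ) a
                 in mk⇔ (λ x → to r (subst id (sym q) (to (s σ a) x)))
                        (λ x → from (s σ a) (subst id q (from r x)))
      where
      h′ : ∀ j → birth (pt (step C ρ k N′ ag fr) (l j)) ≤ birth (pt C (ρ i))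
      h′ = h

      l≢k : ∀ j → l j ≢ k
      l≢k j refl = <-irrefl refl (≤-trans (subst (λ x → birth x ≤ birth (pt C (ρ i))) (pt-new C ag fr) (h′ j))
                                          (birth≤depth C (ρ i)))

      old : ∀ j → pt (step C ρ k N′ ag fr) (l j) ≡ pt C (ρ (l j))
      old j = pt-old C ag fr (l≢k j)

    f : Carrier → Pred (Fin m → M) ℓ
    f a s = ∃[ N ] Σ[ D ∈ Node N ] ∃[ l ] (s ≡ pt D ∘ l × sat N l a)

    V : Pred (Fin m → M) ℓ
    V = f 𝟙

    coherent : ∀ {N N′} (D : Node N) (D′ : Node N′) {l l′ a} →
               pt D ∘ l ≡ pt D′ ∘ l′ → sat N l a → sat N′ l′ a
    coherent D D′ {l} {l′} {a} e x =
      let (i , mx)       = argmax (λ j → birth (pt D (l j)))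
          (l₁ , e₁ , s₁) = retreat D (l i) l mx
          eq j           = cong (λ s → s j) e
          (l₂ , e₂ , s₂) = retreat D′ (l′ i) l′ λ j →
            subst₂ (λ x y → birth x ≤ birth y) (eq j) (eq i) (mx j)
      in to (s₂ id a) (common (eq i) (λ j → trans (e₁ j) (trans (eq j) (sym (e₂ j)))) (from (s₁ id a) x))
      where
      common : ∀ {v w : M} → v ≡ w → ∀ {l₁ l₂} → (∀ j → pt (proj₂ v) (l₁ j) ≡ pt (proj₂ w) (l₂ j)) →
               sat (proj₁ v) l₁ a → sat (proj₁ w) l₂ a
      common {v} refl h = sat-glue (proj₁ v) (λ j → pt≡⇒glue (proj₂ v) _ _ (h j)) a

    f-sat : ∀ {N} (D : Node N) l {a} → f a (pt D ∘ l) → sat N l a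
    f-sat D l (_ , D′ , l′ , e , x) = coherent D′ D (sym e) x

    extend : ∀ {N} (D : Node N) ρ k N′ → Agree k (reindex N ρ) N′ →
             ∃[ N″ ] Σ[ D″ ∈ Node N″ ] ∃[ ρ″ ]
               ((∀ j → j ≢ k → pt D″ (ρ″ j) ≡ pt D (ρ j))
              × (∀ l a → sat N′ l a → sat N″ (ρ″ ∘ l) a) × (∀ l a → sat N″ (ρ″ ∘ l) a → sat N′ l a))
    extend {N} D ρ k N′ ag = by-cases
      (λ { (j₀ , j₀≢k , gl) →
        let κ : Fin n → Fin n
            κ j = by-cases {P = j ≡ k} (λ _ → j₀) (λ _ → j)
            κ≢k : ∀ j → κ j ≢ k
            κ≢k j = κ-prop j (λ x → x ≢ k) (λ _ → j₀≢k) (λ j≢k → j≢k)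
            glκ : ∀ j → glue N′ j (κ j)
            glκ j = κ-prop j (λ x → glue N′ j x) (λ { refl → glue-sym N′ gl }) (λ _ → glue-refl N′)
            both : ∀ l a → sat N (ρ ∘ κ ∘ l) a ⇔ sat N′ (κ ∘ l) a
            both l a = subst (λ T → T ⇔ sat N′ (κ ∘ l) a) (sat-reindex N ρ (κ ∘ l) a)
                             (ag (κ ∘ l) (κ≢k ∘ l) a)
        in N , D , ρ ∘ κ
         , (λ j j≢k → κ-prop j (λ x → pt D (ρ x) ≡ pt D (ρ j)) (λ e → ⊥-elim (j≢k e)) (λ _ → refl))
         , (λ l a x → from (both l a) (sat-glue N′ (glκ ∘ l) a x))
         , (λ l a x → sat-glue N′ (λ j → glue-sym N′ (glκ (l j))) a (to (both l a) x)) })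
      (λ fr → let fr′ : ∀ j → j ≢ k → ¬ glue N′ j k
                  fr′ j j≢k gl = fr (j , j≢k , gl)
              in N′ , step D ρ k N′ ag fr′ , id , (λ j → pt-old D ag fr′) , (λ l a x → x) , (λ l a x → x))
      where
      κ-prop : ∀ {j₀} j {q} (Q : Fin n → Set q) → (j ≡ k → Q j₀) → (j ≢ k → Q j) →
               Q (by-cases {P = j ≡ k} (λ _ → j₀) (λ _ → j))
      κ-prop j Q y n with em {P = j ≡ k}
      ... | yes e  = y e
      ... | no j≢k = n j≢k

    Realised : Net → (Fin n → Fin n) → Set ℓ
    Realised N ρ = ∃[ N′ ] Σ[ D ∈ Node N′ ] ∃[ σ ] (∀ l a → sat N′ (σ ∘ l) a ⇔ sat N (ρ ∘ l) a)

    realise-keep : ∀ N t → t ≤ n → Realised N (mix t id (const zero))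
    realise-keep N zero _ = reindex N (const zero) , root _ g , id , λ l a →
      subst (λ ρ → sat (reindex N (const zero)) l a ⇔ sat N (ρ ∘ l) a) (sym (mix-zero {f = id} {const zero}))
        (subst (λ T → sat (reindex N (const zero)) l a ⇔ T) (sat-reindex N (const zero) l a) (mk⇔ id id))
      where
      g : ∀ i j → glue (reindex N (const zero)) i j
      g i j = subst id (sym (glue-reindex N (const zero) i j)) (glue-refl N)
    realise-keep N (suc t) t<n =
      let (N₁ , D , σ , h) = realise-keep N t (≤-trans (n≤1+n t) t<n)
          ag : Agree k (reindex N₁ σ) N⁺
          ag l l≢k a = subst₂ _⇔_ (sym (sat-reindex N₁ σ l a))
                         (trans (cong (λ z → sat N z a) (fe λ j → mix-suc {f = id} {const zero} λ e → ⊥-elim (l≢k j (at-k e))))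
                                (sym (sat-reindex N (mix (suc t) id (const zero)) l a)))
                         (h l a)
          (N₂ , D₂ , σ₂ , _ , f₁ , f₂) = extend D σ k N⁺ ag
      in N₂ , D₂ , σ₂ , λ l a →
           subst (sat N₂ (σ₂ ∘ l) a ⇔_) (sat-reindex N (mix (suc t) id (const zero)) l a) (mk⇔ (f₂ l a) (f₁ l a))
      where
      k : Fin n
      k = fromℕ< t<n

      N⁺ : Net
      N⁺ = reindex N (mix (suc t) id (const zero))

      at-k : ∀ {i} → toℕ i ≡ t → i ≡ k
      at-k e = toℕ-injective (trans e (sym (toℕ-fromℕ< t<n)))

    realise : ∀ N → Realised N id
    realise N = subst (Realised N) (mix-all {f = id} {const zero}) (realise-keep N n ≤-refl)

    clique⇒node : ∀ {t} (x : Fin (suc t) → M) →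
                  (∀ (s : Fin m → M) → (∀ i → ∃[ j ] x j ≡ s i) → V s) →
                  ∃[ N ] Σ[ D ∈ Node N ] ∃[ l ] x ≡ pt D ∘ l
    clique⇒node x cl =
      let (i , mx) = argmax (λ j → birth (x j))
          (N , D)  = x i
      in N , D , (λ j → proj₁ (inside i mx j)) , fe (λ j → proj₂ (inside i mx j))
      where
      inside : ∀ i → (∀ j → birth (x j) ≤ birth (x i)) → ∀ j → ∃[ a ] x j ≡ pt (proj₂ (x i)) a
      inside i mx j =
        let (N , D , l , e , _) = cl (x i ▹ const (x j)) (λ { zero → i , refl ; (suc _) → j , refl })
            e₀ = cong (λ s → s zero) e
            e₁ = cong (λ s → s (suc zero)) e
            (l′ , q , _) = retreat D (l zero) {1} (λ _ → l (suc zero))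
                             (λ _ → subst₂ (λ y z → birth y ≤ birth z) e₁ e₀ (mx j))
        in l′ zero , trans e₁ (trans (sym (q zero)) (cong (λ v → pt (proj₂ v) (l′ zero)) (sym e₀)))

    missed : ∀ (l : Fin m → Fin n) i → ∃[ k ] (∀ j → j ≢ i → k ≢ l j)
    missed l i = dne λ ¬ex → 1+n≰n (≤-trans m≤n (injective⇒≤ {f = λ k → punchOut (off ¬ex k)} λ {k} {k′} e →
        trans (proj₂ (proj₂ (hit ¬ex k)))
              (trans (cong l (punchOut-injective (off ¬ex k) (off ¬ex k′) e))
                     (sym (proj₂ (proj₂ (hit ¬ex k′)))))))
      where
      hit : ¬ (∃[ k ] (∀ j → j ≢ i → k ≢ l j)) → ∀ k → ∃[ j ] (j ≢ i × k ≡ l j)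
      hit ¬ex k = dne λ ¬hit → ¬ex (k , λ j j≢i e → ¬hit (j , j≢i , e))

      off : (¬ex : ¬ (∃[ k ] (∀ j → j ≢ i → k ≢ l j))) → ∀ k → i ≢ proj₁ (hit ¬ex k)
      off ¬ex k e = proj₁ (proj₂ (hit ¬ex k)) (sym e)

    node-clique : ∀ {N} (D : Node N) {t} (l : Fin t → Fin n) (s : Fin m → M) →
                  (∀ i → ∃[ j ] pt D (l j) ≡ s i) → V s
    node-clique D l s h = _ , D , (λ i → l (proj₁ (h i))) , fe (λ i → sym (proj₂ (h i))) , sat-𝟙

    extend-move : ∀ {N} (D : Node N) ρ l i k a → (∀ j → j ≢ i → k ≢ l j) → sat N (ρ ∘ l) (c i a) →
                  ∃[ N″ ] Σ[ D″ ∈ Node N″ ] ∃[ ρ″ ]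
                    ((∀ j → j ≢ k → pt D″ (ρ″ j) ≡ pt D (ρ j)) × sat N″ (ρ″ ∘ updateAt l i (const k)) a)
    extend-move {N} D ρ l i k a k≢ x =
      let (N′ , ag , y) = move (reindex N ρ) l i k a k≢ (subst id (sym (sat-reindex N ρ l (c i a))) x)
          (N″ , D″ , ρ″ , old , f₁ , _) = extend D ρ k N′ ag
      in N″ , D″ , ρ″ , old , f₁ _ a y

    representation : RelativizedRepresentation 𝔄
    representation = record
      { M         = M
      ; V         = V
      ; f         = f
      ; cover     = cover
      ; f-⊆       = λ a (N , D , l , e , _) → N , D , l , e , sat-𝟙
      ; f-cong    = λ e → (λ (N , D , l , q , x) → N , D , l , q , sat-≈ e x)
                        , (λ (N , D , l , q , x) → N , D , l , q , sat-≈ (IsEquivalence.sym isEquivalence e) x)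
      ; injective = λ (to′ , from′) → faithful λ N l →
          let (N′ , D , σ , h) = realise N
          in mk⇔ (λ x → to (h l _) (f-sat D (σ ∘ l) (to′ (_ , D , σ ∘ l , refl , from (h l _) x))))
                 (λ x → to (h l _) (f-sat D (σ ∘ l) (from′ (_ , D , σ ∘ l , refl , from (h l _) x))))
      ; f-∨       = λ a b →
          (λ (N , D , l , e , x) → [ (λ y → inj₁ (N , D , l , e , y)) , (λ y → inj₂ (N , D , l , e , y)) ]′ (to sat-∨ x))
        , [ (λ (N , D , l , e , x) → N , D , l , e , from sat-∨ (inj₁ x))
          , (λ (N , D , l , e , x) → N , D , l , e , from sat-∨ (inj₂ x)) ]′
      ; f-∧       = λ a b →
          (λ (N , D , l , e , x) → (N , D , l , e , proj₁ (to sat-∧ x)) , (N , D , l , e , proj₂ (to sat-∧ x)))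
        , λ { ((N , D , l , refl , x) , y) → N , D , l , refl , from sat-∧ (x , f-sat D l y) }
      ; f--       = λ a →
          (λ { (N , D , l , refl , x) → (N , D , l , refl , sat-𝟙) , λ y → to sat-- x (f-sat D l y) })
        , λ { ((N , D , l , refl , _) , ¬y) → N , D , l , refl , from sat-- (λ x → ¬y (N , D , l , refl , x)) }
      ; f-𝟙       = id , id
      ; f-𝟘       = (λ (N , D , l , e , x) → ⊥-elim (sat-𝟘 x)) , λ ()
      ; f-c       = λ i a → f-c₁ i a , f-c₂ i a
      ; f-d       = λ i j →
          (λ { (N , D , l , refl , x) → (N , D , l , refl , sat-𝟙) , glue⇒pt≡ D _ _ (to sat-d x) })
        , λ { ((N , D , l , refl , _) , e) → N , D , l , refl , from sat-d (pt≡⇒glue D _ _ e) }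
      }
      where
      self : ∀ {N} (D : Node N) → ∃[ k ] pt D k ≡ (N , D)
      self (root N g)           = zero , refl
      self (step C ρ k N′ ag fr) = k , pt-new C ag fr

      cover : ∀ x → ∃[ s ] (s ∈ V × (∃[ i ] s i ≡ x))
      cover (N , D) = let (k , e) = self D in const (pt D k) , (N , D , const k , refl , sat-𝟙) , zero , e

      f-c₁ : ∀ i a {s} → s ∈ f (c i a) →
             s ∈ V × ∃[ t ] (t ∈ f a × (∀ j → j ≢ i → t j ≡ s j))
      f-c₁ i a (N , D , l , refl , x) =
        let (k , k≢) = missed l i
            (N″ , D″ , ρ″ , old , y) = extend-move D id l i k a k≢ x
        in (N , D , l , refl , sat-𝟙)
         , pt D″ ∘ ρ″ ∘ updateAt l i (const k) , (N″ , D″ , _ , refl , y)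
         , λ j j≢i → trans (cong (pt D″ ∘ ρ″) (updateAt-old l j≢i)) (old (l j) λ e → k≢ j j≢i (sym e))

      f-c₂ : ∀ i a {s} → s ∈ V × (∃[ t ] (t ∈ f a × (∀ j → j ≢ i → t j ≡ s j))) → s ∈ f (c i a)
      f-c₂ i a ((N , D , l , refl , _) , t , (N′ , D′ , l′ , refl , x) , e) =
        let (i₀ , i₀≢i) = other-index i
            e′ : pt D′ ∘ updateAt l′ i (const (l′ i₀)) ≡ pt D ∘ updateAt l i (const (l i₀))
            e′ = fe λ j → by-cases {P = j ≡ i}
              (λ { refl → trans (cong (pt D′) (updateAt-updates j l′))
                          (trans (e i₀ i₀≢i) (cong (pt D) (sym (updateAt-updates j l)))) })
              (λ j≢i → trans (cong (pt D′) (updateAt-old l′ j≢i))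
                       (trans (e j j≢i) (cong (pt D) (sym (updateAt-old l j≢i)))))
        in N , D , l , refl
         , sat-c-indep (λ j j≢i → updateAt-old l j≢i)
             (coherent D′ D e′ (sat-c (λ j j≢i → sym (updateAt-old l′ j≢i)) x))

    square : IsSquare representation n
    square x cl a i l k k≢ h with clique⇒node x cl
    ... | N , D , ρ , refl =
      let (N″ , D″ , ρ″ , old , y) = extend-move D ρ l i k a k≢ (f-sat D (ρ ∘ l) h)
      in pt D″ ∘ ρ″ , node-clique D″ ρ″ , old , (N″ , D″ , _ , refl , y)

    V-clique : ∀ {s} → s ∈ V → RelativizedRepresentation.IsClique representation
                                 (RelativizedRepresentation.Range representation s)
    V-clique (N , D , l , refl , _) = node-clique D l

    complete : (∀ N l → ∃[ a ] (sat N l a × (∀ b → ¬ sat N l b → b ≼ (- a)))) → IsComplete representation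
    complete atom S a (upper , least) = below , above
      where
      ≼-sat : ∀ {N l a b} → a ≼ b → sat N l a → sat N l b
      ≼-sat le x = sat-≈ le (from sat-∨ (inj₁ x))

      above : ∀ {s} → ∃[ b ] (b ∈ S × s ∈ f b) → s ∈ f a
      above (b , bS , N , D , l , e , x) = N , D , l , e , ≼-sat (upper b bS) x

      below : ∀ {s} → s ∈ f a → ∃[ b ] (b ∈ S × s ∈ f b)
      below (N , D , l , refl , x) = dne λ ¬ex →
        let (α , αx , below-α) = atom N l
        in to sat-- (≼-sat (least (- α) λ b bS → below-α b λ y → ¬ex (b , bS , N , D , l , refl , y)) x) αx

  -- The axioms of cylindric algebras

  data Axiom {m} : Equation m → Set where
    ∨-comm  : Axiom (var 0 ∨ᵗ var 1 , var 1 ∨ᵗ var 0)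
    ∨-assoc : Axiom ((var 0 ∨ᵗ var 1) ∨ᵗ var 2 , var 0 ∨ᵗ (var 1 ∨ᵗ var 2))
    ∧-comm  : Axiom (var 0 ∧ᵗ var 1 , var 1 ∧ᵗ var 0)
    ∧-assoc : Axiom ((var 0 ∧ᵗ var 1) ∧ᵗ var 2 , var 0 ∧ᵗ (var 1 ∧ᵗ var 2))
    ∨-abs   : Axiom (var 0 ∨ᵗ (var 0 ∧ᵗ var 1) , var 0)
    ∧-abs   : Axiom (var 0 ∧ᵗ (var 0 ∨ᵗ var 1) , var 0)
    ∨-distˡ : Axiom (var 0 ∨ᵗ (var 1 ∧ᵗ var 2) , (var 0 ∨ᵗ var 1) ∧ᵗ (var 0 ∨ᵗ var 2))
    ∨-distʳ : Axiom ((var 1 ∧ᵗ var 2) ∨ᵗ var 0 , (var 1 ∨ᵗ var 0) ∧ᵗ (var 2 ∨ᵗ var 0))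
    ∧-distˡ : Axiom (var 0 ∧ᵗ (var 1 ∨ᵗ var 2) , (var 0 ∧ᵗ var 1) ∨ᵗ (var 0 ∧ᵗ var 2))
    ∧-distʳ : Axiom ((var 1 ∨ᵗ var 2) ∧ᵗ var 0 , (var 1 ∧ᵗ var 0) ∨ᵗ (var 2 ∧ᵗ var 0))
    ∨-invˡ  : Axiom ((-ᵗ var 0) ∨ᵗ var 0 , 𝟙ᵗ)
    ∨-invʳ  : Axiom (var 0 ∨ᵗ (-ᵗ var 0) , 𝟙ᵗ)
    ∧-invˡ  : Axiom ((-ᵗ var 0) ∧ᵗ var 0 , 𝟘ᵗ)
    ∧-invʳ  : Axiom (var 0 ∧ᵗ (-ᵗ var 0) , 𝟘ᵗ)
    c-𝟘     : ∀ i → Axiom (cᵗ i 𝟘ᵗ , 𝟘ᵗ)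
    c-incr  : ∀ i → Axiom (var 0 ∨ᵗ cᵗ i (var 0) , cᵗ i (var 0))
    c-∧     : ∀ i → Axiom (cᵗ i (var 0 ∧ᵗ cᵗ i (var 1)) , cᵗ i (var 0) ∧ᵗ cᵗ i (var 1))
    c-comm  : ∀ i j → Axiom (cᵗ i (cᵗ j (var 0)) , cᵗ j (cᵗ i (var 0)))
    d-refl  : ∀ i → Axiom (dᵗ i i , 𝟙ᵗ)
    d-comp  : ∀ i j k → k ≢ i → k ≢ j → Axiom (dᵗ i j , cᵗ k (dᵗ i k ∧ᵗ dᵗ k j))
    d-sep   : ∀ i j → i ≢ j →
              Axiom (cᵗ i (dᵗ i j ∧ᵗ var 0) ∧ᵗ cᵗ i (dᵗ i j ∧ᵗ (-ᵗ var 0)) , 𝟘ᵗ)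

  module _ {m} (𝔄 : Structure m ℓ) where
    open Structure 𝔄

    private
      infixr 5 _⹁_
      _⹁_ : Carrier → (ℕ → Carrier) → ℕ → Carrier
      (a ⹁ ρ) zero    = a
      (a ⹁ ρ) (suc n) = ρ n

      ε : ℕ → Carrier
      ε = const 𝟙

    axioms⇒IsCA : (∀ e → Axiom e → 𝔄 ⊨ᵉ e) → IsCA 𝔄
    axioms⇒IsCA ax = record
      { isBooleanAlgebra = record
        { isDistributiveLattice = record
          { isLattice = record
            { isEquivalence = isEquivalence
            ; ∨-comm     = λ x y → ax _ ∨-comm (x ⹁ y ⹁ ε)
            ; ∨-assoc    = λ x y z → ax _ ∨-assoc (x ⹁ y ⹁ z ⹁ ε)
            ; ∨-cong     = ∨-cong
            ; ∧-comm     = λ x y → ax _ ∧-comm (x ⹁ y ⹁ ε)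
            ; ∧-assoc    = λ x y z → ax _ ∧-assoc (x ⹁ y ⹁ z ⹁ ε)
            ; ∧-cong     = ∧-cong
            ; absorptive = (λ x y → ax _ ∨-abs (x ⹁ y ⹁ ε)) , (λ x y → ax _ ∧-abs (x ⹁ y ⹁ ε))
            }
          ; ∨-distrib-∧ = (λ x y z → ax _ ∨-distˡ (x ⹁ y ⹁ z ⹁ ε)) , (λ x y z → ax _ ∨-distʳ (x ⹁ y ⹁ z ⹁ ε))
          ; ∧-distrib-∨ = (λ x y z → ax _ ∧-distˡ (x ⹁ y ⹁ z ⹁ ε)) , (λ x y z → ax _ ∧-distʳ (x ⹁ y ⹁ z ⹁ ε))
          }
        ; ∨-complement = (λ x → ax _ ∨-invˡ (x ⹁ ε)) , (λ x → ax _ ∨-invʳ (x ⹁ ε))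
        ; ∧-complement = (λ x → ax _ ∧-invˡ (x ⹁ ε)) , (λ x → ax _ ∧-invʳ (x ⹁ ε))
        ; ¬-cong       = -‿cong
        }
      ; c-𝟘    = λ i → ax _ (c-𝟘 i) ε
      ; c-incr = λ i x → ax _ (c-incr i) (x ⹁ ε)
      ; c-∧    = λ i x y → ax _ (c-∧ i) (x ⹁ y ⹁ ε)
      ; c-comm = λ i j x → ax _ (c-comm i j) (x ⹁ ε)
      ; d-refl = λ i → ax _ (d-refl i) ε
      ; d-comp = λ i j k k≢i k≢j → ax _ (d-comp i j k k≢i k≢j) ε
      ; d-sep  = λ i j x i≢j → ax _ (d-sep i j i≢j) (x ⹁ ε)
      }

    IsCA⇒axioms : IsCA 𝔄 → ∀ e → Axiom e → 𝔄 ⊨ᵉ e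
    IsCA⇒axioms ca _ = λ where
        ∨-comm ρ               → BA.∨-comm _ _
        ∨-assoc ρ              → BA.∨-assoc _ _ _
        ∧-comm ρ               → BA.∧-comm _ _
        ∧-assoc ρ              → BA.∧-assoc _ _ _
        ∨-abs ρ                → BA.∨-absorbs-∧ _ _
        ∧-abs ρ                → BA.∧-absorbs-∨ _ _
        ∨-distˡ ρ              → BA.∨-distribˡ-∧ _ _ _
        ∨-distʳ ρ              → BA.∨-distribʳ-∧ _ _ _
        ∧-distˡ ρ              → BA.∧-distribˡ-∨ _ _ _
        ∧-distʳ ρ              → BA.∧-distribʳ-∨ _ _ _
        ∨-invˡ ρ               → BA.∨-complementˡ _
        ∨-invʳ ρ               → BA.∨-complementʳ _
        ∧-invˡ ρ               → BA.∧-complementˡ _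
        ∧-invʳ ρ               → BA.∧-complementʳ _
        (c-𝟘 i) ρ              → IsCA.c-𝟘 ca i
        (c-incr i) ρ           → IsCA.c-incr ca i _
        (c-∧ i) ρ              → IsCA.c-∧ ca i _ _
        (c-comm i j) ρ         → IsCA.c-comm ca i j _
        (d-refl i) ρ           → IsCA.d-refl ca i
        (d-comp i j k k≢i k≢j) ρ → IsCA.d-comp ca i j k k≢i k≢j
        (d-sep i j i≢j) ρ      → IsCA.d-sep ca i j _ i≢j
      where
      module BA = IsBooleanAlgebra (IsCA.isBooleanAlgebra ca)

  module _ {m} {𝔄 : Structure m ℓ} (R : RelativizedRepresentation 𝔄) where
    open Structure 𝔄
    open RelativizedRepresentation R hiding (IsSquare)

    -- In an (m+1)-square representation c_i c_j ⊆ c_j c_i: after the i-th point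
    -- has been chosen as a spare point, the original j-th point is free to move.
    square⇒IsCA : ∀ {n} → suc m ≤ n → IsSquare R n → (∀ {s} → s ∈ V → IsClique (Range s)) → IsCA 𝔄
    square⇒IsCA {n} m<n sq V-clique = axioms⇒IsCA 𝔄 λ e ax ρ → law ax ρ
      where
      ≈-refl : ∀ {a} → a ≈ a
      ≈-refl = IsEquivalence.refl isEquivalence

      V? : ∀ {a s} → s ∈ f a → s ∈ V
      V? {a} = f-⊆ a

      pointwise : ∀ {a b} → (∀ {s} → s ∈ V → s ∈ f a ⇔ s ∈ f b) → a ≈ b
      pointwise h = injective ((λ x → to (h (V? x)) x) , (λ x → from (h (V? x)) x))

      χ : (Fin m → M) → Carrier → Bool
      χ s a = ⌊ s ∈ f a ⌋

      by-χ : ∀ {a b} → (∀ {s} → s ∈ V → χ s a ≡ χ s b) → a ≈ b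
      by-χ h = pointwise λ v → mk⇔ (λ x → ⌊⌋-elim (trans (sym (h v)) (⌊⌋-intro x)))
                                   (λ x → ⌊⌋-elim (trans (h v) (⌊⌋-intro x)))

      χ-∨ : ∀ {s} a b → χ s (a ∨ b) ≡ χ s a Bool.∨ χ s b
      χ-∨ {s} a b with em {P = s ∈ f a} | em {P = s ∈ f b}
      ... | yes x | _     = ⌊⌋-intro (proj₂ (f-∨ a b) (inj₁ x))
      ... | no _  | yes y = ⌊⌋-intro (proj₂ (f-∨ a b) (inj₂ y))
      ... | no ¬x | no ¬y = ⌊⌋-false λ z → [ ¬x , ¬y ]′ (proj₁ (f-∨ a b) z)

      χ-∧ : ∀ {s} a b → χ s (a ∧ b) ≡ χ s a Bool.∧ χ s b
      χ-∧ {s} a b with em {P = s ∈ f a} | em {P = s ∈ f b}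
      ... | yes x | yes y = ⌊⌋-intro (proj₂ (f-∧ a b) (x , y))
      ... | yes _ | no ¬y = ⌊⌋-false λ z → ¬y (proj₂ (proj₁ (f-∧ a b) z))
      ... | no ¬x | _     = ⌊⌋-false λ z → ¬x (proj₁ (proj₁ (f-∧ a b) z))

      χ-- : ∀ {s} → s ∈ V → ∀ a → χ s (- a) ≡ not (χ s a)
      χ-- {s} v a with em {P = s ∈ f a}
      ... | yes x = ⌊⌋-false λ z → proj₂ (proj₁ (f-- a) z) x
      ... | no ¬x = ⌊⌋-intro (proj₂ (f-- a) (v , ¬x))

      χ-𝟙 : ∀ {s} → s ∈ V → χ s 𝟙 ≡ true
      χ-𝟙 v = ⌊⌋-intro (proj₂ f-𝟙 v)

      χ-𝟘 : ∀ {s} → χ s 𝟘 ≡ false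
      χ-𝟘 = ⌊⌋-false λ x → proj₁ f-𝟘 x

      c-⊆ : ∀ i j a → f (c i (c j a)) ⊆ f (c j (c i a))
      c-⊆ i j a {s} h with i ≟ j
      ... | yes refl = h
      ... | no i≢j =
        let (y , cly , offy , hy) = sq x clx (c j a) i ι k (λ b _ → k≢ι b)
                                       (subst (_∈ f (c i (c j a))) (fe λ b → sym (xι b)) h)
            (z , clz , offz , hz) = sq y cly a j (updateAt ι i (const k)) (ι j)
              (λ b b≢j → l≢ b b≢j)
              hy
            t = z ∘ ι
            e : ∀ b → b ≢ j → t b ≡ s b
            e b b≢j = trans (offz (ι b) (λ q → b≢j (inject≤-injective _ _ b j q)))
                            (trans (offy (ι b) (λ q → k≢ι b (sym q))) (xι b))
            t∈ : t ∈ f (c i a)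
            t∈ = proj₂ (f-c i a) (clz t (λ b → ι b , refl) , _ , hz′ z hz
                                 , λ b b≢i → cong z (updateAt-old ι b≢i))
        in proj₂ (f-c j (c i a)) (V? h , t , t∈ , e)
        where
        ι : Fin m → Fin n
        ι b = inject≤ b (≤-trans (n≤1+n m) m<n)

        k : Fin n
        k = fromℕ< m<n

        k≢ι : ∀ b → k ≢ ι b
        k≢ι b e = <-irrefl (trans (sym (toℕ-inject≤ b _)) (trans (sym (cong toℕ e)) (toℕ-fromℕ< m<n))) (toℕ<n b)

        x : Fin n → M
        x a = by-cases {P = ∃[ b ] ι b ≡ a} (λ (b , _) → s b) (λ _ → s i)

        xι : ∀ b → x (ι b) ≡ s b
        xι b with em {P = ∃[ b′ ] ι b′ ≡ ι b}
        ... | yes (b′ , e) = cong s (inject≤-injective _ _ b′ b e)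
        ... | no ¬e = ⊥-elim (¬e (b , refl))

        clx : IsClique (Range x)
        clx t r = V-clique (V? h) t λ b → let (a , e) = r b in let (b′ , e′) = in-s a in b′ , trans e′ e
          where
          in-s : ∀ a → ∃[ b ] s b ≡ x a
          in-s a with em {P = ∃[ b ] ι b ≡ a}
          ... | yes (b , _) = b , refl
          ... | no _ = i , refl

        l≢ : ∀ b → b ≢ j → ι j ≢ updateAt ι i (const k) b
        l≢ b b≢j e = by-cases {P = b ≡ i}
          (λ { refl → k≢ι j (sym (trans e (updateAt-updates b ι))) })
          (λ b≢i → b≢j (sym (inject≤-injective _ _ j b (trans e (updateAt-old ι b≢i)))))

        hz′ : ∀ z → z ∘ updateAt (updateAt ι i (const k)) j (const (ι j)) ∈ f a →
              z ∘ updateAt ι i (const k) ∈ f a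
        hz′ z = subst (_∈ f a) (fe λ b → cong z (by-cases {P = b ≡ j}
          (λ { refl → trans (updateAt-updates b _) (sym (updateAt-old ι (λ e → i≢j (sym e)))) })
          (λ b≢j → updateAt-old (updateAt ι i (const k)) b≢j)))

      law : ∀ {e} → Axiom e → 𝔄 ⊨ᵉ e
      law ∨-comm ρ = by-χ λ {s} v → trans (χ-∨ a b) (trans (Boolₚ.∨-comm (χ s a) (χ s b)) (sym (χ-∨ b a)))
        where a = ρ 0 ; b = ρ 1
      law ∨-assoc ρ = by-χ h
        where
        a = ρ 0 ; b = ρ 1 ; z = ρ 2
        h : ∀ {s} → s ∈ V → χ s ((a ∨ b) ∨ z) ≡ χ s (a ∨ (b ∨ z))
        h {s} v rewrite χ-∨ {s} (a ∨ b) z | χ-∨ {s} a b | χ-∨ {s} a (b ∨ z) | χ-∨ {s} b z = Boolₚ.∨-assoc (χ s a) _ _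
      law ∧-comm ρ = by-χ λ {s} v → trans (χ-∧ a b) (trans (Boolₚ.∧-comm (χ s a) (χ s b)) (sym (χ-∧ b a)))
        where a = ρ 0 ; b = ρ 1
      law ∧-assoc ρ = by-χ h
        where
        a = ρ 0 ; b = ρ 1 ; z = ρ 2
        h : ∀ {s} → s ∈ V → χ s ((a ∧ b) ∧ z) ≡ χ s (a ∧ (b ∧ z))
        h {s} v rewrite χ-∧ {s} (a ∧ b) z | χ-∧ {s} a b | χ-∧ {s} a (b ∧ z) | χ-∧ {s} b z = Boolₚ.∧-assoc (χ s a) _ _
      law ∨-abs ρ = by-χ h
        where
        a = ρ 0 ; b = ρ 1
        h : ∀ {s} → s ∈ V → χ s (a ∨ (a ∧ b)) ≡ χ s a
        h {s} v rewrite χ-∨ {s} a (a ∧ b) | χ-∧ {s} a b = Boolₚ.∨-abs-∧ (χ s a) _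
      law ∧-abs ρ = by-χ h
        where
        a = ρ 0 ; b = ρ 1
        h : ∀ {s} → s ∈ V → χ s (a ∧ (a ∨ b)) ≡ χ s a
        h {s} v rewrite χ-∧ {s} a (a ∨ b) | χ-∨ {s} a b = Boolₚ.∧-abs-∨ (χ s a) _
      law ∨-distˡ ρ = by-χ h
        where
        a = ρ 0 ; b = ρ 1 ; z = ρ 2
        h : ∀ {s} → s ∈ V → χ s (a ∨ (b ∧ z)) ≡ χ s ((a ∨ b) ∧ (a ∨ z))
        h {s} v rewrite χ-∨ {s} a (b ∧ z) | χ-∧ {s} b z | χ-∧ {s} (a ∨ b) (a ∨ z) | χ-∨ {s} a b | χ-∨ {s} a z =
          Boolₚ.∨-distribˡ-∧ (χ s a) _ _
      law ∨-distʳ ρ = by-χ h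
        where
        a = ρ 0 ; b = ρ 1 ; z = ρ 2
        h : ∀ {s} → s ∈ V → χ s ((b ∧ z) ∨ a) ≡ χ s ((b ∨ a) ∧ (z ∨ a))
        h {s} v rewrite χ-∨ {s} (b ∧ z) a | χ-∧ {s} b z | χ-∧ {s} (b ∨ a) (z ∨ a) | χ-∨ {s} b a | χ-∨ {s} z a =
          Boolₚ.∨-distribʳ-∧ (χ s a) (χ s b) (χ s z)
      law ∧-distˡ ρ = by-χ h
        where
        a = ρ 0 ; b = ρ 1 ; z = ρ 2
        h : ∀ {s} → s ∈ V → χ s (a ∧ (b ∨ z)) ≡ χ s ((a ∧ b) ∨ (a ∧ z))
        h {s} v rewrite χ-∧ {s} a (b ∨ z) | χ-∨ {s} b z | χ-∨ {s} (a ∧ b) (a ∧ z) | χ-∧ {s} a b | χ-∧ {s} a z =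
          Boolₚ.∧-distribˡ-∨ (χ s a) _ _
      law ∧-distʳ ρ = by-χ h
        where
        a = ρ 0 ; b = ρ 1 ; z = ρ 2
        h : ∀ {s} → s ∈ V → χ s ((b ∨ z) ∧ a) ≡ χ s ((b ∧ a) ∨ (z ∧ a))
        h {s} v rewrite χ-∧ {s} (b ∨ z) a | χ-∨ {s} b z | χ-∨ {s} (b ∧ a) (z ∧ a) | χ-∧ {s} b a | χ-∧ {s} z a =
          Boolₚ.∧-distribʳ-∨ (χ s a) (χ s b) (χ s z)
      law ∨-invˡ ρ = by-χ λ {s} v → trans (χ-∨ (- ρ 0) (ρ 0)) (trans (cong (Bool._∨ χ s (ρ 0)) (χ-- v (ρ 0)))
                       (trans (Boolₚ.∨-inverseˡ (χ s (ρ 0))) (sym (χ-𝟙 v))))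
      law ∨-invʳ ρ = by-χ λ {s} v → trans (χ-∨ (ρ 0) (- ρ 0)) (trans (cong (χ s (ρ 0) Bool.∨_) (χ-- v (ρ 0)))
                       (trans (Boolₚ.∨-inverseʳ (χ s (ρ 0))) (sym (χ-𝟙 v))))
      law ∧-invˡ ρ = by-χ λ {s} v → trans (χ-∧ (- ρ 0) (ρ 0)) (trans (cong (Bool._∧ χ s (ρ 0)) (χ-- v (ρ 0)))
                       (trans (Boolₚ.∧-inverseˡ (χ s (ρ 0))) (sym χ-𝟘)))
      law ∧-invʳ ρ = by-χ λ {s} v → trans (χ-∧ (ρ 0) (- ρ 0)) (trans (cong (χ s (ρ 0) Bool.∧_) (χ-- v (ρ 0)))
                       (trans (Boolₚ.∧-inverseʳ (χ s (ρ 0))) (sym χ-𝟘)))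
      law (c-𝟘 i) ρ = pointwise λ v → mk⇔
        (λ x → let (_ , t , t∈ , _) = proj₁ (f-c i 𝟘) x in ⊥-elim (proj₁ f-𝟘 t∈))
        (λ x → ⊥-elim (proj₁ f-𝟘 x))
      law (c-incr i) ρ = pointwise λ v → mk⇔
        (λ x → [ (λ y → proj₂ (f-c i (ρ 0)) (v , _ , y , λ _ _ → refl)) , id ]′ (proj₁ (f-∨ _ _) x))
        (λ x → proj₂ (f-∨ _ _) (inj₂ x))
      law (c-∧ i) ρ = pointwise λ v → mk⇔
        (λ x → let (_ , t , t∈ , e)     = proj₁ (f-c i _) x
                   (t₀ , t₁)            = proj₁ (f-∧ _ _) t∈
                   (_ , u , u∈ , e′)    = proj₁ (f-c i _) t₁
               in proj₂ (f-∧ _ _) (proj₂ (f-c i _) (v , t , t₀ , e)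
                                 , proj₂ (f-c i _) (v , u , u∈ , λ j j≢i → trans (e′ j j≢i) (e j j≢i))))
        (λ x → let (x₀ , x₁)          = proj₁ (f-∧ _ _) x
                   (_ , t , t∈ , e)   = proj₁ (f-c i _) x₀
                   (_ , u , u∈ , e′)  = proj₁ (f-c i _) x₁
               in proj₂ (f-c i _) (v , t , proj₂ (f-∧ _ _) (t∈ , proj₂ (f-c i _)
                    (V? t∈ , u , u∈ , λ j j≢i → trans (e′ j j≢i) (sym (e j j≢i)))) , e))
      law (c-comm i j) ρ = injective (c-⊆ i j (ρ 0) , c-⊆ j i (ρ 0))
      law (d-refl i) ρ = pointwise λ v → mk⇔ (λ _ → proj₂ f-𝟙 v) (λ _ → proj₂ (f-d i i) (v , refl))
      law (d-comp i j k k≢i k≢j) ρ = pointwise λ {s} v → mk⇔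
        (λ x → let (_ , e) = proj₁ (f-d i j) x
                   t  = updateAt s k (const (s i))
                   tk = updateAt-updates k s
                   ti = updateAt-old s {f = const (s i)} (λ q → k≢i (sym q))
                   tj = updateAt-old s {f = const (s i)} (λ q → k≢j (sym q))
                   tV : t ∈ V
                   tV = V-clique v t λ b → by-cases {P = b ≡ k}
                          (λ { refl → i , sym tk })
                          (λ b≢k → b , sym (updateAt-old s b≢k))
               in proj₂ (f-c k _) (v , t , proj₂ (f-∧ _ _) (proj₂ (f-d i k) (tV , trans ti (sym tk))
                                                          , proj₂ (f-d k j) (tV , trans tk (trans e (sym tj))))
                                  , λ b b≢k → updateAt-old s b≢k))
        (λ x → let (_ , t , t∈ , e) = proj₁ (f-c k _) x
                   (t₀ , t₁) = proj₁ (f-∧ _ _) t∈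
               in proj₂ (f-d i j) (v , trans (sym (e i (λ q → k≢i (sym q))))
                    (trans (proj₂ (proj₁ (f-d i k) t₀)) (trans (proj₂ (proj₁ (f-d k j) t₁)) (e j (λ q → k≢j (sym q)))))))
      law (d-sep i j i≢j) ρ = pointwise λ {s} v → mk⇔
        (λ x → let (x₀ , x₁)         = proj₁ (f-∧ _ _) x
                   (_ , t , t∈ , e)  = proj₁ (f-c i _) x₀
                   (_ , u , u∈ , e′) = proj₁ (f-c i _) x₁
                   (td , ta)         = proj₁ (f-∧ _ _) t∈
                   (ud , ua)         = proj₁ (f-∧ _ _) u∈
                   same : ∀ b → t b ≡ u b
                   same b = by-cases {P = b ≡ i}
                     (λ { refl → trans (proj₂ (proj₁ (f-d i j) td)) (trans (e j (λ q → i≢j (sym q)))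
                          (trans (sym (e′ j (λ q → i≢j (sym q)))) (sym (proj₂ (proj₁ (f-d i j) ud))))) })
                     (λ b≢i → trans (e b b≢i) (sym (e′ b b≢i)))
               in ⊥-elim (proj₂ (proj₁ (f-- _) ua) (subst (_∈ f (ρ 0)) (fe same) ta)))
        (λ x → ⊥-elim (proj₁ f-𝟘 x))

  module _ {m} {J : Set} (𝒰 : Ultrafilter J) (𝔄 : J → Structure m ℓ) where
    open Ultrafilter 𝒰
    private module 𝔄 j = Structure (𝔄 j)

    ultraproduct : Structure m ℓ
    ultraproduct = record
      { Carrier       = ∀ j → 𝔄.Carrier j
      ; _≈_           = λ a b → Lift ℓ (U (λ j → 𝔄._≈_ j (a j) (b j)))
      ; _∨_           = λ a b j → 𝔄._∨_ j (a j) (b j)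
      ; _∧_           = λ a b j → 𝔄._∧_ j (a j) (b j)
      ; -_            = λ a j → 𝔄.-_ j (a j)
      ; 𝟙             = λ j → 𝔄.𝟙 j
      ; 𝟘             = λ j → 𝔄.𝟘 j
      ; c             = λ i a j → 𝔄.c j i (a j)
      ; d             = λ i i′ j → 𝔄.d j i i′
      ; isEquivalence = record
        { refl  = lift (U-pure λ j → IsEquivalence.refl (𝔄.isEquivalence j))
        ; sym   = λ (lift e) → lift (U-map (λ j → IsEquivalence.sym (𝔄.isEquivalence j)) e)
        ; trans = λ (lift e) (lift e′) → lift (U-map₂ (λ j → IsEquivalence.trans (𝔄.isEquivalence j)) e e′)
        }
      ; ∨-cong        = λ (lift e) (lift e′) → lift (U-map₂ (λ j → 𝔄.∨-cong j) e e′)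
      ; ∧-cong        = λ (lift e) (lift e′) → lift (U-map₂ (λ j → 𝔄.∧-cong j) e e′)
      ; -‿cong        = λ (lift e) → lift (U-map (λ j → 𝔄.-‿cong j) e)
      ; c-cong        = λ i (lift e) → lift (U-map (λ j → 𝔄.c-cong j i) e)
      }

    eval-ultraproduct : ∀ {X : Set} (ρ : X → ∀ j → 𝔄.Carrier j) t j →
                        eval ultraproduct ρ t j ≡ eval (𝔄 j) (λ x → ρ x j) t
    eval-ultraproduct ρ (var x)  j = refl
    eval-ultraproduct ρ (s ∨ᵗ t) j = cong₂ (𝔄._∨_ j) (eval-ultraproduct ρ s j) (eval-ultraproduct ρ t j)
    eval-ultraproduct ρ (s ∧ᵗ t) j = cong₂ (𝔄._∧_ j) (eval-ultraproduct ρ s j) (eval-ultraproduct ρ t j)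
    eval-ultraproduct ρ (-ᵗ t)   j = cong (𝔄.-_ j) (eval-ultraproduct ρ t j)
    eval-ultraproduct ρ 𝟙ᵗ       j = refl
    eval-ultraproduct ρ 𝟘ᵗ       j = refl
    eval-ultraproduct ρ (cᵗ i t) j = cong (𝔄.c j i) (eval-ultraproduct ρ t j)
    eval-ultraproduct ρ (dᵗ i k) j = refl

    łoś : ∀ {k} (φ : Formula m k) (ρ : Fin k → ∀ j → 𝔄.Carrier j) →
          Sat ultraproduct ρ φ ⇔ U (λ j → Sat (𝔄 j) (λ x → ρ x j) φ)
    łoś (s ≈ᶠ t) ρ = mk⇔
      (λ (lift e) → U-map (λ j → subst₂ (𝔄._≈_ j) (eval-ultraproduct ρ s j) (eval-ultraproduct ρ t j)) e)
      (λ e → lift (U-map (λ j → subst₂ (𝔄._≈_ j) (sym (eval-ultraproduct ρ s j)) (sym (eval-ultraproduct ρ t j))) e))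
    łoś ⊥ᶠ ρ = mk⇔ (λ ()) (λ u → ⊥-elim (U-⊥ (λ _ ()) u))
    łoś (φ ⇒ᶠ ψ) ρ = mk⇔
      (λ h → by-cases (λ u → U-map (λ j y _ → y) (to (łoś ψ ρ) (h (from (łoś φ ρ) u))))
                      (λ ¬u → U-map (λ j ¬x x → ⊥-elim (¬x x)) (U-em ¬u)))
      (λ u x → from (łoś ψ ρ) (U-map₂ (λ j h y → h y) u (to (łoś φ ρ) x)))
    łoś (∀ᶠ φ) ρ = mk⇔
      (λ h → dne λ ¬u →
        let bad = U-em ¬u
            a j = by-cases {P = ∃[ x ] ¬ Sat (𝔄 j) (x ▹ (λ y → ρ y j)) φ} proj₁ (λ _ → 𝔄.𝟙 j)
        in U-⊥ (λ _ (x , ¬x) → ¬x x) (U-zip (to (łoś φ (a ▹ ρ)) (h a))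
             (U-map (λ j ¬all x → ¬all (counter j (subst (λ z → Sat (𝔄 j) z φ) (fe (cons j a)) x))) bad)))
      (λ u a → from (łoś φ (a ▹ ρ)) (U-map (λ j h → subst (λ z → Sat (𝔄 j) z φ) (sym (fe (cons j a))) (h (a j))) u))
      where
      cons : ∀ j a x → (a ▹ ρ) x j ≡ (a j ▹ (λ y → ρ y j)) x
      cons j a zero    = refl
      cons j a (suc x) = refl

      counter : ∀ j → Sat (𝔄 j) (by-cases {P = ∃[ x ] ¬ Sat (𝔄 j) (x ▹ (λ y → ρ y j)) φ} proj₁ (λ _ → 𝔄.𝟙 j)
                                 ▹ (λ y → ρ y j)) φ →
                ∀ x → Sat (𝔄 j) (x ▹ (λ y → ρ y j)) φ
      counter j with em {P = ∃[ x ] ¬ Sat (𝔄 j) (x ▹ (λ y → ρ y j)) φ}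
      ... | yes (x , ¬s) = λ s → ⊥-elim (¬s s)
      ... | no ¬ex = λ _ x → dne λ ¬s → ¬ex (x , ¬s)

    łoś-sentence : ∀ σ → ultraproduct ⊨ σ ⇔ U (λ j → 𝔄 j ⊨ σ)
    łoś-sentence σ = mk⇔
      (λ s → U-map (λ j → subst (λ z → Sat (𝔄 j) z σ) (fe λ ()))
                   (to (łoś σ none) (subst (λ z → Sat ultraproduct z σ) (fe λ ()) s)))
      (λ u → subst (λ z → Sat ultraproduct z σ) (fe λ ())
               (from (łoś σ none) (U-map (λ j → subst (λ z → Sat (𝔄 j) z σ) (fe λ ())) u)))
      where
      none : Fin 0 → ∀ j → 𝔄.Carrier j
      none ()

  -- Labelled structures

  -- Points have a sort: zero for apices, suc i for the points of base sort i.
  -- T d v is the tint of the apex v over the base point d, if v lies above d.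
  -- A red label proposes values (colour, height) for two apices; white i excuses
  -- a pair of apices from being red, and is only allowed if they do not both lie
  -- above a common point of base sort i.  S D is the set of tints that are allowed
  -- for the apices over D.
  module Rainbow (d₂ κ : ℕ) where

    d : ℕ
    d = suc (suc d₂)

    m : ℕ
    m = suc d

    Value : Set
    Value = Fin κ × ℕ

    data Label : Set where
      white : Fin d → Label
      red   : Value → Value → Label

    record Str (I : Set) : Set where
      constructor str
      field
        glued : I → I → Bool
        sort  : I → Fin m
        T     : I → I → Maybe ℕ
        E     : I → I → Label
        S     : (Fin d → I) → ℕ → Bool

    infixl 9 _∙_
    _∙_ : ∀ {I J} → Str I → (J → I) → Str J
    N ∙ ρ = str (λ i j → glued (ρ i) (ρ j)) (sort ∘ ρ) (λ i j → T (ρ i) (ρ j))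
                (λ i j → E (ρ i) (ρ j)) (λ D → S (ρ ∘ D))
      where open Str N

    colour : Value → Fin κ
    colour = proj₁

    height : Value → ℕ
    height = proj₂

    Compatible : ℕ → Value → ℕ → Value → Set
    Compatible t x t′ y = (t ≡ t′ → x ≡ y)
                        × (t < t′ → height y ≤ height x × (colour x ≡ colour y → height y < height x))

    module _ {I : Set} (N : Str I) where
      open Str N

      Apex : I → Set
      Apex v = sort v ≡ zero

      Base : Fin d → I → Set
      Base i b = sort b ≡ suc i

      Above : I → I → Set
      Above v b = ∃[ t ] T b v ≡ just t

      Apices : I → I → Set
      Apices v w = Apex v × Apex w × ¬ glued v w ≡ true

      Transversal : (Fin d → I) → Set
      Transversal D = ∀ i → Base i (D i)

      Cone : (Fin d → I) → I → ℕ → Set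
      Cone D v t = Apex v × (∀ i → Above v (D i)) × T (D zero) v ≡ just t

      Red : I → I → Value → Value → Set
      Red v w x y = E v w ≡ red x y

    record Legal (Height : ℕ → Set) {I : Set} (N : Str I) : Set where
      open Str N
      field
        glued-refl  : ∀ {i} → glued i i ≡ true
        glued-sym   : ∀ {i j} → glued i j ≡ true → glued j i ≡ true
        glued-trans : ∀ {i j k} → glued i j ≡ true → glued j k ≡ true → glued i k ≡ true
        sort-cong   : ∀ {i j} → glued i j ≡ true → sort i ≡ sort j
        T-cong      : ∀ {i i′ j j′} → glued i i′ ≡ true → glued j j′ ≡ true → T i j ≡ T i′ j′
        E-cong      : ∀ {i i′ j j′} → glued i i′ ≡ true → glued j j′ ≡ true → E i j ≡ E i′ j′
        S-cong      : ∀ {D D′} → (∀ i → glued (D i) (D′ i) ≡ true) → ∀ t → S D t ≡ S D′ t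
        excuse      : ∀ {i b v w} → Base N i b → Apices N v w → Above N v b → Above N w b →
                      E v w ≢ white i
        red-sym     : ∀ {v w x y} → Apices N v w → Red N v w x y → Red N w v y x × Height (height x)
        red-unique  : ∀ {u v w x x′ y y′ z z′} → Apices N u v → Apices N u w → Apices N v w →
                      Red N u v x y → Red N u w x′ z → Red N v w y′ z′ → x ≡ x′
        red-tint    : ∀ {b v w t t′ x y} → Base N zero b → Apices N v w →
                      T b v ≡ just t → T b w ≡ just t′ → Red N v w x y → Compatible t x t′ y
        cone-tint   : ∀ {D v t} → Transversal N D → Cone N D v t → S D t ≡ true

    Legal-∙ : ∀ {H I J} {N : Str I} (ρ : J → I) → Legal H N → Legal H (N ∙ ρ)
    Legal-∙ ρ L = record
      { glued-refl = glued-refl ; glued-sym = glued-sym ; glued-trans = glued-trans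
      ; sort-cong = sort-cong ; T-cong = T-cong ; E-cong = E-cong ; S-cong = S-cong
      ; excuse = excuse ; red-sym = red-sym ; red-unique = red-unique
      ; red-tint = red-tint ; cone-tint = cone-tint }
      where open Legal L

    str-ext : ∀ {I} {N N′ : Str I} →
              (∀ i j → Str.glued N i j ≡ Str.glued N′ i j) → (∀ i → Str.sort N i ≡ Str.sort N′ i) →
              (∀ i j → Str.T N i j ≡ Str.T N′ i j) → (∀ i j → Str.E N i j ≡ Str.E N′ i j) →
              (∀ D t → Str.S N D t ≡ Str.S N′ D t) → N ≡ N′
    str-ext g s t e l with fe (λ i → fe (g i)) | fe s | fe (λ i → fe (t i)) | fe (λ i → fe (e i)) | fe (λ i → fe (l i))
    ... | refl | refl | refl | refl | refl = refl

    ∙-glued : ∀ {H I J} {N : Str I} → Legal H N → {ρ ρ′ : J → I} →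
              (∀ j → Str.glued N (ρ j) (ρ′ j) ≡ true) → N ∙ ρ ≡ N ∙ ρ′
    ∙-glued {N = N} L {ρ} {ρ′} h = str-ext
      (λ i j → bool-ext (λ g → glued-trans (glued-sym (h i)) (glued-trans g (h j)))
                        (λ g → glued-trans (h i) (glued-trans g (glued-sym (h j)))))
      (λ i → sort-cong (h i)) (λ i j → T-cong (h i) (h j)) (λ i j → E-cong (h i) (h j))
      (λ D → S-cong (h ∘ D))
      where open Legal L

    infix 4 _≡[_]_
    _≡[_]_ : ∀ {k I} → (Fin (suc k) → I) → Fin (suc k) → (Fin (suc k) → I) → Set
    l ≡[ i ] l′ = l ∘ punchIn i ≡ l′ ∘ punchIn i

    off⇒≡[] : ∀ {k I} {l l′ : Fin (suc k) → I} {i} → (∀ j → j ≢ i → l j ≡ l′ j) → l ≡[ i ] l′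
    off⇒≡[] h = fe λ j → h _ (punchInᵢ≢i _ j)

    Near : ∀ {k} → Fin (suc k) → Str (Fin (suc k)) → Str (Fin (suc k)) → Set
    Near i α β = α ∙ punchIn i ≡ β ∙ punchIn i

    module _ (H : ℕ → Set) where

      complex : Structure m ℓ
      complex = record
        { Carrier       = Lift ℓ (Str (Fin m) → Bool)
        ; _≈_           = λ a b → Lift ℓ (∀ α → Legal H α → lower a α ≡ lower b α)
        ; _∨_           = λ a b → lift λ α → lower a α Bool.∨ lower b α
        ; _∧_           = λ a b → lift λ α → lower a α Bool.∧ lower b α
        ; -_            = λ a → lift λ α → not (lower a α)
        ; 𝟙             = lift λ _ → true
        ; 𝟘             = lift λ _ → false
        ; c             = λ i a → lift λ α → ⌊ ∃[ β ] (Legal H β × Near i β α × lower a β ≡ true) ⌋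
        ; d             = λ i j → lift λ α → Str.glued α i j
        ; isEquivalence = record
          { refl  = lift λ _ _ → refl
          ; sym   = λ (lift e) → lift λ α L → sym (e α L)
          ; trans = λ (lift e) (lift e′) → lift λ α L → trans (e α L) (e′ α L)
          }
        ; ∨-cong        = λ (lift e) (lift e′) → lift λ α L → cong₂ Bool._∨_ (e α L) (e′ α L)
        ; ∧-cong        = λ (lift e) (lift e′) → lift λ α L → cong₂ Bool._∧_ (e α L) (e′ α L)
        ; -‿cong        = λ (lift e) → lift λ α L → cong not (e α L)
        ; c-cong        = λ i (lift e) → lift λ α _ → ⌊⌋-cong
            (λ (β , L , n , x) → β , L , n , trans (sym (e β L)) x)
            (λ (β , L , n , x) → β , L , n , trans (e β L) x)
        }

    -- A strategy for the existential player in the game with suc n₁ pebbles on a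
    -- sequence of algebras; in the j-th one, from Good s she survives s rounds.
    record Strategy (H : ℕ → ℕ → Set) (n₁ : ℕ) : Set₁ where
      field
        Good    : ℕ → ℕ → Str (Fin (suc n₁)) → Set
        legal   : ∀ {j s N} → Good j s N → Legal (H j) N
        relabel : ∀ {j s N} (ρ : Fin (suc n₁) → Fin (suc n₁)) → Good j s N → Good j s (N ∙ ρ)
        mono    : ∀ {j s N} → Good j (suc s) N → Good j s N
        respond : ∀ {j s N} → Good j (suc s) N → ∀ (l : Fin m → Fin (suc n₁)) i k β →
                  Legal (H j) β → Near i β (N ∙ l) → (∀ b → b ≢ i → k ≢ l b) →
                  ∃[ N′ ] (Good j s N′ × Near k N N′ × N′ ∙ updateAt l i (const k) ≡ β)
        ι       : Fin m → Fin (suc n₁)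
        initial : ∀ {j} {α : Str (Fin m)} → Legal (H j) α → ∃[ N ] (Good j j N × N ∙ ι ≡ α)
        atom    : ∀ j → Σ[ α ∈ Str (Fin m) ] Legal (H j) α

    module _ {H : ℕ → ℕ → Set} {n₁} (st : Strategy H n₁)
             (𝒰 : Ultrafilter ℕ) (free : ∀ k → Ultrafilter.U 𝒰 (λ j → k ≤ j)) where
      open Strategy st
      open Ultrafilter 𝒰

      private
        n : ℕ
        n = suc n₁

      limit : Structure m ℓ
      limit = ultraproduct 𝒰 (λ j → complex (H j))

      record Net : Set ℓ where
        field
          N         : ℕ → Str (Fin n)
          rounds    : ℕ → ℕ
          good      : ∀ j → Good j (rounds j) (N j)
          unbounded : ∀ k → U (λ j → k ≤ rounds j)

      sat : Net → (Fin m → Fin n) → Structure.Carrier limit → Set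
      sat 𝒩 l a = U (λ j → lower (a j) (Net.N 𝒩 j ∙ l) ≡ true)

      Moves : (j : ℕ) (N : Str (Fin n)) (l : Fin m → Fin n) (i : Fin m) (a : Str (Fin m) → Bool) → Set
      Moves j N l i a = ∃[ β ] (Legal (H j) β × Near i β (N ∙ l) × a β ≡ true)

      reply : ∀ l i k → (∀ b → b ≢ i → k ≢ l b) → ∀ a j s N → Good j s N →
              ∃[ N′ ] (Good j (s ∸ 1) N′ × Near k N N′
                       × (1 ≤ s → Moves j N l i a → a (N′ ∙ updateAt l i (const k)) ≡ true))
      reply l i k k≢ a j zero    N g = N , g , refl , λ ()
      reply l i k k≢ a j (suc s) N g = by-cases
        (λ (β , L , near , aβ) →
          let (N′ , g′ , near′ , e) = respond g l i k β L near k≢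
          in N′ , g′ , near′ , λ _ _ → trans (cong a e) aβ)
        (λ ¬mv → N , mono g , refl , λ _ mv → ⊥-elim (¬mv mv))

      basis : Basis limit n
      basis = record
        { Net          = Net
        ; sat          = sat
        ; glue         = λ 𝒩 i i′ → U (λ j → Str.glued (Net.N 𝒩 j) i i′ ≡ true)
        ; reindex      = λ 𝒩 ρ → record
          { N = λ j → Net.N 𝒩 j ∙ ρ ; rounds = Net.rounds 𝒩
          ; good = λ j → relabel ρ (Net.good 𝒩 j) ; unbounded = Net.unbounded 𝒩 }
        ; sat-reindex  = λ 𝒩 ρ l a → refl
        ; glue-reindex = λ 𝒩 ρ i j → refl
        ; glue-refl    = λ 𝒩 → U-pure λ j → Legal.glued-refl (legal (Net.good 𝒩 j))
        ; glue-sym     = λ 𝒩 → U-map λ j → Legal.glued-sym (legal (Net.good 𝒩 j))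
        ; sat-glue     = λ 𝒩 {l} {l′} h a → U-map₂ (λ j g → trans (cong (lower (a j))
                           (sym (∙-glued (legal (Net.good 𝒩 j)) g)))) (U-finite h)
        ; sat-≈        = λ {𝒩} {l} (lift e) x → U-map₂ (λ j (lift e′) x′ →
                           trans (sym (e′ _ (Legal-∙ l (legal (Net.good 𝒩 j))))) x′) e x
        ; sat-∨        = λ {𝒩} {l} {a} {b} → mk⇔
            (λ x → by-cases inj₁ λ ¬y → inj₂ (U-map₂ (λ j → ∨-resolve) x (U-em ¬y)))
            [ U-map (λ j → ∨-left) , U-map (λ j → ∨-right) ]′
        ; sat-∧        = mk⇔ (λ x → U-map (λ j → proj₁ ∘ ∧-split _) x , U-map (λ j → proj₂ ∘ ∧-split _) x)
                             (λ (x , y) → U-map₂ (λ j → ∧-join) x y)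
        ; sat--        = mk⇔ (λ x y → U-⊥ (λ _ (p , q) → not-elim p q) (U-zip x y))
                             (λ ¬x → U-map (λ j → not-intro) (U-em ¬x))
        ; sat-𝟙        = U-pure λ _ → refl
        ; sat-𝟘        = U-⊥ λ _ ()
        ; sat-d        = mk⇔ id id
        ; sat-c        = λ {𝒩} {l} e → U-map λ j x → ⌊⌋-intro
                           (_ , Legal-∙ l (legal (Net.good 𝒩 j)) , cong (Net.N 𝒩 j ∙_) (off⇒≡[] e) , x)
        ; sat-c-indep  = λ {𝒩} e → U-map λ j x → let (β , L , near , y) = ⌊⌋-elim x in
                           ⌊⌋-intro (β , L , trans near (cong (Net.N 𝒩 j ∙_) (off⇒≡[] e)) , y)
        ; move         = move
        ; faithful     = faithful
        }
        where
        ∨-resolve : ∀ {x y} → x Bool.∨ y ≡ true → ¬ x ≡ true → y ≡ true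
        ∨-resolve {true}  _ n = ⊥-elim (n refl)
        ∨-resolve {false} e _ = e

        ∨-left : ∀ {x y} → x ≡ true → x Bool.∨ y ≡ true
        ∨-left refl = refl

        ∨-right : ∀ {x y} → y ≡ true → x Bool.∨ y ≡ true
        ∨-right {true}  _ = refl
        ∨-right {false} e = e

        not-intro : ∀ {x} → ¬ x ≡ true → not x ≡ true
        not-intro {true}  n = ⊥-elim (n refl)
        not-intro {false} _ = refl

        move : ∀ 𝒩 l i k a → (∀ b → b ≢ i → k ≢ l b) →
               sat 𝒩 l (Structure.c limit i a) →
               ∃[ 𝒩′ ] ((∀ l′ → (∀ b → l′ b ≢ k) → ∀ a → sat 𝒩 l′ a ⇔ sat 𝒩′ l′ a)
                      × sat 𝒩′ (updateAt l i (const k)) a)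
        move 𝒩 l i k a k≢ x = 𝒩′
          , (λ l′ l′≢k b → mk⇔ (U-map (λ j → trans (cong (lower (b j)) (sym (off j l′≢k)))))
                               (U-map (λ j → trans (cong (lower (b j)) (off j l′≢k)))))
          , U-map₂ (λ j r x → proj₂ (proj₂ (proj₂ (ans j))) r (⌊⌋-elim x)) (unbounded 1) x
          where
          open Net 𝒩
          ans : ∀ j → _
          ans j = reply l i k k≢ (lower (a j)) j (rounds j) (N j) (good j)

          off : ∀ j {l′ : Fin m → Fin n} → (∀ b → l′ b ≢ k) → N j ∙ l′ ≡ proj₁ (ans j) ∙ l′
          off j {l′} l′≢k = subst (λ z → N j ∙ z ≡ proj₁ (ans j) ∙ z)
            (fe λ b → punchIn-punchOut (λ e → l′≢k b (sym e)))
            (cong (_∙ (λ b → punchOut {i = k} (λ e → l′≢k b (sym e)))) (proj₁ (proj₂ (proj₂ (ans j)))))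

          𝒩′ : Net
          𝒩′ = record
            { N         = λ j → proj₁ (ans j)
            ; rounds    = λ j → rounds j ∸ 1
            ; good      = λ j → proj₁ (proj₂ (ans j))
            ; unbounded = λ r → U-map (λ j le → ∸-monoˡ-≤ 1 le) (unbounded (suc r))
            }

        faithful : ∀ {a b} → (∀ 𝒩 l → sat 𝒩 l a ⇔ sat 𝒩 l b) → Structure._≈_ limit a b
        faithful {a} {b} h = lift (dne λ ¬u →
          U-⊥ (λ _ (e , ne) → ne e) (U-zip equal (U-map differ (U-em ¬u))))
          where
          Differ : ℕ → Set
          Differ j = ∃[ α ] (Legal (H j) α × lower (a j) α ≢ lower (b j) α)

          start : ∀ j → ∃[ α ] (Legal (H j) α × (Differ j → lower (a j) α ≢ lower (b j) α))
          start j = by-cases {P = Differ j} (λ (α , L , ne) → α , L , λ _ → ne)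
                                            (λ ¬ex → proj₁ (atom j) , proj₂ (atom j) , λ ex → ⊥-elim (¬ex ex))

          net : ∀ j → _
          net j = initial (proj₁ (proj₂ (start j)))

          𝒩 : Net
          𝒩 = record { N = λ j → proj₁ (net j) ; rounds = id
                     ; good = λ j → proj₁ (proj₂ (net j)) ; unbounded = free }

          at : (ℕ → Lift ℓ (Str (Fin m) → Bool)) → ℕ → Bool
          at a j = lower (a j) (proj₁ (net j) ∙ ι)

          differ : ∀ j → ¬ (Lift ℓ (∀ α → Legal (H j) α → lower (a j) α ≡ lower (b j) α)) → at a j ≢ at b j
          differ j ¬e = subst (λ α → lower (a j) α ≢ lower (b j) α) (sym (proj₂ (proj₂ (net j))))
            (proj₂ (proj₂ (start j)) (dne λ ¬D → ¬e (lift λ α L → dne λ ne → ¬D (α , L , ne))))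

          equal : U (λ j → at a j ≡ at b j)
          equal = by-cases {P = sat 𝒩 ι a}
            (λ x → U-map₂ (λ j p q → trans p (sym q)) x (to (h 𝒩 ι) x))
            (λ ¬x → U-map₂ (λ j p q → trans (≢true⇒false p) (sym (≢true⇒false q)))
                           (U-em ¬x) (U-em (¬x ∘ from (h 𝒩 ι))))

      limit-complete : (m≤n : m < n) → HasCompleteSmooth m n limit
      limit-complete m<n =
        square⇒IsCA representation m<n square V-clique
        , representation , complete atoms , square⇒smooth representation square
        where
        open Unravelling (≤-trans (n≤1+n m) m<n) limit basis
        open Structure limit using (_≼_; -_)

        atoms : ∀ 𝒩 l → ∃[ a ] (sat 𝒩 l a × (∀ b → ¬ sat 𝒩 l b → b ≼ (- a)))
        atoms 𝒩 l = (λ j → lift λ α → ⌊ α ≡ Net.N 𝒩 j ∙ l ⌋)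
          , U-pure (λ j → ⌊⌋-intro refl)
          , λ b ¬x → lift (U-map (λ j nb → lift λ α _ → ∨-absorb λ bα →
              cong not (⌊⌋-false λ { refl → nb bα })) (U-em ¬x))

      limit-smooth : m < n → HasSmooth m n limit
      limit-smooth m<n = let (ca , R , _ , sm) = limit-complete m<n in ca , R , sm

  -- The strategy of the existential player

  module Response (d₂ κ : ℕ) (c₀ : Fin κ) (H : ℕ → Set) (H₀ : H 0) where
    open Rainbow d₂ κ
    open Str

    red-injective : ∀ {x y x′ y′} → red x y ≡ red x′ y′ → x ≡ x′ × y ≡ y′
    red-injective refl = refl , refl

    Fits : ∀ {I} → Str I → (Fin d → I) → (ℕ → Value) → Set
    Fits N D h = ∀ {v w t t′} → Cone N D v t → Cone N D w t′ → ¬ glued N v w ≡ true →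
                 Red N v w (h t) (h t′)

    Tint : ∀ {I} → Str I → (Fin d → I) → ℕ → Set
    Tint N D t = ∃[ v ] Cone N D v t

    Homomorphic : (ℕ → Set) → (ℕ → Value) → Set
    Homomorphic P h = (∀ {t t′} → P t → P t′ → Compatible t (h t) t′ (h t′)) × (∀ {t} → P t → H (height (h t)))

    module _ {I : Set} {N : Str I} (L : Legal H N) where
      open Legal L

      cone-tint-unique : ∀ {D v w t t′} → glued N v w ≡ true → Cone N D v t → Cone N D w t′ → t ≡ t′
      cone-tint-unique g (_ , _ , e) (_ , _ , e′) with trans (sym e) (trans (T-cong glued-refl g) e′)
      ... | refl = refl

      cones-red : ∀ {D v w t t′} → Transversal N D → Cone N D v t → Cone N D w t′ → ¬ glued N v w ≡ true →
                  ∃[ x ] ∃[ y ] Red N v w x y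
      cones-red {D} {v} {w} tr (av , abv , _) (aw , abw , _) ng with E N v w in eq
      ... | red x y = x , y , refl
      ... | white i = ⊥-elim (excuse (tr i) (av , aw , ng) (abv i) (abw i) eq)

      module _ {D : Fin d → I} (tr : Transversal N D) where

        same-source : ∀ {v w w′ t t₁ t₂ x x′ y y′} → Cone N D v t → Cone N D w t₁ → Cone N D w′ t₂ →
                      ¬ glued N v w ≡ true → ¬ glued N v w′ ≡ true →
                      Red N v w x y → Red N v w′ x′ y′ → x ≡ x′
        same-source {v} {w} {w′} cv cw cw′ n n′ r r′ = by-cases {P = glued N w w′ ≡ true}
          (λ g → proj₁ (red-injective (trans (sym r) (trans (E-cong glued-refl g) r′))))
          (λ ng → let (_ , _ , r″) = cones-red tr cw cw′ ng
                  in red-unique (proj₁ cv , proj₁ cw , n) (proj₁ cv , proj₁ cw′ , n′) (proj₁ cw , proj₁ cw′ , ng) r r′ r″)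

        same-tint : ∀ {v w v′ w′ t t₁ t₂ x x′ y y′} →
                    Cone N D v t → Cone N D w t₁ → Cone N D v′ t → Cone N D w′ t₂ →
                    ¬ glued N v w ≡ true → ¬ glued N v′ w′ ≡ true →
                    Red N v w x y → Red N v′ w′ x′ y′ → x ≡ x′
        same-tint {v} {w} {v′} {w′} cv cw cv′ cw′ n n′ r r′ = by-cases {P = glued N v v′ ≡ true}
          (λ g → same-source cv cw cw′ n (λ e → n′ (glued-trans (glued-sym g) e)) r (trans (E-cong g glued-refl) r′))
          (λ ng → let (a , b , r″) = cones-red tr cv cv′ ng
                      ap = proj₁ cv , proj₁ cv′ , ng
                      a≡b = proj₁ (red-tint (tr zero) ap (proj₂ (proj₂ cv)) (proj₂ (proj₂ cv′)) r″) refl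
                  in trans (same-source cv cw cv′ n ng r r″) (trans a≡b
                       (sym (same-source cv′ cw′ cv n′ (ng ∘ glued-sym) r′ (proj₁ (red-sym ap r″))))))

        Witness : ℕ → Set
        Witness t = ∃[ v ] ∃[ w ] ∃[ t′ ] ∃[ x ] ∃[ y ]
                      (Cone N D v t × Cone N D w t′ × ¬ glued N v w ≡ true × Red N v w x y)

        fit : ∃[ h ] (Fits N D h × Homomorphic (Tint N D) h)
        fit = h , fits , hom , bounded
          where
          h : ℕ → Value
          h t = by-cases {P = Witness t} (λ (_ , _ , _ , x , _) → x) (λ _ → c₀ , 0)

          h-≡ : ∀ {v w t t′ x y} → Cone N D v t → Cone N D w t′ → ¬ glued N v w ≡ true → Red N v w x y → h t ≡ x
          h-≡ {t = t} cv cw n r with em {P = Witness t}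
          ... | yes (_ , _ , _ , _ , _ , cv′ , cw′ , n′ , r′) = same-tint cv′ cw′ cv cw n′ n r′ r
          ... | no ¬w = ⊥-elim (¬w (_ , _ , _ , _ , _ , cv , cw , n , r))

          fits : Fits N D h
          fits cv cw n =
            let (x , y , r) = cones-red tr cv cw n
                r′ = proj₁ (red-sym (proj₁ cv , proj₁ cw , n) r)
            in trans r (cong₂ red (sym (h-≡ cv cw n r)) (sym (h-≡ cw cv (n ∘ glued-sym) r′)))

          hom : ∀ {t t′} → Tint N D t → Tint N D t′ → Compatible t (h t) t′ (h t′)
          hom {t} {t′} (v , cv) (w , cw) = by-cases {P = glued N v w ≡ true}
            (λ g → cong h , λ lt → ⊥-elim (<-irrefl (cone-tint-unique g cv cw) lt))
            (λ n → red-tint (tr zero) (proj₁ cv , proj₁ cw , n) (proj₂ (proj₂ cv)) (proj₂ (proj₂ cw)) (fits cv cw n))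

          bounded : ∀ {t} → Tint N D t → H (height (h t))
          bounded {t} _ with em {P = Witness t}
          ... | yes (_ , _ , _ , _ , _ , cv , cw , n , r) = proj₂ (red-sym (proj₁ cv , proj₁ cw , n) r)
          ... | no _ = H₀

    -- A network N is to be extended by a new point (nothing), whose type over F
    -- is given by β.
    record Task : Set₁ where
      field
        {I}   : Set
        N     : Str I
        LN    : Legal H N
        F     : Fin d → I
        β     : Str (Maybe (Fin d))
        Lβ    : Legal H β
        agree : β ∙ just ≡ N ∙ F
        fresh : ∀ a → ¬ glued β (just a) nothing ≡ true

      module LN = Legal LN
      module Lβ = Legal Lβ

      In : I → Set
      In j = ∃[ a ] glued N j (F a) ≡ true

      In-cong : ∀ {j j′} → glued N j j′ ≡ true → In j → In j′
      In-cong g (a , e) = a , LN.glued-trans (LN.glued-sym g) e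

      emb : Maybe (Fin d) → Maybe I
      emb nothing  = nothing
      emb (just a) = just (F a)

      -- F has only d points, so a transversal in F exhausts it.
      module _ {D : Fin d → I} (tr : Transversal N D) (D-in : ∀ i → In (D i)) where

        filled : ∀ a → ∃[ i ] glued N (F a) (D i) ≡ true
        filled a = let (i , e) = endo-surjective (λ i → proj₁ (D-in i)) inj a in
          i , LN.glued-sym (subst (λ b → glued N (D i) (F b) ≡ true) e (proj₂ (D-in i)))
          where
          inj : ∀ {i i′} → proj₁ (D-in i) ≡ proj₁ (D-in i′) → i ≡ i′
          inj {i} {i′} e = suc-injective (trans (sym (tr i)) (trans (LN.sort-cong
            (LN.glued-trans (proj₂ (D-in i)) (LN.glued-sym (subst (λ b → glued N (D i′) (F b) ≡ true)
              (sym e) (proj₂ (D-in i′)))))) (tr i′)))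

        filled-base : ∀ {b i} → In b → Base N i b → glued N b (D i) ≡ true
        filled-base {b} {i} (a , e) bs =
          let (i′ , e′) = filled a
              g = LN.glued-trans e e′
          in subst (λ z → glued N b (D z) ≡ true)
               (suc-injective (trans (sym (tr i′)) (trans (sym (LN.sort-cong g)) bs))) g

    -- The extension is determined by the labels ε j and ε′ j of the pairs of the
    -- new point and a point j outside F.
    record Extension (τ : Task) (ε ε′ : Task.I τ → Label) : Set where
      open Task τ
      field
        N⁺           : Str (Maybe I)
        N⁺-refl      : ∀ {p} → glued N⁺ p p ≡ true
        sym⁺         : ∀ {p q} → glued N⁺ p q ≡ true → glued N⁺ q p ≡ true
        trans⁺       : ∀ {p q r} → glued N⁺ p q ≡ true → glued N⁺ q r ≡ true → glued N⁺ p r ≡ true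
        glued-just   : ∀ {p j} → glued N⁺ p (just j) ≡ true → ∃[ i ] p ≡ just i
        sort-cong⁺   : ∀ {p p′} → glued N⁺ p p′ ≡ true → sort N⁺ p ≡ sort N⁺ p′
        T-cong⁺      : ∀ {p p′ q q′} → glued N⁺ p p′ ≡ true → glued N⁺ q q′ ≡ true → T N⁺ p q ≡ T N⁺ p′ q′
        E-cong⁺      : (∀ {j j′} → glued N j j′ ≡ true → ε j ≡ ε j′) → (∀ {j j′} → glued N j j′ ≡ true → ε′ j ≡ ε′ j′) →
                       ∀ {p p′ q q′} → glued N⁺ p p′ ≡ true → glued N⁺ q q′ ≡ true → E N⁺ p q ≡ E N⁺ p′ q′
        N⁺-old       : N⁺ ∙ just ≡ N

      Inside : Maybe I → Maybe (Fin d) → Set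
      Inside p q = glued N⁺ p (emb q) ≡ true

      field
        inside-glued : ∀ {p q p′ q′} → Inside p q → Inside p′ q′ → glued N⁺ p p′ ≡ glued β q q′
        inside-sort  : ∀ {p q} → Inside p q → sort N⁺ p ≡ sort β q
        inside-T     : ∀ {p q p′ q′} → Inside p q → Inside p′ q′ → T N⁺ p p′ ≡ T β q q′
        inside-E     : ∀ {p q p′ q′} → Inside p q → Inside p′ q′ → E N⁺ p p′ ≡ E β q q′
        inside-S     : ∀ {D q} → (∀ i → Inside (D i) (q i)) → ∀ t → S N⁺ D t ≡ S β q t
        S-old        : ∀ D₀ t → S N⁺ (just ∘ D₀) t ≡ S N D₀ t
        S-new        : ∀ D → ¬ (∃[ D₀ ] D ≡ just ∘ D₀) → ¬ (Σ[ q ∈ (Fin d → Maybe (Fin d)) ] (∀ i → Inside (D i) (q i))) →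
                       ∀ t → S N⁺ D t ≡ ⌊ Tint N⁺ D t ⌋
        T-new-in     : ∀ {j t} → T N⁺ nothing (just j) ≡ just t → In j
        T-in-new     : ∀ {j t} → T N⁺ (just j) nothing ≡ just t → In j
        E-new-out    : ∀ {j} → ¬ In j → E N⁺ nothing (just j) ≡ ε j
        E-out-new    : ∀ {j} → ¬ In j → E N⁺ (just j) nothing ≡ ε′ j
        new-inside   : Inside nothing nothing
        In-inside    : ∀ {j a} → glued N j (F a) ≡ true → Inside (just j) (just a)

      old-glued : ∀ i j → glued N⁺ (just i) (just j) ≡ glued N i j
      old-glued i j = cong (λ z → glued z i j) N⁺-old

      old-sort : ∀ i → sort N⁺ (just i) ≡ sort N i
      old-sort i = cong (λ z → sort z i) N⁺-old

      old-T : ∀ i j → T N⁺ (just i) (just j) ≡ T N i j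
      old-T i j = cong (λ z → T z i j) N⁺-old

      old-E : ∀ i j → E N⁺ (just i) (just j) ≡ E N i j
      old-E i j = cong (λ z → E z i j) N⁺-old

    module Glue (τ : Task) (ε ε′ : Task.I τ → Label) where
      open Task τ

      -- The type of a pair with exactly one new point, copied from β where possible.
      copy : ∀ {A : Set} → (Fin d → A) → (I → A) → I → A
      copy f g j = by-cases {P = In j} (f ∘ proj₁) (λ _ → g j)

      copy-in : ∀ {A : Set} (f : Fin d → A) g {j} → (∀ {a b} → glued β (just a) (just b) ≡ true → f a ≡ f b) →
                ∀ {a} → glued N j (F a) ≡ true → copy f g j ≡ f a
      copy-in f g {j} f-cong {a} e with em {P = In j}
      ... | yes (b , e′) = f-cong (trans (cong (λ z → glued z b a) agree) (LN.glued-trans (LN.glued-sym e′) e))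
      ... | no ¬in = ⊥-elim (¬in (a , e))

      copy-out : ∀ {A : Set} (f : Fin d → A) g {j} → ¬ In j → copy f g j ≡ g j
      copy-out f g {j} ¬in with em {P = In j}
      ... | yes i = ⊥-elim (¬in i)
      ... | no _  = refl

      N⁺ : Str (Maybe I)
      N⁺ = str gl so Tn En Sn
        where
        gl : Maybe I → Maybe I → Bool
        gl nothing  nothing  = true
        gl nothing  (just _) = false
        gl (just _) nothing  = false
        gl (just i) (just j) = glued N i j

        so : Maybe I → Fin m
        so nothing  = sort β nothing
        so (just i) = sort N i

        Tn : Maybe I → Maybe I → Maybe ℕ
        Tn nothing  nothing  = T β nothing nothing
        Tn nothing  (just j) = copy (λ a → T β nothing (just a)) (λ _ → nothing) j
        Tn (just j) nothing  = copy (λ a → T β (just a) nothing) (λ _ → nothing) j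
        Tn (just i) (just j) = T N i j

        En : Maybe I → Maybe I → Label
        En nothing  nothing  = E β nothing nothing
        En nothing  (just j) = copy (λ a → E β nothing (just a)) ε j
        En (just j) nothing  = copy (λ a → E β (just a) nothing) ε′ j
        En (just i) (just j) = E N i j

        Sn : (Fin d → Maybe I) → ℕ → Bool
        Sn D t = by-cases {P = ∃[ D₀ ] D ≡ just ∘ D₀} (λ (D₀ , _) → S N D₀ t)
          (λ _ → by-cases {P = ∃[ D₁ ] (∀ i → gl (D i) (emb (D₁ i)) ≡ true)} (λ (D₁ , _) → S β D₁ t)
            (λ _ → ⌊ ∃[ v ] Cone (str gl so Tn En (λ _ _ → true)) D v t ⌋))

      Inside : Maybe I → Maybe (Fin d) → Set
      Inside p q = glued N⁺ p (emb q) ≡ true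

      N⁺-refl : ∀ {p} → glued N⁺ p p ≡ true
      N⁺-refl {nothing} = refl
      N⁺-refl {just i}  = LN.glued-refl

      inside-glued : ∀ {p q p′ q′} → Inside p q → Inside p′ q′ → glued N⁺ p p′ ≡ glued β q q′
      inside-glued {nothing} {nothing} {nothing} {nothing} _ _ = sym Lβ.glued-refl
      inside-glued {nothing} {nothing} {just j}  {just b}  _ _ = sym (≢true⇒false (fresh b ∘ Lβ.glued-sym))
      inside-glued {just i}  {just a}  {nothing} {nothing} _ _ = sym (≢true⇒false (fresh a))
      inside-glued {just i}  {just a}  {just j}  {just b}  e e′ = trans
        (bool-ext (λ g → LN.glued-trans (LN.glued-sym e) (LN.glued-trans g e′))
                  (λ g → LN.glued-trans e (LN.glued-trans g (LN.glued-sym e′))))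
        (sym (cong (λ z → glued z a b) agree))

      inside-sort : ∀ {p q} → Inside p q → sort N⁺ p ≡ sort β q
      inside-sort {nothing} {nothing} _ = refl
      inside-sort {just i}  {just a}  e = trans (LN.sort-cong e) (sym (cong (λ z → sort z a) agree))

      inside-T : ∀ {p q p′ q′} → Inside p q → Inside p′ q′ → T N⁺ p p′ ≡ T β q q′
      inside-T {nothing} {nothing} {nothing} {nothing} _ _ = refl
      inside-T {nothing} {nothing} {just j}  {just b}  _ e = copy-in _ _ (Lβ.T-cong Lβ.glued-refl) e
      inside-T {just i}  {just a}  {nothing} {nothing} e _ = copy-in _ _ (λ g → Lβ.T-cong g Lβ.glued-refl) e
      inside-T {just i}  {just a}  {just j}  {just b}  e e′ =
        trans (LN.T-cong e e′) (sym (cong (λ z → T z a b) agree))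

      inside-E : ∀ {p q p′ q′} → Inside p q → Inside p′ q′ → E N⁺ p p′ ≡ E β q q′
      inside-E {nothing} {nothing} {nothing} {nothing} _ _ = refl
      inside-E {nothing} {nothing} {just j}  {just b}  _ e = copy-in (λ a → E β nothing (just a)) ε (Lβ.E-cong Lβ.glued-refl) e
      inside-E {just i}  {just a}  {nothing} {nothing} e _ = copy-in (λ a → E β (just a) nothing) ε′ (λ g → Lβ.E-cong g Lβ.glued-refl) e
      inside-E {just i}  {just a}  {just j}  {just b}  e e′ =
        trans (LN.E-cong e e′) (sym (cong (λ z → E z a b) agree))

      just-inside : ∀ {i q} → Inside (just i) q → ∃[ a ] (q ≡ just a × glued N i (F a) ≡ true)
      just-inside {q = just a} e = a , refl , e

      inside-S : ∀ {D q} → (∀ i → Inside (D i) (q i)) → ∀ t → S N⁺ D t ≡ S β q t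
      inside-S {D} {q} h t = by-cases-elim (_≡ S β q t)
        (λ { (D₀ , refl) → let q₀ i = just-inside {D₀ i} {q i} (h i) in
          trans (LN.S-cong (λ i → proj₂ (proj₂ (q₀ i))) t)
            (trans (sym (cong (λ z → S z (λ i → proj₁ (q₀ i)) t) agree))
              (cong (λ z → S β z t) (fe λ i → sym (proj₁ (proj₂ (q₀ i)))))) })
        (λ _ → by-cases-elim (_≡ S β q t)
          (λ (D₁ , h₁) → Lβ.S-cong (λ i → trans (sym (inside-glued {D i} {D₁ i} {D i} {q i} (h₁ i) (h i))) (N⁺-refl {D i})) t)
          (λ ¬h → ⊥-elim (¬h (q , h))))

      S-old : ∀ D₀ t → S N⁺ (just ∘ D₀) t ≡ S N D₀ t
      S-old D₀ t = by-cases-elim (_≡ S N D₀ t)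
        (λ (D₁ , e) → cong (λ z → S N z t) (fe λ i → just-injective (cong (λ z → z i) (sym e))))
        (λ ¬e → ⊥-elim (¬e (D₀ , refl)))

      S-new : ∀ D → ¬ (∃[ D₀ ] D ≡ just ∘ D₀) → ¬ (Σ[ q ∈ (Fin d → Maybe (Fin d)) ] (∀ i → Inside (D i) (q i))) →
              ∀ t → S N⁺ D t ≡ ⌊ Tint N⁺ D t ⌋
      S-new D ¬old ¬in t = by-cases-elim (_≡ ⌊ Tint N⁺ D t ⌋) (λ old → ⊥-elim (¬old old))
        (λ _ → by-cases-elim (_≡ ⌊ Tint N⁺ D t ⌋) (λ i → ⊥-elim (¬in i)) (λ _ → refl))

      T-new-in : ∀ {j t} → T N⁺ nothing (just j) ≡ just t → In j
      T-new-in {j} e with em {P = In j}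
      ... | yes i = i
      T-new-in {j} () | no _

      T-in-new : ∀ {j t} → T N⁺ (just j) nothing ≡ just t → In j
      T-in-new {j} e with em {P = In j}
      ... | yes i = i
      T-in-new {j} () | no _

      copy-cong : ∀ {A : Set} (f : Fin d → A) g → (∀ {a b} → glued β (just a) (just b) ≡ true → f a ≡ f b) →
                  ∀ {j j′} → glued N j j′ ≡ true → (¬ In j → g j ≡ g j′) → copy f g j ≡ copy f g j′
      copy-cong f g f-cong {j} {j′} gl g-cong = by-cases {P = In j}
        (λ (a , e) → trans (copy-in f g f-cong e) (sym (copy-in f g f-cong (LN.glued-trans (LN.glued-sym gl) e))))
        (λ ¬in → trans (copy-out f g ¬in)
                   (trans (g-cong ¬in) (sym (copy-out f g (¬in ∘ In-cong (LN.glued-sym gl))))))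

      sort-cong⁺ : ∀ {p p′} → glued N⁺ p p′ ≡ true → sort N⁺ p ≡ sort N⁺ p′
      sort-cong⁺ {nothing} {nothing} _ = refl
      sort-cong⁺ {just _}  {just _}  g = LN.sort-cong g

      T-cong⁺ : ∀ {p p′ q q′} → glued N⁺ p p′ ≡ true → glued N⁺ q q′ ≡ true → T N⁺ p q ≡ T N⁺ p′ q′
      T-cong⁺ {nothing} {nothing} {nothing} {nothing} _ _ = refl
      T-cong⁺ {nothing} {nothing} {just _} {just _} _ g = copy-cong _ _ (Lβ.T-cong Lβ.glued-refl) g (λ _ → refl)
      T-cong⁺ {just _} {just _} {nothing} {nothing} g _ = copy-cong _ _ (λ e → Lβ.T-cong e Lβ.glued-refl) g (λ _ → refl)
      T-cong⁺ {just _} {just _} {just _} {just _} g g′ = LN.T-cong g g′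

      E-cong⁺ : (∀ {j j′} → glued N j j′ ≡ true → ε j ≡ ε j′) → (∀ {j j′} → glued N j j′ ≡ true → ε′ j ≡ ε′ j′) →
                ∀ {p p′ q q′} → glued N⁺ p p′ ≡ true → glued N⁺ q q′ ≡ true → E N⁺ p q ≡ E N⁺ p′ q′
      E-cong⁺ c c′ {nothing} {nothing} {nothing} {nothing} _ _ = refl
      E-cong⁺ c c′ {nothing} {nothing} {just _} {just _} _ g =
        copy-cong (λ a → E β nothing (just a)) ε (Lβ.E-cong Lβ.glued-refl) g (λ _ → c g)
      E-cong⁺ c c′ {just _} {just _} {nothing} {nothing} g _ =
        copy-cong (λ a → E β (just a) nothing) ε′ (λ e → Lβ.E-cong e Lβ.glued-refl) g (λ _ → c′ g)
      E-cong⁺ c c′ {just _} {just _} {just _} {just _} g g′ = LN.E-cong g g′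

      sym⁺ : ∀ {p q} → glued N⁺ p q ≡ true → glued N⁺ q p ≡ true
      sym⁺ {nothing} {nothing} _ = refl
      sym⁺ {just _}  {just _}  g = LN.glued-sym g

      trans⁺ : ∀ {p q r} → glued N⁺ p q ≡ true → glued N⁺ q r ≡ true → glued N⁺ p r ≡ true
      trans⁺ {nothing} {nothing} {nothing} _ _  = refl
      trans⁺ {just _}  {just _}  {just _}  g g′ = LN.glued-trans g g′

      N⁺-old : N⁺ ∙ just ≡ N
      N⁺-old = str-ext (λ _ _ → refl) (λ _ → refl) (λ _ _ → refl) (λ _ _ → refl) S-old

      glued-just : ∀ {p j} → glued N⁺ p (just j) ≡ true → ∃[ i ] p ≡ just i
      glued-just {just i} _ = i , refl

      extension : Extension τ ε ε′
      extension = record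
        { N⁺ = N⁺ ; N⁺-refl = λ {p} → N⁺-refl {p} ; sym⁺ = λ {p} {q} → sym⁺ {p} {q}
        ; trans⁺ = λ {p} {q} {r} → trans⁺ {p} {q} {r}
        ; glued-just = λ {p} {j} → glued-just {p} {j}
        ; sort-cong⁺ = λ {p} {p′} → sort-cong⁺ {p} {p′}
        ; T-cong⁺ = λ {p} {p′} {q} {q′} → T-cong⁺ {p} {p′} {q} {q′}
        ; E-cong⁺ = λ c c′ {p} {p′} {q} {q′} → E-cong⁺ c c′ {p} {p′} {q} {q′}
        ; N⁺-old = N⁺-old
        ; inside-glued = λ {p} {q} {p′} {q′} → inside-glued {p} {q} {p′} {q′}
        ; inside-sort = λ {p} {q} → inside-sort {p} {q}
        ; inside-T = λ {p} {q} {p′} {q′} → inside-T {p} {q} {p′} {q′}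
        ; inside-E = λ {p} {q} {p′} {q′} → inside-E {p} {q} {p′} {q′}
        ; inside-S = λ {D} {q} → inside-S {D} {q}
        ; S-old = S-old ; S-new = S-new ; T-new-in = T-new-in ; T-in-new = T-in-new
        ; E-new-out = copy-out (λ a → E β nothing (just a)) ε
        ; E-out-new = copy-out (λ a → E β (just a) nothing) ε′
        ; new-inside = refl ; In-inside = λ g → g }

    -- An outside apex j is either excused from being related to the new point,
    -- or both are cones over D.
    module _ {τ : Task} {ε ε′ : Task.I τ → Label} (X : Extension τ ε ε′) where
      open Task τ
      open Extension X

      data Link (C : Set) (D : Fin d → I) (h : ℕ → Value) (t₀ : ℕ) (j : I) : Label → Label → Set where
        excused : ∀ i → (∀ b → Base N i b → Above N⁺ nothing (just b) → ¬ Above N j b) →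
                  Link C D h t₀ j (white i) (white i)
        cone    : ∀ t → C → Cone N D j t → Link C D h t₀ j (red (h t₀) (h t)) (red (h t) (h t₀))

      record Links : Set₁ where
        field
          C       : Set
          D       : Fin d → I
          h       : ℕ → Value
          t₀      : ℕ
          tr      : C → Transversal N D
          new     : C → Cone N⁺ (just ∘ D) nothing t₀
          fits    : C → Fits N D h
          hom     : C → Homomorphic (λ t → Tint N D t ⊎ t ≡ t₀) h
          ε-cong  : ∀ {j j′} → glued N j j′ ≡ true → ε j ≡ ε j′
          ε′-cong : ∀ {j j′} → glued N j j′ ≡ true → ε′ j ≡ ε′ j′
          link    : sort β nothing ≡ zero → ∀ j → Apex N j → ¬ In j → Link C D h t₀ j (ε j) (ε′ j)

    module Legality {τ : Task} {ε ε′ : Task.I τ → Label} {X : Extension τ ε ε′} (K : Links X) where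
      open Task τ
      open Extension X
      open Links K

      D-in : C → ∀ i → In (D i)
      D-in c i = T-in-new (proj₂ (proj₁ (proj₂ (new c)) i))

      In⇒D : C → ∀ {b i} → In b → Base N i b → glued N b (D i) ≡ true
      In⇒D c = filled-base (tr c) (D-in c)

      In⇒¬apex : C → ∀ {j} → In j → ¬ Apex N j
      In⇒¬apex c (a , e) ap =
        let (i , e′) = filled (tr c) (D-in c) a
        in case trans (sym ap) (trans (LN.sort-cong (LN.glued-trans e e′)) (tr c i)) of λ ()

      link-red : ∀ {j e e′ x y} → Link X C D h t₀ j e e′ → e ≡ red x y →
                 ∃[ t ] (C × Cone N D j t × x ≡ h t₀ × y ≡ h t)
      link-red (cone t c co) refl = t , c , co , refl , refl

      link-red′ : ∀ {j e e′ x y} → Link X C D h t₀ j e e′ → e′ ≡ red x y →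
                  ∃[ t ] (C × Cone N D j t × x ≡ h t × y ≡ h t₀)
      link-red′ (cone t c co) refl = t , c , co , refl , refl

      link-white : ∀ {j e e′ i b} → Link X C D h t₀ j e e′ → e ≡ white i ⊎ e′ ≡ white i →
                   Base N i b → Above N⁺ nothing (just b) → ¬ Above N j b
      link-white (excused i ex) (inj₁ refl) = ex _
      link-white (excused i ex) (inj₂ refl) = ex _
      link-white (cone _ _ _)   (inj₁ ())
      link-white (cone _ _ _)   (inj₂ ())

      cone-cong⁺ : ∀ {D D′ v t} → (∀ i → glued N⁺ (D i) (D′ i) ≡ true) → Cone N⁺ D v t → Cone N⁺ D′ v t
      cone-cong⁺ g (ap , ab , e) = ap
        , (λ i → let (t , e′) = ab i in t , trans (T-cong⁺ (sym⁺ (g i)) N⁺-refl) e′)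
        , trans (T-cong⁺ (sym⁺ (g zero)) N⁺-refl) e

      all-just : (D : Fin d → Maybe I) → (∀ i → ∃[ j ] D i ≡ just j) → ∃[ D₀ ] D ≡ just ∘ D₀
      all-just D h = (λ i → proj₁ (h i)) , fe λ i → proj₂ (h i)

      S-cong⁺ : ∀ {D D′} → (∀ i → glued N⁺ (D i) (D′ i) ≡ true) → ∀ t → S N⁺ D t ≡ S N⁺ D′ t
      S-cong⁺ {D} {D′} g t = by-cases {P = ∃[ D₀ ] D′ ≡ just ∘ D₀}
        (λ { (D₀ , refl) → let (D₁ , e) = all-just D (λ i → glued-just (g i)) in
             both-old D₁ D₀ e g })
        (λ ¬old′ →
          let ¬old : ¬ (∃[ D₀ ] D ≡ just ∘ D₀)
              ¬old = λ { (D₀ , refl) → ¬old′ (all-just D′ λ i → glued-just (sym⁺ (g i))) }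
          in by-cases {P = Σ[ q ∈ (Fin d → Maybe (Fin d)) ] (∀ i → Inside (D i) (q i))}
            (λ (q , ins) → trans (inside-S {D} {q} ins t) (sym (inside-S {D′} {q} (λ i → trans⁺ (sym⁺ (g i)) (ins i)) t)))
            (λ ¬in → trans (S-new D ¬old ¬in t)
               (trans (⌊⌋-cong (λ (v , c) → v , cone-cong⁺ g c) (λ (v , c) → v , cone-cong⁺ (sym⁺ ∘ g) c))
                 (sym (S-new D′ ¬old′ (λ (q , ins) → ¬in (q , λ i → trans⁺ (g i) (ins i))) t)))))
        where
        both-old : ∀ {D} D₁ D₀ → D ≡ just ∘ D₁ → (∀ i → glued N⁺ (D i) (just (D₀ i)) ≡ true) →
                   S N⁺ D t ≡ S N⁺ (just ∘ D₀) t
        both-old D₁ D₀ refl g = trans (S-old D₁ t) (trans (LN.S-cong (λ i → trans (sym (old-glued (D₁ i) (D₀ i))) (g i)) t) (sym (S-old D₀ t)))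

      β-sort : ∀ {p q x} → Inside p q → sort N⁺ p ≡ x → sort β q ≡ x
      β-sort i e = trans (sym (inside-sort i)) e

      β-apices : ∀ {p q p′ q′} → Inside p q → Inside p′ q′ → Apices N⁺ p p′ → Apices β q q′
      β-apices i i′ (a , a′ , n) = β-sort i a , β-sort i′ a′ , λ g → n (trans (inside-glued i i′) g)

      β-above : ∀ {v b p q} → Inside v p → Inside b q → Above N⁺ v b → Above β p q
      β-above i i′ (t , e) = t , trans (sym (inside-T i′ i)) e

      N-sort : ∀ {i x} → sort N⁺ (just i) ≡ x → sort N i ≡ x
      N-sort e = trans (sym (old-sort _)) e

      N-apices : ∀ {i j} → Apices N⁺ (just i) (just j) → Apices N i j
      N-apices (a , a′ , n) = N-sort a , N-sort a′ , λ g → n (trans (old-glued _ _) g)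

      N-T : ∀ {i j x} → T N⁺ (just i) (just j) ≡ x → T N i j ≡ x
      N-T e = trans (sym (old-T _ _)) e

      N-above : ∀ {v b} → Above N⁺ (just v) (just b) → Above N v b
      N-above (t , e) = t , N-T e

      N-E : ∀ {i j x} → E N⁺ (just i) (just j) ≡ x → E N i j ≡ x
      N-E e = trans (sym (old-E _ _)) e

      inside : ∀ {j} → In j → ∃[ q ] Inside (just j) q
      inside (a , e) = just a , In-inside e

      new-apex : sort N⁺ nothing ≡ zero → sort β nothing ≡ zero
      new-apex = β-sort new-inside

      excuse-β : ∀ {i b v w p q r} → Inside b p → Inside v q → Inside w r → Base N⁺ i b → Apices N⁺ v w →
                 Above N⁺ v b → Above N⁺ w b → E N⁺ v w ≢ white i
      excuse-β ib iv iw bs ap a a′ e = Lβ.excuse (β-sort ib bs) (β-apices iv iw ap)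
        (β-above iv ib a) (β-above iw ib a′) (trans (sym (inside-E iv iw)) e)

      base≢apex : ∀ {p} {i : Fin d} → sort N⁺ p ≡ suc i → ¬ sort N⁺ p ≡ zero
      base≢apex b a = case trans (sym b) a of λ ()

      excuse⁺ : ∀ {i b v w} → Base N⁺ i b → Apices N⁺ v w → Above N⁺ v b → Above N⁺ w b → E N⁺ v w ≢ white i
      excuse⁺ {b = nothing} {nothing} bs (av , _) = ⊥-elim (base≢apex bs av)
      excuse⁺ {b = nothing} {just _} {nothing} bs (_ , aw , _) = ⊥-elim (base≢apex bs aw)
      excuse⁺ {b = nothing} {just v} {just w} bs ap a a′ =
        excuse-β new-inside (proj₂ (inside (T-new-in (proj₂ a)))) (proj₂ (inside (T-new-in (proj₂ a′)))) bs ap a a′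
      excuse⁺ {b = just b} {nothing} {nothing} bs (_ , _ , n) = ⊥-elim (n N⁺-refl)
      excuse⁺ {b = just b} {nothing} {just w} bs ap a a′ e = by-cases {P = In w}
        (λ iw → excuse-β (proj₂ (inside (T-in-new (proj₂ a)))) new-inside (proj₂ (inside iw)) bs ap a a′ e)
        (λ ow → link-white (link (new-apex (proj₁ ap)) w (N-sort (proj₁ (proj₂ ap))) ow)
                  (inj₁ (trans (sym (E-new-out ow)) e)) (N-sort bs) a (N-above a′))
      excuse⁺ {b = just b} {just v} {nothing} bs ap a a′ e = by-cases {P = In v}
        (λ iv → excuse-β (proj₂ (inside (T-in-new (proj₂ a′)))) (proj₂ (inside iv)) new-inside bs ap a a′ e)
        (λ ov → link-white (link (new-apex (proj₁ (proj₂ ap))) v (N-sort (proj₁ ap)) ov)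
                  (inj₂ (trans (sym (E-out-new ov)) e)) (N-sort bs) a′ (N-above a))
      excuse⁺ {b = just b} {just v} {just w} bs ap a a′ e =
        LN.excuse (N-sort bs) (N-apices ap) (N-above a) (N-above a′) (N-E e)

      red-sym-β : ∀ {v w q r x y} → Inside v q → Inside w r → Apices N⁺ v w → Red N⁺ v w x y →
                  Red N⁺ w v y x × H (height x)
      red-sym-β iv iw ap e =
        let (e′ , hx) = Lβ.red-sym (β-apices iv iw ap) (trans (sym (inside-E iv iw)) e)
        in trans (inside-E iw iv) e′ , hx

      H-new : C → H (height (h t₀))
      H-new c = proj₂ (hom c) (inj₂ refl)

      H-old : C → ∀ {j t} → Cone N D j t → H (height (h t))
      H-old c co = proj₂ (hom c) (inj₁ (_ , co))

      link-sym : ∀ {j e e′ x y} → Link X C D h t₀ j e e′ → e ≡ red x y → e′ ≡ red y x × H (height x)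
      link-sym (cone t c co) refl = refl , H-new c

      link-sym′ : ∀ {j e e′ x y} → Link X C D h t₀ j e e′ → e′ ≡ red x y → e ≡ red y x × H (height x)
      link-sym′ (cone t c co) refl = refl , H-old c co

      red-sym⁺ : ∀ {v w x y} → Apices N⁺ v w → Red N⁺ v w x y → Red N⁺ w v y x × H (height x)
      red-sym⁺ {nothing} {nothing} (_ , _ , n) = ⊥-elim (n N⁺-refl)
      red-sym⁺ {nothing} {just w} ap e = by-cases {P = In w}
        (λ iw → red-sym-β new-inside (proj₂ (inside iw)) ap e)
        (λ ow → let (e′ , hx) = link-sym (link (new-apex (proj₁ ap)) w (N-sort (proj₁ (proj₂ ap))) ow)
                                         (trans (sym (E-new-out ow)) e)
                in trans (E-out-new ow) e′ , hx)
      red-sym⁺ {just v} {nothing} ap e = by-cases {P = In v}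
        (λ iv → red-sym-β (proj₂ (inside iv)) new-inside ap e)
        (λ ov → let (e′ , hx) = link-sym′ (link (new-apex (proj₁ (proj₂ ap))) v (N-sort (proj₁ ap)) ov)
                                          (trans (sym (E-out-new ov)) e)
                in trans (E-new-out ov) e′ , hx)
      red-sym⁺ {just v} {just w} ap e =
        let (e′ , hx) = LN.red-sym (N-apices ap) (N-E e) in trans (old-E _ _) e′ , hx

      Cones : I → I → Value → Value → Value → Value → Set
      Cones j k x y x′ z = C × ∃[ t ] ∃[ t′ ] (Cone N D j t × Cone N D k t′ ×
                             x ≡ h t₀ × y ≡ h t × x′ ≡ h t₀ × z ≡ h t′)

      both : ∀ {j k x y x′ z} → Apices N⁺ nothing (just j) → Apices N⁺ nothing (just k) →
             Red N⁺ nothing (just j) x y → Red N⁺ nothing (just k) x′ z →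
             (In j × In k) ⊎ Cones j k x y x′ z
      both {j} {k} ap ap′ e e′ = by-cases {P = In j}
        (λ ij → by-cases {P = In k} (λ ik → inj₁ (ij , ik))
          (λ ok → let (_ , c , _) = out ap′ ok e′ in ⊥-elim (In⇒¬apex c ij (N-sort (proj₁ (proj₂ ap))))))
        (λ oj → let (t , c , co , x≡ , y≡) = out ap oj e in by-cases {P = In k}
          (λ ik → ⊥-elim (In⇒¬apex c ik (N-sort (proj₁ (proj₂ ap′)))))
          (λ ok → let (t′ , _ , co′ , x′≡ , z≡) = out ap′ ok e′
                  in inj₂ (c , t , t′ , co , co′ , x≡ , y≡ , x′≡ , z≡)))
        where
        out : ∀ {j x y} → Apices N⁺ nothing (just j) → ¬ In j → Red N⁺ nothing (just j) x y →
              ∃[ t ] (C × Cone N D j t × x ≡ h t₀ × y ≡ h t)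
        out {j} ap oj e = link-red (link (new-apex (proj₁ ap)) j (N-sort (proj₁ (proj₂ ap))) oj)
                                   (trans (sym (E-new-out oj)) e)

      red-unique-β : ∀ {u v w p q r x x′ y y′ z z′} → Inside u p → Inside v q → Inside w r →
                     Apices N⁺ u v → Apices N⁺ u w → Apices N⁺ v w →
                     Red N⁺ u v x y → Red N⁺ u w x′ z → Red N⁺ v w y′ z′ → x ≡ x′
      red-unique-β iu iv iw a a′ a″ e e′ e″ =
        Lβ.red-unique (β-apices iu iv a) (β-apices iu iw a′) (β-apices iv iw a″)
          (trans (sym (inside-E iu iv)) e) (trans (sym (inside-E iu iw)) e′) (trans (sym (inside-E iv iw)) e″)

      apices-sym : ∀ {p p′} → Apices N⁺ p p′ → Apices N⁺ p′ p
      apices-sym (a , a′ , n) = a′ , a , n ∘ sym⁺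

      red-unique⁺ : ∀ {u v w x x′ y y′ z z′} → Apices N⁺ u v → Apices N⁺ u w → Apices N⁺ v w →
                    Red N⁺ u v x y → Red N⁺ u w x′ z → Red N⁺ v w y′ z′ → x ≡ x′
      red-unique⁺ {nothing} {nothing} (_ , _ , n) = ⊥-elim (n N⁺-refl)
      red-unique⁺ {nothing} {just _} {nothing} _ (_ , _ , n) = ⊥-elim (n N⁺-refl)
      red-unique⁺ {just _} {nothing} {nothing} _ _ (_ , _ , n) = ⊥-elim (n N⁺-refl)
      red-unique⁺ {nothing} {just j} {just k} a a′ a″ e e′ e″ =
        [ (λ (ij , ik) → red-unique-β new-inside (proj₂ (inside ij)) (proj₂ (inside ik)) a a′ a″ e e′ e″)
        , (λ (_ , _ , _ , _ , _ , x≡ , _ , x′≡ , _) → trans x≡ (sym x′≡)) ]′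
        (both a a′ e e′)
      red-unique⁺ {just j} {nothing} {just k} a a′ a″ e e′ e″ =
        [ (λ (ij , ik) → red-unique-β (proj₂ (inside ij)) new-inside (proj₂ (inside ik)) a a′ a″ e e′ e″)
        , (λ (c , _ , _ , co , co′ , _ , x≡ , _ , _) →
            trans x≡ (proj₁ (red-injective (trans (sym (fits c co co′ (proj₂ (proj₂ (N-apices a′))))) (N-E e′))))) ]′
        (both (apices-sym a) a″ (proj₁ (red-sym⁺ a e)) e″)
      red-unique⁺ {just j} {just k} {nothing} a a′ a″ e e′ e″ =
        [ (λ (ij , ik) → red-unique-β (proj₂ (inside ij)) (proj₂ (inside ik)) new-inside a a′ a″ e e′ e″)
        , (λ (c , _ , _ , co , co′ , _ , x′≡ , _ , _) →
            sym (trans x′≡ (proj₁ (red-injective (trans (sym (fits c co co′ (proj₂ (proj₂ (N-apices a))))) (N-E e)))))) ]′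
        (both (apices-sym a′) (apices-sym a″) (proj₁ (red-sym⁺ a′ e′)) (proj₁ (red-sym⁺ a″ e″)))
      red-unique⁺ {just _} {just _} {just _} a a′ a″ e e′ e″ =
        LN.red-unique (N-apices a) (N-apices a′) (N-apices a″) (N-E e) (N-E e′) (N-E e″)

      red-tint-β : ∀ {b v w p q r t t′ x y} → Inside b p → Inside v q → Inside w r → Base N⁺ zero b →
                   Apices N⁺ v w → T N⁺ b v ≡ just t → T N⁺ b w ≡ just t′ → Red N⁺ v w x y → Compatible t x t′ y
      red-tint-β ib iv iw bs ap e e′ r = Lβ.red-tint (β-sort ib bs) (β-apices iv iw ap)
        (trans (sym (inside-T ib iv)) e) (trans (sym (inside-T ib iw)) e′) (trans (sym (inside-E iv iw)) r)

      new-tint : C → ∀ {b t} → Base N⁺ zero (just b) → T N⁺ (just b) nothing ≡ just t → t ≡ t₀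
      new-tint c {b} bs e = just-injective (trans (sym e) (trans
        (T-cong⁺ (trans (old-glued _ _) (In⇒D c (T-in-new e) (N-sort bs))) N⁺-refl) (proj₂ (proj₂ (new c)))))

      old-tint : C → ∀ {b j t t′} → Base N⁺ zero (just b) → In b → Cone N D j t → T N⁺ (just b) (just j) ≡ just t′ → t′ ≡ t
      old-tint c bs ib (_ , _ , e) e′ = just-injective (trans (sym (N-T e′))
        (trans (LN.T-cong (In⇒D c ib (N-sort bs)) LN.glued-refl) e))

      compat : ∀ {t x t′ y t₁ t₂} → t ≡ t₁ → x ≡ h t₁ → t′ ≡ t₂ → y ≡ h t₂ →
               Compatible t₁ (h t₁) t₂ (h t₂) → Compatible t x t′ y
      compat refl refl refl refl c = c

      red-tint⁺ : ∀ {b v w t t′ x y} → Base N⁺ zero b → Apices N⁺ v w →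
                  T N⁺ b v ≡ just t → T N⁺ b w ≡ just t′ → Red N⁺ v w x y → Compatible t x t′ y
      red-tint⁺ {nothing} {nothing} bs (av , _) = ⊥-elim (base≢apex bs av)
      red-tint⁺ {nothing} {just _} {nothing} bs (_ , aw , _) = ⊥-elim (base≢apex bs aw)
      red-tint⁺ {nothing} {just v} {just w} bs ap e e′ r =
        red-tint-β new-inside (proj₂ (inside (T-new-in e))) (proj₂ (inside (T-new-in e′))) bs ap e e′ r
      red-tint⁺ {just b} {nothing} {nothing} bs (_ , _ , n) = ⊥-elim (n N⁺-refl)
      red-tint⁺ {just b} {nothing} {just w} bs ap e e′ r = by-cases {P = In w}
        (λ iw → red-tint-β (proj₂ (inside (T-in-new e))) new-inside (proj₂ (inside iw)) bs ap e e′ r)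
        (λ ow → let (t′ , c , co , x≡ , y≡) = link-red (link (new-apex (proj₁ ap)) w (N-sort (proj₁ (proj₂ ap))) ow)
                                                (trans (sym (E-new-out ow)) r)
                in compat (new-tint c bs e) x≡ (old-tint c bs (T-in-new e) co e′) y≡
                     (proj₁ (hom c) (inj₂ refl) (inj₁ (_ , co))))
      red-tint⁺ {just b} {just v} {nothing} bs ap e e′ r = by-cases {P = In v}
        (λ iv → red-tint-β (proj₂ (inside (T-in-new e′))) (proj₂ (inside iv)) new-inside bs ap e e′ r)
        (λ ov → let (t′ , c , co , x≡ , y≡) = link-red′ (link (new-apex (proj₁ (proj₂ ap))) v (N-sort (proj₁ ap)) ov)
                                                (trans (sym (E-out-new ov)) r)
                in compat (old-tint c bs (T-in-new e′) co e) x≡ (new-tint c bs e′) y≡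
                     (proj₁ (hom c) (inj₁ (_ , co)) (inj₂ refl)))
      red-tint⁺ {just b} {just v} {just w} bs ap e e′ r =
        LN.red-tint (N-sort bs) (N-apices ap) (N-T e) (N-T e′) (N-E r)

      cone-β : ∀ {D v t p q} → (∀ i → Inside (D i) (q i)) → Inside v p → Cone N⁺ D v t → Cone β q p t
      cone-β iD iv (a , ab , e) = β-sort iv a , (λ i → β-above iv (iD i) (ab i))
        , trans (sym (inside-T (iD zero) iv)) e

      cone-N : ∀ {D j t} → Cone N⁺ (just ∘ D) (just j) t → Cone N D j t
      cone-N (a , ab , e) = N-sort a , (λ i → N-above (ab i)) , N-T e

      transversal-just : ∀ {D} → Transversal N⁺ D → sort N⁺ nothing ≡ zero → ∀ i → ∃[ j ] D i ≡ just j
      transversal-just {D} tr′ a i with D i | tr′ i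
      ... | just j  | _ = j , refl
      ... | nothing | b = ⊥-elim (base≢apex b a)

      some-new : ∀ {D} → ¬ (∃[ D₀ ] D ≡ just ∘ D₀) → ∃[ i ] D i ≡ nothing
      some-new {D} ¬old = dne λ ¬new → ¬old (all-just D λ i → is-just (λ e → ¬new (i , e)))
        where
        is-just : ∀ {p : Maybe I} → p ≢ nothing → ∃[ j ] p ≡ just j
        is-just {just j}  _ = j , refl
        is-just {nothing} n = ⊥-elim (n refl)

      cone-over-new : ∀ {D v t} → Transversal N⁺ D → ¬ (∃[ D₀ ] D ≡ just ∘ D₀) → Cone N⁺ D v t →
                      ∃[ j ] (v ≡ just j × In j)
      cone-over-new {D} {nothing} tr′ ¬old (a , _) =
        ⊥-elim (¬old (all-just D (transversal-just tr′ a)))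
      cone-over-new {D} {just j} tr′ ¬old (_ , ab , _) =
        let (i , e) = some-new ¬old
            (t , e′) = ab i
        in j , refl , T-new-in (trans (cong (λ p → T N⁺ p (just j)) (sym e)) e′)

      cone-tint⁺ : ∀ {D v t} → Transversal N⁺ D → Cone N⁺ D v t → S N⁺ D t ≡ true
      cone-tint⁺ {D} {v} {t} tr′ co = by-cases {P = ∃[ D₀ ] D ≡ just ∘ D₀}
        (λ { (D₀ , refl) → old D₀ tr′ co })
        (λ ¬old → by-cases {P = Σ[ q ∈ (Fin d → Maybe (Fin d)) ] (∀ i → Inside (D i) (q i))}
          (λ (q , ins) → let (j , v≡ , ij) = cone-over-new tr′ ¬old co in
             trans (inside-S {D} {q} ins t)
               (Lβ.cone-tint (λ i → β-sort (ins i) (tr′ i))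
                 (cone-β ins (subst (λ p → Inside p (proj₁ (inside ij))) (sym v≡) (proj₂ (inside ij))) co)))
          (λ ¬in → trans (S-new D ¬old ¬in t) (⌊⌋-intro (v , co))))
        where
        old : ∀ {v} D₀ → Transversal N⁺ (just ∘ D₀) → Cone N⁺ (just ∘ D₀) v t → S N⁺ (just ∘ D₀) t ≡ true
        old {just j} D₀ tr′ co = trans (S-old D₀ t) (LN.cone-tint (λ i → N-sort (tr′ i)) (cone-N co))
        old {nothing} D₀ tr′ co@(_ , ab , _) =
          let ins i = proj₂ (inside (T-in-new (proj₂ (ab i))))
          in trans (inside-S ins t) (Lβ.cone-tint (λ i → β-sort (ins i) (tr′ i)) (cone-β ins new-inside co))

      legal⁺ : Legal H N⁺
      legal⁺ = record
        { glued-refl = N⁺-refl ; glued-sym = sym⁺ ; glued-trans = trans⁺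
        ; sort-cong = sort-cong⁺ ; T-cong = T-cong⁺ ; E-cong = E-cong⁺ ε-cong ε′-cong ; S-cong = S-cong⁺
        ; excuse = λ {i} {b} {v} {w} → excuse⁺ {i} {b} {v} {w}
        ; red-sym = λ {v} {w} → red-sym⁺ {v} {w}
        ; red-unique = λ {u} {v} {w} → red-unique⁺ {u} {v} {w}
        ; red-tint = λ {b} {v} {w} → red-tint⁺ {b} {v} {w}
        ; cone-tint = cone-tint⁺ }

  infix 9 _[_↦_]

  _[_↦_] : ∀ {a} {A : Set a} → (ℕ → A) → ℕ → A → ℕ → A
  (h [ t ↦ x ]) t′ = by-cases {P = t′ ≡ t} (λ _ → x) (λ _ → h t′)

  update-at : ∀ {a} {A : Set a} {h : ℕ → A} {t x} → (h [ t ↦ x ]) t ≡ x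
  update-at {x = x} = by-cases-elim (_≡ x) (λ _ → refl) (λ n → ⊥-elim (n refl))

  update-off : ∀ {a} {A : Set a} {h : ℕ → A} {t x t′} → t′ ≢ t → (h [ t ↦ x ]) t′ ≡ h t′
  update-off {h = h} {t′ = t′} n = by-cases-elim (_≡ h t′) (λ e → ⊥-elim (n e)) (λ _ → refl)

  -- A choice of values for the tints that become visible over a tuple of base
  -- points: from G s P h the existential player survives s further new tints.
  module Play (d₂ κ : ℕ) (c₀ : Fin κ) (H : ℕ → Set) (H₀ : H 0) (n₁ : ℕ) where
    open Rainbow d₂ κ
    open Str
    open Response d₂ κ c₀ H H₀

    record Small (P : ℕ → Set) : Set where
      field
        size     : ℕ
        list     : Fin size → ℕ
        complete : ∀ {t} → P t → ∃[ i ] list i ≡ t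
        bound    : ∀ {k} (v : Fin k → ℕ) → (∀ {i j} → v i ≡ v j → i ≡ j) → (∀ i → P (v i)) → k + d ≤ n₁

    record Plan : Set₁ where
      field
        Ok       : ℕ → Set
        Ok-pred  : ∀ {s} → Ok (suc s) → Ok s
        G        : ℕ → (ℕ → Set) → (ℕ → Value) → Set
        G-hom    : ∀ {s P h} → G s P h → Homomorphic P h
        G-sub    : ∀ {s P P′ h} → (∀ {t} → P′ t → P t) → G s P h → G s P′ h
        G-mono   : ∀ {s P h} → G (suc s) P h → G s P h
        G-single : ∀ {s} → Ok s → ∀ t → ∃[ h ] G s (_≡ t) h
        G-extend : ∀ {s P h t} → G (suc s) P h → ¬ P t → Small P → ∃[ x ] G s (λ t′ → P t′ ⊎ t′ ≡ t) (h [ t ↦ x ])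

    Hom-sub : ∀ {P P′ : ℕ → Set} {h} → (∀ {t} → P′ t → P t) → Homomorphic P h → Homomorphic P′ h
    Hom-sub f (c , b) = (λ x y → c (f x) (f y)) , (λ x → b (f x))

    distinct-count : ∀ {I : Set} {N : Str I} → Legal H N → ∀ {k} (e : I → Fin k) → (∀ {i j} → e i ≡ e j → i ≡ j) →
                     ∀ {D} → Transversal N D → ∀ {k′} (v : Fin k′ → I) → (∀ i → Apex N (v i)) →
                     (∀ {i j} → glued N (v i) (v j) ≡ true → i ≡ j) → k′ + d ≤ k
    distinct-count {I} {N} L {k} e e-inj {D} tr {k′} v ap v-inj =
      injective⇒≤ {f = λ x → e (point (splitAt k′ x))} λ {x} {y} eq →
        trans (sym (join-splitAt k′ d x))
          (trans (cong (join k′ d) (same (splitAt k′ x) (splitAt k′ y) (e-inj eq))) (join-splitAt k′ d y))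
      where
      open Legal L
      point : Fin k′ ⊎ Fin d → I
      point = [ v , D ]′

      glue-≡ : ∀ {i j} → i ≡ j → glued N i j ≡ true
      glue-≡ refl = glued-refl

      same : ∀ x y → point x ≡ point y → x ≡ y
      same (inj₁ i) (inj₁ j) eq = cong inj₁ (v-inj (glue-≡ eq))
      same (inj₁ i) (inj₂ j) eq = case trans (sym (ap i)) (trans (cong (sort N) eq) (tr j)) of λ ()
      same (inj₂ i) (inj₁ j) eq = case trans (sym (ap j)) (trans (cong (sort N) (sym eq)) (tr i)) of λ ()
      same (inj₂ i) (inj₂ j) eq = cong inj₂ (suc-injective (trans (sym (tr i)) (trans (cong (sort N) eq) (tr j))))

    module Strategist (plan : Plan) where
      open Plan plan

      Inv : ∀ {I} → ℕ → Str I → (Fin d → I) → Set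
      Inv s N D = ∃[ h ] (Fits N D h × (Homomorphic (λ t → S N D t ≡ true) h ⊎ G s (Tint N D) h))

      Good : ∀ {I} → ℕ → Str I → Set
      Good s N = Ok s × Legal H N × (∀ D → Transversal N D → Inv s N D)

      Good-∙ : ∀ {I J s} {N : Str I} (ρ : J → I) → Good s N → Good s (N ∙ ρ)
      Good-∙ ρ (ok , L , inv) = ok , Legal-∙ ρ L , λ D tr →
        let (h , fits , r) = inv (ρ ∘ D) tr
        in h , (λ c c′ → fits c c′)
             , [ inj₁ , (λ g → inj₂ (G-sub (λ (v , c) → ρ v , c) g)) ]′ r

      Good-mono : ∀ {I s} {N : Str I} → Good (suc s) N → Good s N
      Good-mono (ok , L , inv) = Ok-pred ok , L , λ D tr →
        let (h , fits , r) = inv D tr in h , fits , [ inj₁ , (λ g → inj₂ (G-mono g)) ]′ r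

      -- d + 1 points contain at most one cone over a given tuple.
      Legal⇒Good : ∀ {s} {β : Str (Maybe (Fin d))} → Ok s → Legal H β → Good s β
      Legal⇒Good {s} {β} ok L = ok , L , inv
        where
        code : Maybe (Fin d) → Fin m
        code nothing  = zero
        code (just a) = suc a

        code-injective : ∀ {p q} → code p ≡ code q → p ≡ q
        code-injective {nothing} {nothing} _ = refl
        code-injective {just _}  {just _}  e = cong just (suc-injective e)

        inv : ∀ D → Transversal β D → Inv s β D
        inv D tr = by-cases {P = ∃[ t ] Tint β D t} {R = Inv s β D}
          (λ (t , v , c) → let (h , g) = G-single ok t in
            h , (λ c c′ n → ⊥-elim (n (one c c′)))
              , inj₂ (G-sub (λ (w , c′) → cone-tint-unique L (one c′ c) c′ c) g))
          (λ ¬t → let (h , g) = G-single ok 0 in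
            h , (λ c _ _ → ⊥-elim (¬t (_ , _ , c))) , inj₂ (G-sub (λ tt → ⊥-elim (¬t (_ , tt))) g))
          where
          one : ∀ {v w t t′} → Cone β D v t → Cone β D w t′ → glued β v w ≡ true
          one {v} {w} c c′ = dne λ n → 1+n≰n
            (distinct-count L code (λ {p} {q} → code-injective {p} {q}) tr (v ▹ const w)
              (λ { zero → proj₁ c ; (suc _) → proj₁ c′ }) (pair n))
            where
            pair : ¬ glued β v w ≡ true → ∀ {i j : Fin 2} →
                   glued β ((v ▹ const w) i) ((v ▹ const w) j) ≡ true → i ≡ j
            pair n {zero}     {zero}     _ = refl
            pair n {zero}     {suc zero} g = ⊥-elim (n g)
            pair n {suc zero} {zero}     g = ⊥-elim (n (Legal.glued-sym L g))
            pair n {suc zero} {suc zero} _ = refl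

      module Preserve {τ : Task} {ε ε′ : Task.I τ → Label} {X : Extension τ ε ε′} (K : Links X) {s}
        (good : Good (suc s) (Task.N τ))
        (all-cones : ∀ D t → Transversal (Task.N τ) D → Cone (Extension.N⁺ X) (just ∘ D) nothing t → Links.C K)
        (inv-new : Links.C K → Homomorphic (λ t → S (Task.N τ) (Links.D K) t ≡ true) (Links.h K)
                             ⊎ G s (λ t → Tint (Task.N τ) (Links.D K) t ⊎ t ≡ Links.t₀ K) (Links.h K)) where
        open Task τ
        open Extension X
        open Links K
        open Legality K

        ok⁺ : Ok s
        ok⁺ = Ok-pred (proj₁ good)

        inv⁺-unchanged : ∀ D₀ → Transversal N D₀ → ¬ (∃[ t ] Cone N⁺ (just ∘ D₀) nothing t) → Inv s N⁺ (just ∘ D₀)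
        inv⁺-unchanged D₀ tr₀ ¬new =
          let (h₀ , fits₀ , r) = proj₂ (proj₂ good) D₀ tr₀
          in h₀ , fits⁺ h₀ fits₀
           , [ (λ hm → inj₁ (Hom-sub (λ {t} e → trans (sym (S-old D₀ t)) e) hm))
             , (λ g → inj₂ (G-sub old-tint-only (G-mono g))) ]′ r
          where
          fits⁺ : ∀ h₀ → Fits N D₀ h₀ → Fits N⁺ (just ∘ D₀) h₀
          fits⁺ h₀ f₀ {nothing} c _ _ = ⊥-elim (¬new (_ , c))
          fits⁺ h₀ f₀ {just v} {nothing} _ c _ = ⊥-elim (¬new (_ , c))
          fits⁺ h₀ f₀ {just v} {just w} c c′ n =
            trans (old-E v w) (f₀ (cone-N c) (cone-N c′) (λ g → n (trans (old-glued v w) g)))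

          old-tint-only : ∀ {t} → Tint N⁺ (just ∘ D₀) t → Tint N D₀ t
          old-tint-only (nothing , c) = ⊥-elim (¬new (_ , c))
          old-tint-only (just v , c)  = v , cone-N c

        inv⁺-cone : ∀ D₀ t → Transversal N D₀ → Cone N⁺ (just ∘ D₀) nothing t → Inv s N⁺ (just ∘ D₀)
        inv⁺-cone D₀ t tr₀ co = h , fits⁺
          , [ (λ hm → inj₁ (Hom-sub (λ {u} e → trans (sym (LN.S-cong D₀~D u)) (trans (sym (S-old D₀ u)) e)) hm))
            , (λ g → inj₂ (G-sub tints g)) ]′ (inv-new cc)
          where
          cc : C
          cc = all-cones D₀ t tr₀ co

          D₀~D : ∀ i → glued N (D₀ i) (D i) ≡ true
          D₀~D i = In⇒D cc (T-in-new (proj₂ (proj₁ (proj₂ co) i))) (tr₀ i)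

          move : ∀ {j u} → Cone N⁺ (just ∘ D₀) (just j) u → Cone N D j u
          move c = let (a , ab , e) = cone-N c in
            a , (λ i → let (u , e′) = ab i in u , trans (LN.T-cong (LN.glued-sym (D₀~D i)) LN.glued-refl) e′)
              , trans (LN.T-cong (LN.glued-sym (D₀~D zero)) LN.glued-refl) e

          tint₀ : ∀ {u} → Cone N⁺ (just ∘ D₀) nothing u → u ≡ t₀
          tint₀ (_ , _ , e) = new-tint cc (trans (old-sort _) (tr₀ zero)) e

          tints : ∀ {u} → Tint N⁺ (just ∘ D₀) u → Tint N D u ⊎ u ≡ t₀
          tints (nothing , c) = inj₂ (tint₀ c)
          tints (just v , c)  = inj₁ (v , move c)

          linked : ∀ {w u e e′} → Link X C D h t₀ w e e′ → Cone N D w u →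
                   e ≡ red (h t₀) (h u) × e′ ≡ red (h u) (h t₀)
          linked (excused i ex) (_ , ab , _) = ⊥-elim (ex (D i) (tr cc i) (proj₁ (proj₂ (new cc)) i) (ab i))
          linked (cone u′ _ (_ , _ , e)) (_ , _ , e′) with just-injective (trans (sym e) e′)
          ... | refl = refl , refl

          out : ∀ {w u} → Cone N⁺ (just ∘ D₀) (just w) u → ¬ In w
          out c i = In⇒¬apex cc i (proj₁ (cone-N c))

          fits⁺ : Fits N⁺ (just ∘ D₀) h
          fits⁺ {nothing} {nothing} _ _ n = ⊥-elim (n N⁺-refl)
          fits⁺ {nothing} {just w} c c′ n with tint₀ c
          ... | refl = trans (E-new-out (out c′))
                         (proj₁ (linked (link (new-apex (proj₁ c)) w (N-sort (proj₁ c′)) (out c′)) (move c′)))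
          fits⁺ {just v} {nothing} c c′ n with tint₀ c′
          ... | refl = trans (E-out-new (out c))
                         (proj₂ (linked (link (new-apex (proj₁ c′)) v (N-sort (proj₁ c)) (out c)) (move c)))
          fits⁺ {just v} {just w} c c′ n =
            trans (old-E v w) (fits cc (move c) (move c′) (λ g → n (trans (old-glued v w) g)))

        inv⁺-inside : ∀ D₁ q → Transversal N⁺ D₁ → ¬ (∃[ D₀ ] D₁ ≡ just ∘ D₀) → (∀ i → Inside (D₁ i) (q i)) →
                      Inv s N⁺ D₁
        inv⁺-inside D₁ q tr₁ ¬old ins =
          let (h₁ , fits₁ , r) = proj₂ (proj₂ (Legal⇒Good ok⁺ Lβ)) q (λ i → β-sort (ins i) (tr₁ i))
          in h₁ , (λ c c′ n → let (iv , c₁) = inner c ; (iw , c₁′) = inner c′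
                               in trans (inside-E iv iw) (fits₁ c₁ c₁′ (λ g → n (trans (inside-glued iv iw) g))))
           , [ (λ hm → inj₁ (Hom-sub (λ {t} e → trans (sym (inside-S {D₁} {q} ins t)) e) hm))
             , (λ g → inj₂ (G-sub (λ (v , c) → _ , proj₂ (inner c)) g)) ]′ r
          where
          point : ∀ {v t} → Cone N⁺ D₁ v t → Maybe (Fin d)
          point c = let (_ , _ , i) = cone-over-new tr₁ ¬old c in proj₁ (inside i)

          inner : ∀ {v t} (c : Cone N⁺ D₁ v t) → Inside v (point c) × Cone β q (point c) t
          inner c =
            let (_ , e , i) = cone-over-new tr₁ ¬old c
                iv = subst (λ p → Inside p (proj₁ (inside i))) (sym e) (proj₂ (inside i))
            in iv , cone-β ins iv c

        inv⁺ : ∀ D₁ → Transversal N⁺ D₁ → Inv s N⁺ D₁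
        inv⁺ D₁ tr₁ = by-cases {P = ∃[ D₀ ] D₁ ≡ just ∘ D₀}
          (λ { (D₀ , refl) → by-cases {P = ∃[ t ] Cone N⁺ (just ∘ D₀) nothing t} {R = Inv s N⁺ (just ∘ D₀)}
            (λ (t , co) → inv⁺-cone D₀ t (λ i → N-sort (tr₁ i)) co)
            (inv⁺-unchanged D₀ (λ i → N-sort (tr₁ i))) })
          (λ ¬old → by-cases {P = Σ[ q ∈ (Fin d → Maybe (Fin d)) ] (∀ i → Inside (D₁ i) (q i))} {R = Inv s N⁺ D₁}
            (λ (q , ins) → inv⁺-inside D₁ q tr₁ ¬old ins)
            (λ ¬in → let (h₁ , fits₁ , hm) = fit legal⁺ tr₁
                     in h₁ , fits₁ , inj₁ (Hom-sub (λ {t} e → ⌊⌋-elim (trans (sym (S-new D₁ ¬old ¬in t)) e)) hm)))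

        good⁺ : Good s N⁺
        good⁺ = ok⁺ , legal⁺ , inv⁺

      tints-small : ∀ {N : Str (Fin n₁)} → Legal H N → ∀ {D} → Transversal N D → Small (Tint N D)
      tints-small {N} L {D} tr = record
        { size     = n₁
        ; list     = λ i → fromMaybe 0 (T N (D zero) i)
        ; complete = λ (v , _ , _ , e) → v , cong (fromMaybe 0) e
        ; bound    = λ v v-inj tint → distinct-count L id id tr (λ i → proj₁ (tint i)) (λ i → proj₁ (proj₂ (tint i)))
                       (λ {i} {j} g → v-inj (cone-tint-unique L g (proj₂ (tint i)) (proj₂ (tint j))))
        }

      module Answer (τ : Task) (small : ∀ {D} → Transversal (Task.N τ) D → Small (Tint (Task.N τ) D))
                    {s} (good : Good (suc s) (Task.N τ)) where
        open Task τ

        -- Says, in terms of β alone, that the new point is a cone over D in every extension.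
        NewCone : (Fin d → I) → ℕ → Set
        NewCone D t = Σ[ a ∈ (Fin d → Fin d) ] ((∀ i → glued N (D i) (F (a i)) ≡ true) × Cone β (just ∘ a) nothing t)

        module _ {ε ε′ : I → Label} (X : Extension τ ε ε′) where
          open Extension X

          NewCone⇒ : ∀ {D t} → NewCone D t → Cone N⁺ (just ∘ D) nothing t
          NewCone⇒ (a , g , ap , ab , e) = trans (inside-sort new-inside) ap
            , (λ i → let (t , e′) = ab i in t , trans (inside-T (In-inside (g i)) new-inside) e′)
            , trans (inside-T (In-inside (g zero)) new-inside) e

          ⇒NewCone : ∀ {D t} → Cone N⁺ (just ∘ D) nothing t → NewCone D t
          ⇒NewCone {D} (ap , ab , e) =
            (λ i → proj₁ (D-in i)) , (λ i → proj₂ (D-in i))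
            , trans (sym (inside-sort new-inside)) ap
            , (λ i → let (t , e′) = ab i in t , trans (sym (inside-T (In-inside (proj₂ (D-in i))) new-inside)) e′)
            , trans (sym (inside-T (In-inside (proj₂ (D-in zero))) new-inside)) e
            where
            D-in : ∀ i → In (D i)
            D-in i = T-in-new (proj₂ (ab i))

          emb-β : N⁺ ∙ emb ≡ β
          emb-β = str-ext (λ p q → inside-glued (N⁺-refl {emb p}) (N⁺-refl {emb q}))
            (λ p → inside-sort (N⁺-refl {emb p}))
            (λ p q → inside-T (N⁺-refl {emb p}) (N⁺-refl {emb q}))
            (λ p q → inside-E (N⁺-refl {emb p}) (N⁺-refl {emb q}))
            (λ D t → inside-S (λ i → N⁺-refl {emb (D i)}) t)

        Answered : Set
        Answered = Σ[ N⁺ ∈ Str (Maybe I) ] (Good s N⁺ × N⁺ ∙ just ≡ N × N⁺ ∙ emb ≡ β)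

        answered : ∀ {ε ε′} {X : Extension τ ε ε′} (K : Links X) →
                   (∀ D t → Transversal N D → Cone (Extension.N⁺ X) (just ∘ D) nothing t → Links.C K) →
                   (Links.C K → Homomorphic (λ t → S N (Links.D K) t ≡ true) (Links.h K)
                              ⊎ G s (λ t → Tint N (Links.D K) t ⊎ t ≡ Links.t₀ K) (Links.h K)) → Answered
        answered {X = X} K all-cones inv-new =
          Extension.N⁺ X , Preserve.good⁺ K good all-cones inv-new , Extension.N⁺-old X , emb-β X

        module NoCone (none : ∀ D t → Transversal N D → ¬ NewCone D t) where

          Missing : Fin d → Set
          Missing i = ∀ a → sort β (just a) ≡ suc i → ¬ Above β nothing (just a)

          missing : sort β nothing ≡ zero → ∃[ i ] Missing i
          missing ap = dne λ ¬ex →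
            let b : ∀ i → ∃[ a ] (sort β (just a) ≡ suc i × Above β nothing (just a))
                b i = dne λ ¬b → ¬ex (i , λ a e ab → ¬b (a , e , ab))
            in none (λ i → F (proj₁ (b i))) (proj₁ (proj₂ (proj₂ (b zero))))
                 (λ i → trans (sym (cong (λ z → sort z (proj₁ (b i))) agree)) (proj₁ (proj₂ (b i))))
                 ((λ i → proj₁ (b i)) , (λ i → LN.glued-refl) , ap , (λ i → proj₂ (proj₂ (b i)))
                 , proj₂ (proj₂ (proj₂ (b zero))))

          i₀ : Fin d
          i₀ = by-cases {P = sort β nothing ≡ zero} (λ ap → proj₁ (missing ap)) (λ _ → zero)

          i₀-missing : sort β nothing ≡ zero → Missing i₀
          i₀-missing ap = by-cases-elim Missing (λ ap → proj₂ (missing ap)) (λ ¬ap → ⊥-elim (¬ap ap))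

          X : Extension τ (const (white i₀)) (const (white i₀))
          X = Glue.extension τ (const (white i₀)) (const (white i₀))

          links : Links X
          links = record
            { C = ⊥ ; D = F ; h = const (c₀ , 0) ; t₀ = 0 ; tr = λ () ; new = λ () ; fits = λ () ; hom = λ ()
            ; ε-cong = λ _ → refl ; ε′-cong = λ _ → refl
            ; link = λ ap j _ _ → excused i₀ λ b bs (t , e) _ →
                let (a , g) = Extension.T-in-new X e
                in i₀-missing ap a
                     (trans (cong (λ z → sort z a) agree) (trans (sym (LN.sort-cong g)) bs))
                     (t , trans (sym (Extension.inside-T X {just b} {just a} {nothing} {nothing} (Extension.In-inside X g) (Extension.new-inside X))) e)
            }

          answer : Answered
          answer = answered links (λ D t tr co → none D t tr (⇒NewCone X co)) (λ ())

        module WithCone (D : Fin d → I) (t₀ : ℕ) (tr : Transversal N D) (nc : NewCone D t₀) where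

          Values : Set
          Values = Σ[ h ∈ (ℕ → Value) ]
                     (Fits N D h × Homomorphic (λ t → Tint N D t ⊎ t ≡ t₀) h
                      × (Homomorphic (λ t → S N D t ≡ true) h ⊎ G s (λ t → Tint N D t ⊎ t ≡ t₀) h))

          h-data : Values
          h-data with proj₂ (proj₂ good) D tr
          ... | h , fits , inj₁ hm = h , fits , Hom-sub both hm , inj₁ hm
            where
            a = proj₁ nc

            S-t₀ : S N D t₀ ≡ true
            S-t₀ = trans (LN.S-cong (proj₁ (proj₂ nc)) t₀) (trans (sym (cong (λ z → S z a t₀) agree))
              (Lβ.cone-tint (λ i → trans (cong (λ z → sort z (a i)) agree)
                                         (trans (sym (LN.sort-cong (proj₁ (proj₂ nc) i))) (tr i)))
                            (proj₂ (proj₂ nc))))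

            both : ∀ {t} → Tint N D t ⊎ t ≡ t₀ → S N D t ≡ true
            both (inj₁ (v , c)) = LN.cone-tint tr c
            both (inj₂ refl)    = S-t₀
          ... | h , fits , inj₂ g = by-cases {P = Tint N D t₀} {R = Values}
            (λ old → let g′ = G-sub {P′ = λ t → Tint N D t ⊎ t ≡ t₀} [ id , (λ { refl → old }) ]′ (G-mono g)
                     in h , fits , G-hom g′ , inj₂ g′)
            (λ new → let (x , g′) = G-extend g new (small tr)
                         off : ∀ {t} → Tint N D t → (h [ t₀ ↦ x ]) t ≡ h t
                         off {t} old = update-off {h = h} λ e → new (subst (Tint N D) e old)
                     in h [ t₀ ↦ x ]
                      , (λ {v} {w} {_} {_} c c′ n → trans (fits c c′ n) (sym (cong₂ red (off (v , c)) (off (w , c′)))))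
                      , G-hom g′ , inj₂ g′)

          h : ℕ → Value
          h = proj₁ h-data

          Tests : Set
          Tests = Bool × Maybe ℕ × (Fin d → Bool)

          tests : I → Tests
          tests j = ⌊ ∃[ t ] Cone N D j t ⌋ , T N (D zero) j , λ i → ⌊ Above N j (D i) ⌋

          tests-cong : ∀ {j j′} → glued N j j′ ≡ true → tests j ≡ tests j′
          tests-cong {j} {j′} g = cong₂ _,_ (⌊⌋-cong (tint-cong g) (tint-cong (LN.glued-sym g)))
            (cong₂ _,_ (LN.T-cong LN.glued-refl g)
                       (fe λ i → ⌊⌋-cong (above-cong g) (above-cong (LN.glued-sym g))))
            where
            above-cong : ∀ {j j′ i} → glued N j j′ ≡ true → Above N j (D i) → Above N j′ (D i)
            above-cong g (t , e) = t , trans (LN.T-cong LN.glued-refl (LN.glued-sym g)) e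

            tint-cong : ∀ {j j′} → glued N j j′ ≡ true → ∃[ t ] Cone N D j t → ∃[ t ] Cone N D j′ t
            tint-cong g (t , ap , ab , e) = t , trans (sym (LN.sort-cong g)) ap , (λ i → above-cong g (ab i))
              , trans (LN.T-cong LN.glued-refl (LN.glued-sym g)) e

          gap : (Fin d → Bool) → Fin d
          gap χ = by-cases {P = ∃[ i ] χ i ≡ false} proj₁ (const zero)

          gap-false : ∀ {χ : Fin d → Bool} {i} → χ i ≡ false → χ (gap χ) ≡ false
          gap-false {χ} {i} e = by-cases-elim {P = ∃[ i ] χ i ≡ false} (λ i → χ i ≡ false) {proj₁} {const zero}
            proj₂ (λ ¬ex → ⊥-elim (¬ex (i , e)))

          label label′ : Tests → Label
          label (true , just t , _)  = red (h t₀) (h t)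
          label (_ , _ , χ)          = white (gap χ)
          label′ (true , just t , _) = red (h t) (h t₀)
          label′ (_ , _ , χ)         = white (gap χ)

          X : Extension τ (label ∘ tests) (label′ ∘ tests)
          X = Glue.extension τ (label ∘ tests) (label′ ∘ tests)

          new : Cone (Extension.N⁺ X) (just ∘ D) nothing t₀
          new = NewCone⇒ X nc

          link : ∀ {j} → Apex N j → ∀ x → x ≡ tests j → Link X ⊤ D h t₀ j (label x) (label′ x)
          link {j} ap = λ where
              (true , just t , _)  e → cone t tt (ap , proj₁ (proj₂ (proj₂ (tint e))) , sym (cong (proj₁ ∘ proj₂) e))
              (true , nothing , _) e → ⊥-elim (case trans (cong (proj₁ ∘ proj₂) e) (proj₂ (proj₂ (proj₂ (tint e)))) of λ ())
              (false , _ , χ)      e → excused (gap χ) λ b bs (t , e₁) (t′ , e₂) →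
                true≢false (⌊⌋-intro (t′ , trans (LN.T-cong (LN.glued-sym (filled-base tr (λ i → _ , proj₁ (proj₂ nc) i)
                                                                      (Extension.T-in-new X e₁) bs)) LN.glued-refl) e₂))
                           (trans (sym (cong (λ y → proj₂ (proj₂ y) (gap χ)) e)) (gap-false {χ} (proj₂ (no-cone e))))
            where
            tint : ∀ {y} → (true , y) ≡ tests j → ∃[ t ] Cone N D j t
            tint e = ⌊⌋-elim (sym (cong proj₁ e))

            no-cone : ∀ {x χ} → (false , x , χ) ≡ tests j → ∃[ i ] χ i ≡ false
            no-cone e = dne λ ¬ex → true≢false
              (⌊⌋-intro (let ab i = dne λ n → ¬ex (i , trans (cong (λ y → proj₂ (proj₂ y) i) e) (⌊⌋-false n))
                         in proj₁ (ab zero) , ap , ab , proj₂ (ab zero)))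
              (sym (cong proj₁ e))

          links : Links X
          links = record
            { C = ⊤ ; D = D ; h = h ; t₀ = t₀ ; tr = λ _ → tr ; new = λ _ → new
            ; fits = λ _ → proj₁ (proj₂ h-data) ; hom = λ _ → proj₁ (proj₂ (proj₂ h-data))
            ; ε-cong = λ g → cong label (tests-cong g) ; ε′-cong = λ g → cong label′ (tests-cong g)
            ; link = λ _ j ap _ → link ap (tests j) refl
            }

          answer : Answered
          answer = answered links (λ _ _ _ _ → tt) (λ _ → proj₂ (proj₂ (proj₂ h-data)))

        answer : Answered
        answer = by-cases {P = ∃[ D ] ∃[ t ] (Transversal N D × NewCone D t)}
          (λ (D , t , tr , nc) → WithCone.answer D t tr nc)
          (λ none → NoCone.answer λ D t tr nc → none (D , t , tr , nc))

  module _ (d₂ κ : ℕ) (c₀ : Fin κ) where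
    open Rainbow d₂ κ
    open Str

    module _ (H : ℕ → ℕ → Set) (H₀ : ∀ j → H j 0) {n₁ : ℕ} (m≤n : m ≤ suc n₁)
             (plan : ∀ j → Play.Plan d₂ κ c₀ (H j) (H₀ j) n₁) (ok : ∀ j → Play.Plan.Ok (plan j) j) where
      private
        n : ℕ
        n = suc n₁

        Good : ∀ {I} → ℕ → ℕ → Str I → Set
        Good j = Play.Strategist.Good d₂ κ c₀ (H j) (H₀ j) n₁ (plan j)

        module Strategist j = Play.Strategist d₂ κ c₀ (H j) (H₀ j) n₁ (plan j)

      split : ∀ {k} → Fin (suc k) → Fin (suc k) → Maybe (Fin k)
      split i b with i ≟ b
      ... | yes _  = nothing
      ... | no i≢b = just (punchOut i≢b)

      unsplit : ∀ {k} → Fin (suc k) → Maybe (Fin k) → Fin (suc k)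
      unsplit i nothing  = i
      unsplit i (just a) = punchIn i a

      unsplit-split : ∀ {k} (i b : Fin (suc k)) → unsplit i (split i b) ≡ b
      unsplit-split i b with i ≟ b
      ... | yes e  = e
      ... | no i≢b = punchIn-punchOut i≢b

      split-same : ∀ {k} (i : Fin (suc k)) → split i i ≡ nothing
      split-same i with i ≟ i
      ... | yes _ = refl
      ... | no n  = ⊥-elim (n refl)

      split-punchIn : ∀ {k} (i : Fin (suc k)) a → split i (punchIn i a) ≡ just a
      split-punchIn i a with i ≟ punchIn i a
      ... | yes e  = ⊥-elim (punchInᵢ≢i i a (sym e))
      ... | no i≢b = cong just (punchOut-punchIn i)

      respond : ∀ {j s} {N : Str (Fin n)} → Good j (suc s) N → ∀ (l : Fin m → Fin n) i k β →
                Legal (H j) β → Near i β (N ∙ l) → (∀ b → b ≢ i → k ≢ l b) →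
                ∃[ N′ ] (Good j s N′ × Near k N N′ × N′ ∙ updateAt l i (const k) ≡ β)
      respond {j} {s} {N} good l i k β Lβ near k≢ = by-cases {P = ∃[ a ] glued β (punchIn i a) i ≡ true}
        reuse invent
        where
        off : ∀ a → k ≢ l (punchIn i a)
        off a = k≢ (punchIn i a) (punchInᵢ≢i i a)

        Reply : Set
        Reply = ∃[ N′ ] (Good j s N′ × Near k N N′ × N′ ∙ updateAt l i (const k) ≡ β)

        reuse : ∃[ a ] glued β (punchIn i a) i ≡ true → Reply
        reuse (a , g) = N ∙ σ , Strategist.Good-∙ j σ (Strategist.Good-mono j good)
          , cong (N ∙_) (fe λ b → sym (σ-off (punchInᵢ≢i k b)))
          , trans (cong (N ∙_) (fe same))
              (trans (cong (_∙ r) (sym near)) (sym (∙-glued Lβ {id} λ b → β-glued (i ≟ b))))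
          where
          k′ : Fin n
          k′ = l (punchIn i a)

          σ : Fin n → Fin n
          σ = updateAt id k (const k′)

          σ-off : ∀ {b} → b ≢ k → σ b ≡ b
          σ-off = updateAt-old id

          r : Fin m → Fin d
          r b = fromMaybe a (split i b)

          same : ∀ b → σ (updateAt l i (const k) b) ≡ l (punchIn i (r b))
          same b = by-cases {P = b ≡ i}
            (λ { refl → trans (cong σ (updateAt-updates b l)) (trans (updateAt-updates k id)
                   (cong (λ x → l (punchIn b (fromMaybe a x))) (sym (split-same b)))) })
            (λ b≢i → trans (cong σ (updateAt-old l b≢i)) (trans (σ-off (λ e → k≢ b b≢i (sym e)))
                   (cong l (trans (sym (unsplit-split i b)) (other (split i b) refl b≢i)))))
            where
            other : ∀ x → split i b ≡ x → b ≢ i → unsplit i x ≡ punchIn i (fromMaybe a x)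
            other nothing  e b≢i = ⊥-elim (b≢i (trans (sym (unsplit-split i b)) (cong (unsplit i) e)))
            other (just _) _ _   = refl

          β-glued : ∀ {b} → Dec (i ≡ b) → glued β b (punchIn i (r b)) ≡ true
          β-glued (yes refl) = subst (λ x → glued β i (punchIn i (fromMaybe a x)) ≡ true) (sym (split-same i))
                                 (Legal.glued-sym Lβ g)
          β-glued {b} (no i≢b) = subst (λ x → glued β b x ≡ true)
            (trans (sym (punchIn-punchOut i≢b))
                   (cong (λ x → punchIn i (fromMaybe a x))
                         (trans (sym (split-punchIn i (punchOut i≢b))) (cong (split i) (punchIn-punchOut i≢b)))))
            (Legal.glued-refl Lβ)

        invent : ¬ (∃[ a ] glued β (punchIn i a) i ≡ true) → Reply
        invent fresh = conclude (Strategist.Answer.answer j τ (λ tr → Strategist.tints-small j L₁ tr) good₁)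
          where
          good₁ : Good j (suc s) (N ∙ punchIn k)
          good₁ = Strategist.Good-∙ j (punchIn k) good

          L₁ : Legal (H j) (N ∙ punchIn k)
          L₁ = proj₁ (proj₂ good₁)

          F : Fin d → Fin n₁
          F a = punchOut (off a)

          τ : Response.Task d₂ κ c₀ (H j) (H₀ j)
          τ = record
            { N = N ∙ punchIn k ; LN = L₁ ; F = F ; β = β ∙ unsplit i ; Lβ = Legal-∙ (unsplit i) Lβ
            ; agree = trans near (cong (N ∙_) (fe λ a → sym (punchIn-punchOut (off a))))
            ; fresh = λ a g → fresh (a , g) }

          place : ∀ b → split k (updateAt l i (const k) b) ≡ Response.Task.emb τ (split i b)
          place b with i ≟ b
          ... | yes refl = trans (cong (split k) (updateAt-updates i l)) (split-same k)
          ... | no i≢b = trans (cong (split k) (trans (updateAt-old l (i≢b ∘ sym))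
                                 (trans (cong l (sym (punchIn-punchOut i≢b))) (sym (punchIn-punchOut (off (punchOut i≢b)))))))
                               (split-punchIn k _)

          conclude : Σ[ N⁺ ∈ Str (Maybe (Fin n₁)) ]
                       (Good j s N⁺ × N⁺ ∙ just ≡ N ∙ punchIn k × N⁺ ∙ Response.Task.emb τ ≡ β ∙ unsplit i) → Reply
          conclude (N⁺ , good⁺ , old , new) =
            N⁺ ∙ split k , Strategist.Good-∙ j (split k) good⁺
            , trans (sym old) (cong (N⁺ ∙_) (fe λ b → sym (split-punchIn k b)))
            , trans (cong (N⁺ ∙_) (fe place)) (trans (cong (_∙ split i) new) (cong (β ∙_) (fe (unsplit-split i))))

      private
        ι : Fin m → Fin n
        ι b = inject≤ b m≤n

        clamp : Fin n → Fin m
        clamp x = by-cases {P = ∃[ b ] ι b ≡ x} proj₁ (λ _ → zero)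

        clamp-ι : ∀ b → clamp (ι b) ≡ b
        clamp-ι b = by-cases-elim {P = ∃[ b′ ] ι b′ ≡ ι b} (_≡ b) {proj₁} {λ _ → zero}
          (λ (b′ , e) → inject≤-injective _ _ b′ b e) (λ ¬e → ⊥-elim (¬e (b , refl)))

      initial : ∀ {j} {α : Str (Fin m)} → Legal (H j) α → ∃[ N ] (Good j j N × N ∙ ι ≡ α)
      initial {j} {α} L = α ∙ unsplit zero ∙ (split zero ∘ clamp)
        , Strategist.Good-∙ j (split zero ∘ clamp) (Strategist.Legal⇒Good j (ok j) (Legal-∙ (unsplit zero) L))
        , cong (α ∙_) (fe λ b → trans (unsplit-split zero (clamp (ι b))) (clamp-ι b))

    cone-atom : ℕ → Str (Fin m)
    cone-atom t = str (λ i j → ⌊ i ≡ j ⌋) id (λ { (suc _) zero → just t ; _ _ → nothing })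
                      (λ _ _ → white zero) (λ _ _ → true)

    cone-atom-legal : ∀ H t → Legal H (cone-atom t)
    cone-atom-legal H t = record
      { glued-refl  = ⌊⌋-intro refl
      ; glued-sym   = λ e → ⌊⌋-intro (sym (⌊⌋-elim e))
      ; glued-trans = λ e e′ → ⌊⌋-intro (trans (⌊⌋-elim e) (⌊⌋-elim e′))
      ; sort-cong   = ⌊⌋-elim
      ; T-cong      = λ e e′ → cong₂ (T (cone-atom t)) (⌊⌋-elim e) (⌊⌋-elim e′)
      ; E-cong      = λ _ _ → refl
      ; S-cong      = λ _ _ → refl
      ; excuse      = λ _ ap → ⊥-elim (one-apex ap)
      ; red-sym     = λ ap → ⊥-elim (one-apex ap)
      ; red-unique  = λ ap → ⊥-elim (one-apex ap)
      ; red-tint    = λ _ ap → ⊥-elim (one-apex ap)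
      ; cone-tint   = λ _ _ → refl
      }
      where
      one-apex : ∀ {v w} → ¬ Apices (cone-atom t) v w
      one-apex (refl , refl , n) = n (⌊⌋-intro refl)

    strategy : ∀ (H : ℕ → ℕ → Set) (H₀ : ∀ j → H j 0) {n₁} → m ≤ suc n₁ →
               (plan : ∀ j → Play.Plan d₂ κ c₀ (H j) (H₀ j) n₁) → (∀ j → Play.Plan.Ok (plan j) j) →
               Strategy H n₁
    strategy H H₀ {n₁} m≤n plan ok = record
      { Good    = λ j → Good.Good j
      ; legal   = λ (_ , L , _) → L
      ; relabel = λ {j} ρ → Good.Good-∙ j ρ
      ; mono    = λ {j} → Good.Good-mono j
      ; respond = λ {j} → respond H H₀ m≤n plan ok {j}
      ; ι       = _
      ; initial = λ {j} → initial H H₀ m≤n plan ok {j}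
      ; atom    = λ j → cone-atom 0 , cone-atom-legal (H j) 0
      }
      where
      module Good j = Play.Strategist d₂ κ c₀ (H j) (H₀ j) n₁ (plan j)

    sup : ∀ {k} (f : Fin k → ℕ) (Q : Fin k → Set) →
          ∃[ x ] ((x ≡ 0 ⊎ ∃[ i ] (Q i × x ≡ f i)) × (∀ i → Q i → f i ≤ x))
    sup {zero}  f Q = 0 , inj₁ refl , λ ()
    sup {suc k} f Q =
      let (x , attained , above) = sup (f ∘ suc) (Q ∘ suc)
          shift : (x ≡ 0 ⊎ ∃[ i ] (Q (suc i) × x ≡ f (suc i))) → x ≡ 0 ⊎ ∃[ i ] (Q i × x ≡ f i)
          shift = λ { (inj₁ e) → inj₁ e ; (inj₂ (i , q , e)) → inj₂ (suc i , q , e) }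
      in by-cases {P = Q zero × x ≤ f zero}
        (λ (q , le) → f zero , inj₂ (zero , q , refl) , λ { zero _ → ≤-refl ; (suc i) q′ → ≤-trans (above i q′) le })
        (λ ¬q → x , shift attained
              , λ { zero q → [ id , (λ le → ⊥-elim (¬q (q , le))) ]′ (≤-total (f zero) x) ; (suc i) q → above i q })

    multiples-gap : ∀ {a x y} → a ∣ x → a ∣ y → x < y → x + a ≤ y
    multiples-gap {a} (divides p refl) (divides q refl) lt =
      subst (_≤ q * a) (ℕₚ.+-comm a (p * a)) (ℕₚ.*-monoˡ-≤ a (ℕₚ.*-cancelʳ-< a p q lt))

    -- With too few pebbles to see κ cones at once there is always a fresh colour.
    module _ (H : ℕ → Set) (H₀ : H 0) {n₁} (few : n₁ < κ + d) where
      open Play d₂ κ c₀ H H₀ n₁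

      fresh-colours : Plan
      fresh-colours = record
        { Ok       = λ _ → ⊤
        ; Ok-pred  = λ _ → tt
        ; G        = λ _ P h → (∀ {t} → P t → height (h t) ≡ 0)
                             × (∀ {t t′} → P t → P t′ → colour (h t) ≡ colour (h t′) → t ≡ t′)
        ; G-hom    = λ {_} {P} {h} (low , inj) →
            (λ {t} {t′} p p′ → cong h , λ lt → subst₂ _≤_ (sym (low p′)) (sym (low p)) z≤n
                                             , λ e → ⊥-elim (<-irrefl (inj p p′ e) lt))
            , λ p → subst H (sym (low p)) H₀
        ; G-sub    = λ f (low , inj) → (λ p → low (f p)) , λ p p′ → inj (f p) (f p′)
        ; G-mono   = id
        ; G-single = λ _ t → const (c₀ , 0) , (λ _ → refl) , λ { refl refl _ → refl }
        ; G-extend = λ {_} → extend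
        }
        where
        extend : ∀ {P h t} → (∀ {t} → P t → height (h t) ≡ 0)
                             × (∀ {t t′} → P t → P t′ → colour (h t) ≡ colour (h t′) → t ≡ t′) →
                 ¬ P t → Small P → ∃[ x ] ((∀ {t′} → P t′ ⊎ t′ ≡ t → height ((h [ t ↦ x ]) t′) ≡ 0)
                   × (∀ {t′ t″} → P t′ ⊎ t′ ≡ t → P t″ ⊎ t″ ≡ t →
                      colour ((h [ t ↦ x ]) t′) ≡ colour ((h [ t ↦ x ]) t″) → t′ ≡ t″))
        extend {P = P} {h} {t} (low , inj) new small =
          let (c , c-fresh) = fresh in (c , 0) , low′ c , inj′ c c-fresh
          where
          fresh : ∃[ c ] (∀ {t′} → P t′ → colour (h t′) ≢ c)
          fresh = dne λ none →
            let w : ∀ c → ∃[ t′ ] (P t′ × colour (h t′) ≡ c)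
                w c = dne λ ¬w → none (c , λ {t′} p e → ¬w (t′ , p , e))
            in ℕₚ.<⇒≱ few (Small.bound small (λ c → proj₁ (w c))
                 (λ {c} {c′} e → trans (sym (proj₂ (proj₂ (w c)))) (trans (cong (colour ∘ h) e) (proj₂ (proj₂ (w c′)))))
                 (λ c → proj₁ (proj₂ (w c))))

          off : ∀ {x t′} → P t′ → (h [ t ↦ x ]) t′ ≡ h t′
          off p = update-off {h = h} λ e → new (subst P e p)

          at : ∀ {x} → (h [ t ↦ x ]) t ≡ x
          at = update-at {h = h}

          low′ : ∀ c {t′} → P t′ ⊎ t′ ≡ t → height ((h [ t ↦ c , 0 ]) t′) ≡ 0
          low′ c (inj₁ p)    = trans (cong height (off p)) (low p)
          low′ c (inj₂ refl) = cong height (at {c , 0})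

          inj′ : ∀ c → (∀ {t′} → P t′ → colour (h t′) ≢ c) → ∀ {t′ t″} → P t′ ⊎ t′ ≡ t → P t″ ⊎ t″ ≡ t →
                 colour ((h [ t ↦ c , 0 ]) t′) ≡ colour ((h [ t ↦ c , 0 ]) t″) → t′ ≡ t″
          inj′ c cf (inj₁ p) (inj₁ p′) e = inj p p′ (trans (cong colour (sym (off p))) (trans e (cong colour (off p′))))
          inj′ c cf (inj₁ p) (inj₂ refl) e =
            ⊥-elim (cf p (trans (cong colour (sym (off p))) (trans e (cong colour (at {c , 0})))))
          inj′ c cf (inj₂ refl) (inj₁ p) e =
            ⊥-elim (cf p (trans (cong colour (sym (off p))) (trans (sym e) (cong colour (at {c , 0})))))
          inj′ c cf (inj₂ refl) (inj₂ refl) _ = refl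

    -- With s rounds to go the heights are multiples of 2 ^ s, which leaves room
    -- for a new height between any two of them.
    module _ (H : ℕ → Set) (H₀ : H 0) (J : ℕ) (H-below : ∀ {b} → b < 2 ^ J → H b) {n₁ : ℕ} where
      open Play d₂ κ c₀ H H₀ n₁

      record Spaced (s : ℕ) (P : ℕ → Set) (h : ℕ → Value) : Set where
        field
          s<J        : s < J
          multiple   : ∀ {t} → P t → 2 ^ s ∣ height (h t)
          positive   : ∀ {t} → P t → 0 < height (h t)
          below      : ∀ {t} → P t → height (h t) < 2 ^ J
          decreasing : ∀ {t t′} → P t → P t′ → t < t′ → height (h t′) < height (h t)

      2^-∣ : ∀ {a b} → a ≤ b → 2 ^ a ∣ 2 ^ b
      2^-∣ {a} {b} le = subst (λ x → 2 ^ a ∣ 2 ^ x) (ℕₚ.m+[n∸m]≡n le)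
        (subst (2 ^ a ∣_) (sym (ℕₚ.^-distribˡ-+-* 2 a (b ∸ a))) (m∣m*n (2 ^ (b ∸ a))))

      0<2^ : ∀ s → 0 < 2 ^ s
      0<2^ s = ℕₚ.m^n>0 2 s

      2^s<2^suc : ∀ s → 2 ^ s < 2 ^ suc s
      2^s<2^suc s = ℕₚ.^-monoʳ-< 2 (s≤s (s≤s z≤n)) (ℕₚ.n<1+n s)

      spaced-heights : Plan
      spaced-heights = record
        { Ok       = _< J
        ; Ok-pred  = λ lt → ≤-trans (n≤1+n _) lt
        ; G        = Spaced
        ; G-hom    = λ {_} {P} {h} g → let open Spaced g in
            (λ p p′ → cong h , λ lt → ℕₚ.<⇒≤ (decreasing p p′ lt) , λ _ → decreasing p p′ lt)
            , λ p → H-below (below p)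
        ; G-sub    = λ f g → let open Spaced g in record
            { s<J = s<J ; multiple = multiple ∘ f ; positive = positive ∘ f ; below = below ∘ f
            ; decreasing = λ p p′ → decreasing (f p) (f p′) }
        ; G-mono   = λ {s} g → let open Spaced g in record
            { s<J = ≤-trans (n≤1+n _) s<J ; multiple = λ p → ∣-trans (2^-∣ (n≤1+n s)) (multiple p)
            ; positive = positive ; below = below ; decreasing = decreasing }
        ; G-single = λ {s} s<J t → const (c₀ , 2 ^ s) , record
            { s<J = s<J ; multiple = λ _ → ∣-refl ; positive = λ _ → 0<2^ s
            ; below = λ _ → ℕₚ.^-monoʳ-< 2 (s≤s (s≤s z≤n)) s<J
            ; decreasing = λ { refl refl lt → ⊥-elim (<-irrefl refl lt) } }
        ; G-extend = extend
        }
        where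
        extend : ∀ {s P h t} → Spaced (suc s) P h → ¬ P t → Small P →
                 ∃[ x ] Spaced s (λ t′ → P t′ ⊎ t′ ≡ t) (h [ t ↦ x ])
        extend {s} {P} {h} {t} g new small = (c₀ , b) , record
          { s<J        = ≤-trans (n≤1+n _) s<J
          ; multiple   = λ { (inj₁ p) → subst (λ v → 2 ^ s ∣ height v) (sym (off p)) (∣-trans (2^-∣ (n≤1+n s)) (multiple p))
                           ; (inj₂ refl) → subst (λ v → 2 ^ s ∣ height v) (sym at)
                               (∣m∣n⇒∣m+n (∣-trans (2^-∣ (n≤1+n s)) lo-multiple) ∣-refl) }
          ; positive   = λ { (inj₁ p) → subst (λ v → 0 < height v) (sym (off p)) (positive p)
                           ; (inj₂ refl) → subst (λ v → 0 < height v) (sym at) (≤-trans (0<2^ s) (m≤n+m _ lo)) }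
          ; below      = λ { (inj₁ p) → subst (λ v → height v < 2 ^ J) (sym (off p)) (below p)
                           ; (inj₂ refl) → subst (λ v → height v < 2 ^ J) (sym at) (room (2^-∣ (ℕₚ.<⇒≤ s<J)) lo<J) }
          ; decreasing = λ { (inj₁ p) (inj₁ p′) lt → subst₂ (λ v w → height w < height v) (sym (off p)) (sym (off p′))
                                                       (decreasing p p′ lt)
                           ; (inj₁ p) (inj₂ refl) lt → subst₂ (λ v w → height w < height v) (sym (off p)) (sym at)
                                                         (room (multiple p) (lo-below p lt))
                           ; (inj₂ refl) (inj₁ p) lt → subst₂ (λ v w → height w < height v) (sym at) (sym (off p))
                                                         (≤-trans (s≤s (lo-above p lt)) lo<b)
                           ; (inj₂ refl) (inj₂ refl) lt → ⊥-elim (<-irrefl refl lt) }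
          }
          where
          open Spaced g
          open Small small

          Above-t : Fin size → Set
          Above-t i = P (list i) × t < list i

          highest : ∃[ x ] ((x ≡ 0 ⊎ ∃[ i ] (Above-t i × x ≡ height (h (list i))))
                            × (∀ i → Above-t i → height (h (list i)) ≤ x))
          highest = sup (λ i → height (h (list i))) Above-t

          lo b : ℕ
          lo = proj₁ highest
          b  = lo + 2 ^ s

          lo-multiple : 2 ^ suc s ∣ lo
          lo-multiple with proj₁ (proj₂ highest)
          ... | inj₁ e = subst (2 ^ suc s ∣_) (sym e) ((2 ^ suc s) ∣0)
          ... | inj₂ (i , (p , _) , e) = subst (2 ^ suc s ∣_) (sym e) (multiple p)

          lo<J : lo < 2 ^ J
          lo<J with proj₁ (proj₂ highest)
          ... | inj₁ e = subst (_< 2 ^ J) (sym e) (0<2^ J)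
          ... | inj₂ (i , (p , _) , e) = subst (_< 2 ^ J) (sym e) (below p)

          lo-below : ∀ {t′} → P t′ → t′ < t → lo < height (h t′)
          lo-below p lt with proj₁ (proj₂ highest)
          ... | inj₁ e = subst (_< _) (sym e) (positive p)
          ... | inj₂ (i , (p′ , lt′) , e) = subst (_< _) (sym e) (decreasing p p′ (ℕₚ.<-trans lt lt′))

          lo-above : ∀ {t′} → P t′ → t < t′ → height (h t′) ≤ lo
          lo-above p lt with complete p
          ... | i , refl = proj₂ (proj₂ highest) i (p , lt)

          lo<b : lo < b
          lo<b = subst (_≤ b) (ℕₚ.+-comm lo 1) (ℕₚ.+-monoʳ-≤ lo (0<2^ s))

          room : ∀ {y} → 2 ^ suc s ∣ y → lo < y → b < y
          room dv lt = ≤-trans (ℕₚ.+-monoʳ-< lo (2^s<2^suc s)) (multiples-gap lo-multiple dv lt)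

          off : ∀ {x t′} → P t′ → (h [ t ↦ x ]) t′ ≡ h t′
          off p = update-off {h = h} λ e → new (subst P e p)

          at : ∀ {x} → (h [ t ↦ x ]) t ≡ x
          at = update-at {h = h}

  -- The strategy of the universal player

  argmin : ∀ {k} (g : Fin (suc k) → ℕ) → ∃[ i ] (∀ j → g i ≤ g j)
  argmin {zero}  g = zero , λ { zero → ≤-refl }
  argmin {suc k} g with argmin (g ∘ suc)
  ... | i , h with ≤-total (g zero) (g (suc i))
  ...   | inj₁ le = zero  , λ { zero → ≤-refl ; (suc j) → ≤-trans le (h j) }
  ...   | inj₂ le = suc i , λ { zero → le ; (suc j) → h j }

  total : ∀ {k} → (Fin k → ℕ) → ℕ
  total {zero}  g = 0
  total {suc k} g = g zero + total (g ∘ suc)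

  total-cong : ∀ {k} {g g′ : Fin k → ℕ} → (∀ i → g′ i ≡ g i) → total g′ ≡ total g
  total-cong {zero}  e = refl
  total-cong {suc k} e = cong₂ _+_ (e zero) (total-cong (e ∘ suc))

  total-< : ∀ {k} {g g′ : Fin k → ℕ} i → (∀ j → j ≢ i → g′ j ≡ g j) → g′ i < g i → total g′ < total g
  total-< {suc k} zero    e lt = ℕₚ.+-mono-<-≤ lt (ℕₚ.≤-reflexive (total-cong λ j → e (suc j) λ ()))
  total-< {suc k} (suc i) e lt = ℕₚ.+-mono-≤-< (ℕₚ.≤-reflexive (e zero λ ()))
                                   (total-< i (λ j j≢i → e (suc j) (j≢i ∘ suc-injective)) lt)

  third : ∀ {n} (i j : Fin (suc (suc (suc n)))) → ∃[ k ] (k ≢ i × k ≢ j)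
  third zero zero = suc zero , (λ ()) , (λ ())
  third zero (suc zero) = suc (suc zero) , (λ ()) , (λ ())
  third zero (suc (suc _)) = suc zero , (λ ()) , (λ ())
  third (suc zero) zero = suc (suc zero) , (λ ()) , (λ ())
  third (suc (suc _)) zero = suc zero , (λ ()) , (λ ())
  third (suc _) (suc _) = zero , (λ ()) , (λ ())

  module Forcing (d₂ κ₂ : ℕ) (H : ℕ → Set) where

    κ : ℕ
    κ = suc (suc κ₂)

    open Rainbow d₂ κ
    open Str
    open Structure (complex H) using (Carrier)

    ⟦_⟧ : (Str (Fin m) → Set) → Carrier
    ⟦ P ⟧ = lift λ α → ⌊ P α ⌋

    -- Every tuple at which some label red v w occurs determines v and w: this
    -- excludes labels that are given by a nonprincipal ultrafilter.
    Splitting : RelativizedRepresentation (complex H) → Set _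
    Splitting R = ∀ {s} (P : Str (Fin m) → Set) (Q : Value × Value → Str (Fin m) → Set) →
                  (∀ α → Legal H α → P α → ∃[ v ] (Q v α × H (height (proj₁ v)) × H (height (proj₂ v)))) →
                  s ∈ f ⟦ P ⟧ → ∃[ v ] s ∈ f ⟦ Q v ⟧
      where open RelativizedRepresentation R

    module _ (R : RelativizedRepresentation (complex H)) where
      open RelativizedRepresentation R hiding (IsSquare; IsComplete)
      open Structure (complex H) hiding (Carrier) renaming (d to diag)

      infix 4 _⊩_
      _⊩_ : (Fin m → M) → (Str (Fin m) → Set) → Set ℓ
      s ⊩ P = s ∈ f ⟦ P ⟧

      f-mono : ∀ {a b s} → (∀ α → Legal H α → lower a α ≡ true → lower b α ≡ true) → s ∈ f a → s ∈ f b
      f-mono {a} {b} h x = proj₁ (f-cong {a ∨ b} {b} (lift λ α L → ∨-absorb (h α L))) (proj₂ (f-∨ a b) (inj₁ x))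

      ⊩-map : ∀ {P Q s} → (∀ α → Legal H α → P α → Q α) → s ⊩ P → s ⊩ Q
      ⊩-map h = f-mono λ α L x → ⌊⌋-intro (h α L (⌊⌋-elim x))

      ⊩-zip : ∀ {P Q s} → s ⊩ P → s ⊩ Q → s ⊩ (λ α → P α × Q α)
      ⊩-zip {P} {Q} x y = f-mono {⟦ P ⟧ ∧ ⟦ Q ⟧}
        (λ α L e → let (p , q) = ∧-split (⌊ P α ⌋) e in ⌊⌋-intro (⌊⌋-elim p , ⌊⌋-elim q))
        (proj₂ (f-∧ ⟦ P ⟧ ⟦ Q ⟧) (x , y))

      ⊩-absurd : ∀ {P s} → (∀ α → Legal H α → ¬ P α) → ¬ s ⊩ P
      ⊩-absurd h x = proj₁ f-𝟘 (f-mono {b = 𝟘} (λ α L p → ⊥-elim (h α L (⌊⌋-elim p))) x)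

      ⊩-valid : ∀ {P s} → (∀ α → Legal H α → P α) → s ∈ V → s ⊩ P
      ⊩-valid h v = f-mono {𝟙} (λ α L _ → ⌊⌋-intro (h α L)) (proj₂ f-𝟙 v)

      ⊩-all : ∀ {k} {P : Fin k → Str (Fin m) → Set} {s} → s ∈ V → (∀ i → s ⊩ P i) → s ⊩ (λ α → ∀ i → P i α)
      ⊩-all {zero}  v h = ⊩-valid (λ _ _ ()) v
      ⊩-all {suc k} v h = ⊩-map (λ { α L (p , q) zero → p ; α L (p , q) (suc i) → q i }) (⊩-zip (h zero) (⊩-all v (h ∘ suc)))

      ⊩-some : ∀ {k} {P : Fin k → Str (Fin m) → Set} {s} → s ⊩ (λ α → ∃[ i ] P i α) → ∃[ i ] s ⊩ P i
      ⊩-some {k} {P} {s} x = dne λ none →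
        let v = f-⊆ _ x
        in ⊩-absurd {λ α → (∃[ i ] P i α) × (∀ i → ¬ P i α)} (λ α L ((i , p) , n) → n i p)
             (⊩-zip x (⊩-all v λ i → ⊩-map {λ α → ¬ P i α} (λ _ _ p → p) (negate (λ y → none (i , y)) v)))
        where
        negate : ∀ {Q s} → ¬ s ⊩ Q → s ∈ V → s ⊩ (λ α → ¬ Q α)
        negate {Q} ¬x v = f-mono {a = - ⟦ Q ⟧}
          (λ α L e → ⌊⌋-intro λ q → not-elim e (⌊⌋-intro q)) (proj₂ (f-- ⟦ Q ⟧) (v , ¬x))

      ⊩-change : ∀ {P s t} i → (∀ {α β} → Near i β α → P β → P α) → s ⊩ P → t ∈ V → (∀ j → j ≢ i → s j ≡ t j) → t ⊩ P
      ⊩-change {P} i indep x v e = f-mono {c i ⟦ P ⟧}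
        (λ α L y → let (β , _ , near , z) = ⌊⌋-elim y in ⌊⌋-intro (indep near (⌊⌋-elim z)))
        (proj₂ (f-c i ⟦ P ⟧) (v , _ , x , e))

      ⊩-glued : ∀ {s i j} → s ∈ V → s i ≡ s j → s ⊩ (λ α → glued α i j ≡ true)
      ⊩-glued {s} {i} {j} v e = f-mono {diag i j} (λ α L y → ⌊⌋-intro y) (proj₂ (f-d i j) (v , e))

      ⊩-move : ∀ {P s} i (α : Str (Fin m)) → Legal H α → (∀ β → Legal H β → P β → Near i α β) → s ⊩ P →
               s ∈ f (c i ⟦ _≡ α ⟧)
      ⊩-move i α Lα near = f-mono λ β L p → ⌊⌋-intro (α , Lα , near β L (⌊⌋-elim p) , ⌊⌋-intro refl)

      module Clique {n : ℕ} (x : Fin n → M) (clique : IsClique (Range x)) where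

        tuple∈V : ∀ (l : Fin m → Fin n) → x ∘ l ∈ V
        tuple∈V l = clique (x ∘ l) λ i → l i , refl

        pair : Fin m → Fin m → Fin 2 → Fin m
        pair i j zero    = i
        pair i j (suc _) = j

        At : (Str (Fin 2) → Set) → Fin m → Fin m → Str (Fin m) → Set
        At Φ i j α = Φ (α ∙ pair i j)

        Holds : Fin n → Fin n → (Str (Fin 2) → Set) → Set ℓ
        Holds p r Φ = ∀ l i j → i ≢ j → l i ≡ p → l j ≡ r → x ∘ l ⊩ At Φ i j

        module _ {Φ : Str (Fin 2) → Set} {p r : Fin n} where

          change-rest : ∀ {i j} (l l′ : Fin m → Fin n) → l i ≡ l′ i → l j ≡ l′ j → x ∘ l ⊩ At Φ i j → x ∘ l′ ⊩ At Φ i j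
          change-rest {i} {j} l l′ ei ej h =
            subst (λ z → x ∘ z ⊩ At Φ i j) (mix-all {f = l′} {l})
              (hybrid m (subst (λ z → x ∘ z ⊩ At Φ i j) (sym (mix-zero {f = l′} {l})) h))
            where
            pair-near : ∀ {α β b} → i ≢ b → j ≢ b → Near b β α → β ∙ pair i j ≡ α ∙ pair i j
            pair-near {α} {β} {b} i≢b j≢b near =
              subst (λ ρ → β ∙ ρ ≡ α ∙ ρ) (fe λ { zero → punchIn-punchOut (i≢b ∘ sym)
                                               ; (suc zero) → punchIn-punchOut (j≢b ∘ sym) })
                    (cong (_∙ ρ) near)
              where
              ρ : Fin 2 → Fin d
              ρ zero    = punchOut {i = b} (i≢b ∘ sym)
              ρ (suc _) = punchOut {i = b} (j≢b ∘ sym)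

            step : ∀ t → x ∘ mix t l′ l ⊩ At Φ i j → x ∘ mix (suc t) l′ l ⊩ At Φ i j
            step t prev = by-cases {P = ∃[ b ] (toℕ b ≡ t × l′ b ≢ l b)}
              (λ (b , eb , differ) → ⊩-change b
                (λ {α} {β} near → subst Φ (pair-near {α} {β} {b} (λ { refl → differ (sym ei) }) (λ { refl → differ (sym ej) }) near))
                prev (tuple∈V _) (λ b′ b′≢b → cong x (mix-suc {f = l′} {l} λ e → ⊥-elim (b′≢b (toℕ-injective (trans e (sym eb)))))))
              (λ none → subst (_⊩ At Φ i j) (fe λ b → cong x (mix-suc {f = l′} {l} λ e → dne λ n → none (b , e , n))) prev)

            hybrid : ∀ t → x ∘ mix 0 l′ l ⊩ At Φ i j → x ∘ mix t l′ l ⊩ At Φ i j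
            hybrid zero    h = h
            hybrid (suc t) h = step t (hybrid t h)

          Somewhere : Fin m → Fin m → Set ℓ
          Somewhere i j = i ≢ j × ∃[ l ] (l i ≡ p × l j ≡ r × x ∘ l ⊩ At Φ i j)

          swap-glued : ∀ {α i j i′ j′} → Legal H α → glued α i i′ ≡ true → glued α j j′ ≡ true →
                       Φ (α ∙ pair i j) → Φ (α ∙ pair i′ j′)
          swap-glued L g g′ = subst Φ (∙-glued L λ { zero → g ; (suc _) → g′ })

          move₁ : ∀ {i j} i′ → i′ ≢ j → Somewhere i j → Somewhere i′ j
          move₁ {i} {j} i′ i′≢j (i≢j , l , ei , ej , h) = i′≢j , l′ , at-i′ , at-j ,
            ⊩-map (λ α L (φ , g) → swap-glued L g (Legal.glued-refl L) φ)
              (⊩-zip (change-rest l l′ (sym (trans at-i (sym ei))) (trans ej (sym at-j)) h)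
                     (⊩-glued (tuple∈V l′) (cong x (trans at-i (sym at-i′)))))
            where
            l′ : Fin m → Fin n
            l′ = updateAt l i′ (const p)

            at-i′ : l′ i′ ≡ p
            at-i′ = updateAt-updates i′ l

            at-i : l′ i ≡ p
            at-i = by-cases {P = i ≡ i′} (λ { refl → at-i′ }) (λ n → trans (updateAt-old l n) ei)

            at-j : l′ j ≡ r
            at-j = trans (updateAt-old l (i′≢j ∘ sym)) ej

          move₂ : ∀ {i j} j′ → i ≢ j′ → Somewhere i j → Somewhere i j′
          move₂ {i} {j} j′ i≢j′ (i≢j , l , ei , ej , h) = i≢j′ , l′ , at-i , at-j′ ,
            ⊩-map (λ α L (φ , g) → swap-glued L (Legal.glued-refl L) g φ)
              (⊩-zip (change-rest l l′ (trans ei (sym at-i)) (sym (trans at-j (sym ej))) h)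
                     (⊩-glued (tuple∈V l′) (cong x (trans at-j (sym at-j′)))))
            where
            l′ : Fin m → Fin n
            l′ = updateAt l j′ (const r)

            at-j′ : l′ j′ ≡ r
            at-j′ = updateAt-updates j′ l

            at-j : l′ j ≡ r
            at-j = by-cases {P = j ≡ j′} (λ { refl → at-j′ }) (λ n → trans (updateAt-old l n) ej)

            at-i : l′ i ≡ p
            at-i = trans (updateAt-old l i≢j′) ei

          everywhere : ∀ {i j} → Somewhere i j → Holds p r Φ
          everywhere {i} {j} h l′ i′ j′ i′≢j′ ei ej =
            let (_ , l , ei₁ , ej₁ , h₁) = by-cases {P = i′ ≡ j}
                  (λ { refl → let (k , k≢i , k≢j) = third i i′ in
                         move₂ j′ i′≢j′ (move₁ i′ (k≢j ∘ sym) (move₂ k (k≢i ∘ sym) h)) })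
                  (λ i′≢j → move₂ j′ i′≢j′ (move₁ i′ i′≢j h))
            in change-rest l l′ (trans ei₁ (sym ei)) (trans ej₁ (sym ej)) h₁

      n : ℕ
      n = d + suc κ

      base : Fin d → Fin n
      base i = i ↑ˡ suc κ

      apex : Fin (suc κ) → Fin n
      apex a = d ↑ʳ a

      base≢apex : ∀ {i a} → base i ≢ apex a
      base≢apex {i} {a} e = case trans (sym (splitAt-↑ˡ d i (suc κ))) (trans (cong (splitAt d) e) (splitAt-↑ʳ d (suc κ) a)) of λ ()

      apex-injective : ∀ {a b} → apex a ≡ apex b → a ≡ b
      apex-injective = ↑ʳ-injective d _ _

      cone-tuple : Fin (suc κ) → Fin m → Fin n
      cone-tuple a zero    = apex a
      cone-tuple a (suc i) = base i

      cone-tuple-injective : ∀ {a i j} → cone-tuple a i ≡ cone-tuple a j → i ≡ j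
      cone-tuple-injective {i = zero}  {zero}  _ = refl
      cone-tuple-injective {i = zero}  {suc j} e = ⊥-elim (base≢apex (sym e))
      cone-tuple-injective {i = suc i} {zero}  e = ⊥-elim (base≢apex e)
      cone-tuple-injective {i = suc i} {suc j} e = cong suc (↑ˡ-injective (suc κ) i j e)

      trio : ∀ {A : Set} → A → A → A → Fin m → A
      trio p r u zero          = p
      trio p r u (suc zero)    = r
      trio p r u (suc (suc _)) = u

      private
        i₀ i₁ i₂ : Fin m
        i₀ = zero
        i₁ = suc zero
        i₂ = suc (suc zero)

      atom : ℕ → Str (Fin m)
      atom = cone-atom d₂ κ zero

      record Window (τ : Fin (suc κ) → ℕ) : Set ℓ where
        field
          x      : Fin n → M
          clique : IsClique (Range x)
          cone   : ∀ a → x ∘ cone-tuple a ⊩ (_≡ atom (τ a))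

      module InWindow (splitting : Splitting R) {τ : Fin (suc κ) → ℕ} (τ-injective : ∀ {a b} → τ a ≡ τ b → a ≡ b)
                      (W : Window τ) where
        open Window W
        open Clique x clique

        Lies : Fin d → ℕ → Str (Fin 2) → Set
        Lies i t γ = sort γ zero ≡ suc i × sort γ (suc zero) ≡ zero × T γ zero (suc zero) ≡ just t

        lies : ∀ a i → Holds (base i) (apex a) (Lies i (τ a))
        lies a i = everywhere {Lies i (τ a)} {i = suc i} {zero}
          ((λ ()) , cone-tuple a , refl , refl , ⊩-map (λ { α L refl → refl , refl , refl }) (cone a))

        NotWhite : Fin d → Str (Fin 2) → Set
        NotWhite i γ = E γ zero (suc zero) ≢ white i × Apices γ zero (suc zero)

        RedPair : Value × Value → Str (Fin 2) → Set
        RedPair (v , w) γ = Red γ zero (suc zero) v w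

        not-white : ∀ {a b} → a ≢ b → ∀ i → Holds (apex a) (apex b) (NotWhite i)
        not-white {a} {b} a≢b i = everywhere {NotWhite i} {i = i₀} {i₁}
          ((λ ()) , trio (apex a) (apex b) (base i) , refl , refl
          , ⊩-map (λ α L ((s₂ , s₀ , t) , (_ , s₁ , t′)) →
              let ap : Apices α i₀ i₁
                  ap = s₀ , s₁ , λ g → a≢b (τ-injective (just-injective
                         (trans (sym t) (trans (Legal.T-cong L (Legal.glued-refl L) g) t′))))
              in Legal.excuse L s₂ ap (_ , t) (_ , t′) , ap)
            (⊩-zip (lies a i _ i₂ i₀ (λ ()) refl refl) (lies b i _ i₂ i₁ (λ ()) refl refl)))

        red-pair : ∀ {a b} → a ≢ b → ∃[ v ] Holds (apex a) (apex b) (RedPair v)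
        red-pair {a} {b} a≢b =
          let (v , h) = splitting (λ α → ∀ i → NotWhite i (α ∙ pair i₀ i₁)) (λ v α → RedPair v (α ∙ pair i₀ i₁)) read
                          (⊩-all (tuple∈V l) λ i → not-white a≢b i l i₀ i₁ (λ ()) refl refl)
          in v , everywhere {RedPair v} {i = i₀} {i₁} ((λ ()) , l , refl , refl , h)
          where
          l : Fin m → Fin n
          l = trio (apex a) (apex b) (apex b)

          read : ∀ α → Legal H α → (∀ i → NotWhite i (α ∙ pair i₀ i₁)) →
                 ∃[ v ] (RedPair v (α ∙ pair i₀ i₁) × H (height (proj₁ v)) × H (height (proj₂ v)))
          read α L nw with E α i₀ i₁ in eq
          ... | white i = ⊥-elim (proj₁ (nw i) refl)
          ... | red v w =
            let ap = proj₂ (nw zero)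
                (e , hv) = Legal.red-sym L ap eq
                (_ , hw) = Legal.red-sym L (proj₁ (proj₂ ap) , proj₁ ap , λ g → proj₂ (proj₂ ap) (Legal.glued-sym L g)) e
            in (v , w) , refl , hv , hw

        unique : ∀ {p r v v′} → Holds p r (RedPair v) → Holds p r (RedPair v′) → v ≡ v′
        unique {p} {r} h h′ = dne λ n → ⊩-absurd (λ α L (e , e′) → n (values e e′))
          (⊩-zip (h l i₀ i₁ (λ ()) refl refl) (h′ l i₀ i₁ (λ ()) refl refl))
          where
          l : Fin m → Fin n
          l = trio p r r

          values : ∀ {e : Label} {v v′ : Value × Value} → e ≡ red (proj₁ v) (proj₂ v) → e ≡ red (proj₁ v′) (proj₂ v′) → v ≡ v′
          values refl refl = refl

        apices : ∀ {a b} → a ≢ b → ∀ l i j → i ≢ j → l i ≡ apex a → l j ≡ apex b → x ∘ l ⊩ (λ α → Apices α i j)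
        apices a≢b l i j i≢j ei ej = ⊩-map (λ α L (_ , ap) → ap) (not-white a≢b zero l i j i≢j ei ej)

        flip : ∀ {a b v w} → a ≢ b → Holds (apex a) (apex b) (RedPair (v , w)) → Holds (apex b) (apex a) (RedPair (w , v))
        flip {a} {b} {v} {w} a≢b h = everywhere {RedPair (w , v)} {i = i₁} {i₀}
          ((λ ()) , l , refl , refl
          , ⊩-map (λ α L (ap , e) → proj₁ (Legal.red-sym L ap e))
              (⊩-zip (apices a≢b l i₀ i₁ (λ ()) refl refl) (h l i₀ i₁ (λ ()) refl refl)))
          where
          l : Fin m → Fin n
          l = trio (apex a) (apex b) (apex b)

        triangle : ∀ {a b c v w v′ u w′ u′} → a ≢ b → a ≢ c → b ≢ c →
                   Holds (apex a) (apex b) (RedPair (v , w)) → Holds (apex a) (apex c) (RedPair (v′ , u)) →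
                   Holds (apex b) (apex c) (RedPair (w′ , u′)) → v ≡ v′
        triangle {a} {b} {c} a≢b a≢c b≢c h h′ h″ = dne λ n → ⊩-absurd
          (λ α L ((ap , ap′ , ap″) , e , e′ , e″) → n (Legal.red-unique L ap ap′ ap″ e e′ e″))
          (⊩-zip (⊩-zip (apices a≢b l i₀ i₁ (λ ()) refl refl)
                   (⊩-zip (apices a≢c l i₀ i₂ (λ ()) refl refl) (apices b≢c l i₁ i₂ (λ ()) refl refl)))
                 (⊩-zip (h l i₀ i₁ (λ ()) refl refl)
                   (⊩-zip (h′ l i₀ i₂ (λ ()) refl refl) (h″ l i₁ i₂ (λ ()) refl refl))))
          where
          l : Fin m → Fin n
          l = trio (apex a) (apex b) (apex c)

        other-apex : (a : Fin (suc κ)) → ∃[ b ] a ≢ b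
        other-apex a = let (b , b≢a) = other-index a in b , b≢a ∘ sym

        abstract
          value : Fin (suc κ) → Value
          value a = proj₁ (proj₁ (red-pair (proj₂ (other-apex a))))

          source : ∀ {a b v w} → a ≢ b → Holds (apex a) (apex b) (RedPair (v , w)) → v ≡ value a
          source {a} {b} {v} {w} a≢b h = by-cases {P = b ≡ proj₁ (other-apex a)}
            (λ e → cong proj₁ (unique (subst (λ b → Holds (apex a) (apex b) (RedPair (v , w))) e h)
                                      (proj₂ (red-pair (proj₂ (other-apex a))))))
            (λ n → triangle a≢b (proj₂ (other-apex a)) n h (proj₂ (red-pair (proj₂ (other-apex a)))) (proj₂ (red-pair n)))

          values : ∀ {a b} → a ≢ b → Holds (apex a) (apex b) (RedPair (value a , value b))
          values {a} {b} a≢b =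
            let ((v , w) , h) = red-pair a≢b
            in subst (λ z → Holds (apex a) (apex b) (RedPair z))
                 (cong₂ _,_ (source a≢b h) (source (a≢b ∘ sym) (flip a≢b h))) h

        compatible : ∀ {a b} → a ≢ b → Compatible (τ a) (value a) (τ b) (value b)
        compatible {a} {b} a≢b = dne λ n → ⊩-absurd
          (λ α L (((s₂ , _ , t) , (_ , _ , t′)) , ap , e) → n (Legal.red-tint L s₂ ap t t′ e))
          (⊩-zip (⊩-zip (lies a zero l i₂ i₀ (λ ()) refl refl) (lies b zero l i₂ i₁ (λ ()) refl refl))
            (⊩-zip (apices a≢b l i₀ i₁ (λ ()) refl refl) (values a≢b l i₀ i₁ (λ ()) refl refl)))
          where
          l : Fin m → Fin n
          l = trio (apex a) (apex b) (base zero)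

        height-≤ : ∀ {a b} → τ a ≤ τ b → height (value b) ≤ height (value a)
        height-≤ {a} {b} le = by-cases {P = a ≡ b}
          (λ { refl → ≤-refl })
          (λ n → proj₁ (proj₂ (compatible n) (ℕₚ.≤∧≢⇒< le (λ e → n (τ-injective e)))))

        -- Two of the suc κ apices have the same one of the κ colours.
        drop : ∀ {first last} → (∀ a → τ first ≤ τ a) → (∀ a → τ a ≤ τ last) → height (value last) < height (value first)
        drop {first} {last} fst lst =
          let (a , b , a<b , e) = pigeonhole (ℕₚ.n<1+n κ) (colour ∘ value)
              a≢b : a ≢ b
              a≢b a≡b = <-irrefl (cong toℕ a≡b) a<b
          in [ (λ le → strict a≢b e le) , (λ le → strict (a≢b ∘ sym) (sym e) le) ]′ (≤-total (τ a) (τ b))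
          where
          strict : ∀ {a b} → a ≢ b → colour (value a) ≡ colour (value b) → τ a ≤ τ b →
                   height (value last) < height (value first)
          strict {a} {b} a≢b e le =
            ≤-trans (s≤s (height-≤ (lst b)))
              (≤-trans (proj₂ (proj₂ (compatible a≢b) (ℕₚ.≤∧≢⇒< le (λ q → a≢b (τ-injective q)))) e) (height-≤ (fst a)))

      atom-legal : ∀ t → Legal H (atom t)
      atom-legal = cone-atom-legal d₂ κ zero H

      atom-near : ∀ t t′ → Near zero (atom t) (atom t′)
      atom-near t t′ = str-ext (λ _ _ → refl) (λ _ → refl) (λ _ _ → refl) (λ _ _ → refl) (λ _ _ → refl)

      module _ (square : IsSquare R n) where

        new-cone : ∀ (x : Fin n → M) → IsClique (Range x) → ∀ {b t} → x ∘ cone-tuple b ⊩ (_≡ atom t) → ∀ a t′ →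
                   ∃[ y ] (IsClique (Range y) × (∀ j → j ≢ apex a → y j ≡ x j) × y ∘ cone-tuple a ⊩ (_≡ atom t′))
        new-cone x cl {b} {t} h a t′ =
          let (y , cly , off , hy) = square x cl ⟦ _≡ atom t′ ⟧ zero (cone-tuple b) (apex a)
                (λ { zero n → ⊥-elim (n refl) ; (suc j) _ → base≢apex ∘ sym })
                (⊩-move zero (atom t′) (atom-legal t′) (λ { β L refl → atom-near t′ t }) h)
          in y , cly , off , subst (_⊩ (_≡ atom t′)) (fe λ { zero → refl ; (suc j) → refl }) hy

        cone-tuple-off : ∀ {x y : Fin n → M} {a} → (∀ j → j ≢ apex a → y j ≡ x j) → ∀ {b} → b ≢ a →
                         y ∘ cone-tuple b ≡ x ∘ cone-tuple b
        cone-tuple-off off b≢a = fe λ { zero → off _ (b≢a ∘ apex-injective) ; (suc j) → off _ base≢apex }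

        module Slide (splitting : Splitting R) {τ : Fin (suc κ) → ℕ} (τ-injective : ∀ {a b} → τ a ≡ τ b → a ≡ b)
                     (W : Window τ) where
          open Window W
          module Old = InWindow splitting τ-injective W

          first last : Fin (suc κ)
          first = proj₁ (argmin τ)
          last  = proj₁ (argmax τ)

          t′ : ℕ
          t′ = suc (τ last)

          τ′ : Fin (suc κ) → ℕ
          τ′ = updateAt τ first (const t′)

          τ′-first : τ′ first ≡ t′
          τ′-first = updateAt-updates first τ

          τ′-old : ∀ {a} → a ≢ first → τ′ a ≡ τ a
          τ′-old = updateAt-old τ

          τ<t′ : ∀ a → τ a < t′
          τ<t′ a = s≤s (proj₂ (argmax τ) a)

          τ′-injective : ∀ {a b} → τ′ a ≡ τ′ b → a ≡ b
          τ′-injective {a} {b} e = by-cases {P = a ≡ first}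
            (λ { refl → by-cases {P = b ≡ first} sym
              (λ n → ⊥-elim (<-irrefl (trans (sym (τ′-old n)) (trans (sym e) τ′-first)) (τ<t′ b))) })
            (λ n → by-cases {P = b ≡ first}
              (λ { refl → ⊥-elim (<-irrefl (trans (sym (τ′-old n)) (trans e τ′-first)) (τ<t′ a)) })
              (λ n′ → τ-injective (trans (sym (τ′-old n)) (trans e (τ′-old n′)))))

          abstract
            replaced : ∃[ y ] (IsClique (Range y) × (∀ j → j ≢ apex first → y j ≡ x j)
                               × y ∘ cone-tuple first ⊩ (_≡ atom t′))
            replaced = new-cone x clique (cone first) first t′

          y : Fin n → M
          y = proj₁ replaced

          W′ : Window τ′
          W′ = record
            { x      = y
            ; clique = proj₁ (proj₂ replaced)
            ; cone   = λ a → by-cases {P = a ≡ first}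
                (λ { refl → subst (λ t → y ∘ cone-tuple first ⊩ (_≡ atom t)) (sym τ′-first) (proj₂ (proj₂ (proj₂ replaced))) })
                (λ n → subst₂ (λ s t → s ⊩ (_≡ atom t)) (sym (cone-tuple-off (proj₁ (proj₂ (proj₂ replaced))) n))
                              (sym (τ′-old n)) (cone a))
            }

          module New = InWindow splitting τ′-injective W′

          value-kept : ∀ {a} → a ≢ first → New.value a ≡ Old.value a
          value-kept {a} a≢f = dne λ n → ⊩-absurd {λ α → RedAt (New.value a) (New.value b) α × RedAt (Old.value a) (Old.value b) α}
              (λ α L (e , e′) → n (source≡ e e′))
              (⊩-zip {RedAt (New.value a) (New.value b)} {RedAt (Old.value a) (Old.value b)} {x ∘ l}
                (subst (_⊩ RedAt (New.value a) (New.value b)) same (New.values (b≢a ∘ sym) l i₀ i₁ (λ ()) refl refl))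
                (Old.values (b≢a ∘ sym) l i₀ i₁ (λ ()) refl refl))
            where
            b = proj₁ (third a first)
            b≢a = proj₁ (proj₂ (third a first))
            b≢f = proj₂ (proj₂ (third a first))

            l : Fin m → Fin n
            l = trio (apex a) (apex b) (apex b)

            off = proj₁ (proj₂ (proj₂ replaced))

            same : y ∘ l ≡ x ∘ l
            same = fe λ { zero → off _ (a≢f ∘ apex-injective) ; (suc zero) → off _ (b≢f ∘ apex-injective)
                        ; (suc (suc _)) → off _ (b≢f ∘ apex-injective) }

            RedAt : Value → Value → Str (Fin m) → Set
            RedAt v w α = Red α i₀ i₁ v w

            source≡ : ∀ {e : Label} {v w v′ w′} → e ≡ red v w → e ≡ red v′ w′ → v ≡ v′
            source≡ refl refl = refl

          last≢first : last ≢ first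
          last≢first e = <-irrefl (cong (height ∘ Old.value) e)
            (Old.drop {first} {last} (proj₂ (argmin τ)) (proj₂ (argmax τ)))

          total-drops : total (height ∘ New.value) < total (height ∘ Old.value)
          total-drops = total-< first (λ a n → cong height (value-kept n))
            (≤-trans (s≤s (subst (λ v → height (New.value first) ≤ height v) (value-kept last≢first)
                            (New.height-≤ {last} {first} (subst₂ _≤_ (sym (τ′-old last≢first)) (sym τ′-first) (n≤1+n _)))))
                     (Old.drop {first} {last} (proj₂ (argmin τ)) (proj₂ (argmax τ))))

        no-window : Splitting R → ∀ k {τ : Fin (suc κ) → ℕ} (inj : ∀ {a b} → τ a ≡ τ b → a ≡ b) (W : Window τ)
                    (sp : Splitting R) → total (height ∘ InWindow.value sp inj W) < k → ⊥
        no-window _ (suc k) inj W sp lt =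
          no-window sp k (Slide.τ′-injective sp inj W) (Slide.W′ sp inj W) sp
            (≤-trans (Slide.total-drops sp inj W) (s≤s⁻¹ lt))

        -- The range of s need not be a clique.  So start from the constant tuple of
        -- its first point and let square rebuild the cone point by point.
        start : ∃[ s ] s ⊩ (_≡ atom 0)
        start = dne λ none →
          let e = injective {⟦ _≡ atom 0 ⟧} {𝟘} ((λ {s} h → ⊥-elim (none (s , h))) , λ h → ⊥-elim (proj₁ f-𝟘 h))
          in case trans (sym (⌊⌋-intro refl)) (lower e (atom 0) (atom-legal 0)) of λ ()

        collapse : ∀ {s} → s ⊩ (_≡ atom 0) → ∀ t →
                   let g = mix t (const zero) id in s ∘ g ⊩ (_≡ atom 0 ∙ g)
        collapse {s} h zero = subst (λ g → s ∘ g ⊩ (_≡ atom 0 ∙ g)) (sym (mix-zero {f = const zero} {id})) h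
        collapse {s} h (suc t) = by-cases {P = ∃[ b ] (toℕ b ≡ t × b ≢ zero)}
          (λ (b , eb , b≢0) → step b eb b≢0 (collapse h t))
          (λ none → subst (λ g → s ∘ g ⊩ (_≡ atom 0 ∙ g))
            (fe λ b → mix-suc {f = const zero} {id} λ e → dne λ n → none (b , e , n ∘ sym)) (collapse h t))
          where
          g g⁺ : Fin m → Fin m
          g  = mix t (const zero) id
          g⁺ = mix (suc t) (const zero) id

          step : ∀ b → toℕ b ≡ t → b ≢ zero → s ∘ g ⊩ (_≡ atom 0 ∙ g) → s ∘ g⁺ ⊩ (_≡ atom 0 ∙ g⁺)
          step b eb b≢0 hg =
            let (_ , u , u∈ , off) = proj₁ (f-c b (⟦ _≡ atom 0 ∙ g⁺ ⟧ ∧ diag b zero)) (f-mono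
                  (λ β L e → ⌊⌋-intro (atom 0 ∙ g⁺ , Legal-∙ g⁺ (atom-legal 0)
                    , trans (cong (atom 0 ∙_) (sym (off⇒≡[] kept))) (cong (_∙ punchIn b) (sym (⌊⌋-elim e)))
                    , ∧-join (⌊⌋-intro refl) (trans (cong₂ (glued (atom 0)) at-b at-0) (Legal.glued-refl (atom-legal 0) {zero})))) hg)
                (u₁ , u₂) = proj₁ (f-∧ _ _) u∈
            in subst (_⊩ (_≡ atom 0 ∙ g⁺)) (fe λ b′ → by-cases {P = b′ ≡ b}
                 (λ { refl → trans (proj₂ (proj₁ (f-d b′ zero) u₂))
                               (trans (off zero (b≢0 ∘ sym)) (cong s (trans (kept zero (b≢0 ∘ sym)) (trans at-0 (sym at-b))))) })
                 (λ n → trans (off b′ n) (cong s (kept b′ n)))) u₁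
            where
            kept : ∀ b′ → b′ ≢ b → g b′ ≡ g⁺ b′
            kept b′ n = mix-suc {f = const zero} {id} λ e → ⊥-elim (n (toℕ-injective (trans e (sym eb))))

            at-b : g⁺ b ≡ zero
            at-b = mix-< {f = const zero} {id} (s≤s (subst (_≤ t) (sym eb) ≤-refl))

            at-0 : g⁺ zero ≡ zero
            at-0 = mix-< {f = const zero} {id} (s≤s z≤n)

        Prefix : ℕ → Set ℓ
        Prefix t = ∃[ x ] (IsClique (Range x) × x ∘ cone-tuple zero ⊩ (_≡ atom 0 ∙ mix t id (const zero)))

        prefix : ∀ t → Prefix t
        prefix zero =
          let (s , h) = start
              h₀ = subst (λ g → s ∘ g ⊩ (_≡ atom 0 ∙ g)) (mix-all {f = const zero} {id}) (collapse h m)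
          in const (s zero)
           , (λ u r → subst (_∈ V) (fe λ i → proj₂ (r i)) (f-⊆ _ h₀))
           , subst (λ g → const (s zero) ⊩ (_≡ atom 0 ∙ g)) (sym (mix-zero {f = id} {const zero})) h₀
        prefix (suc t) = by-cases {P = ∃[ b ] toℕ b ≡ t} (λ (b , eb) → add b eb (prefix t))
          (λ none → let (x , cl , h) = prefix t in x , cl ,
            subst (λ g → x ∘ cone-tuple zero ⊩ (_≡ atom 0 ∙ g)) (fe λ b → mix-suc {f = id} {const zero} λ e → ⊥-elim (none (b , e))) h)
          where
          g⁺ : Fin m → Fin m
          g⁺ = mix (suc t) id (const zero)

          add : ∀ b → toℕ b ≡ t → Prefix t → Prefix (suc t)
          add b eb (x , cl , h) =
            let (y , cly , _ , hy) = square x cl ⟦ _≡ atom 0 ∙ g⁺ ⟧ b (cone-tuple zero) (cone-tuple zero b)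
                  (λ j j≢b e → j≢b (sym (cone-tuple-injective {zero} {b} {j} e)))
                  (⊩-move b (atom 0 ∙ g⁺) (Legal-∙ g⁺ (atom-legal 0))
                    (λ { β L refl → cong (atom 0 ∙_) (sym (off⇒≡[] λ j j≢b → mix-suc {f = id} {const zero} λ e →
                         ⊥-elim (j≢b (toℕ-injective (trans e (sym eb)))))) }) h)
            in y , cly , subst (λ l → y ∘ l ⊩ (_≡ atom 0 ∙ g⁺)) (fe λ j → by-cases {P = j ≡ b}
                 (λ { refl → updateAt-updates j (cone-tuple zero) }) (λ n → updateAt-old (cone-tuple zero) n)) hy

        cones : ∀ j → ∃[ x ] (IsClique (Range x) × (∀ a → toℕ a < suc j → x ∘ cone-tuple a ⊩ (_≡ atom (toℕ a))))
        cones zero = let (x , cl , h) = prefix m in x , cl ,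
          λ { zero _ → subst (λ g → x ∘ cone-tuple zero ⊩ (_≡ atom 0 ∙ g)) (mix-all {f = id} {const zero}) h ; (suc _) (s≤s ()) }
        cones (suc j) = by-cases {P = ∃[ a ] toℕ a ≡ suc j}
          (λ (a , ea) →
            let (x , cl , h) = cones j
                (y , cly , off , hy) = new-cone x cl (h zero (s≤s z≤n)) a (toℕ a)
            in y , cly , λ b lt → by-cases {P = b ≡ a} (λ { refl → hy })
                 (λ b≢a → subst (_⊩ (_≡ atom (toℕ b))) (sym (cone-tuple-off off b≢a))
                   (h b (ℕₚ.≤∧≢⇒< (s≤s⁻¹ lt) (λ e → b≢a (toℕ-injective (trans e (sym ea))))))))
          (λ none → let (x , cl , h) = cones j in x , cl , λ b lt →
            h b (ℕₚ.≤∧≢⇒< (s≤s⁻¹ lt) (λ e → none (b , e))))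

        not-square : Splitting R → ⊥
        not-square sp = no-window sp _ {toℕ} toℕ-injective W sp ≤-refl
          where
          W : Window toℕ
          W = let (x , cl , h) = cones κ in record { x = x ; clique = cl ; cone = λ a → h a (toℕ<n a) }

  record Embedding {m} (𝔄 𝔅 : Structure m ℓ) : Set ℓ where
    private
      module 𝔄 = Structure 𝔄
      module 𝔅 = Structure 𝔅
    field
      h      : 𝔄.Carrier → 𝔅.Carrier
      h-cong : ∀ {a b} → a 𝔄.≈ b → h a 𝔅.≈ h b
      h-inj  : ∀ {a b} → h a 𝔅.≈ h b → a 𝔄.≈ b
      h-∨    : ∀ a b → h (a 𝔄.∨ b) ≡ h a 𝔅.∨ h b
      h-∧    : ∀ a b → h (a 𝔄.∧ b) ≡ h a 𝔅.∧ h b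
      h--    : ∀ a → h (𝔄.- a) ≡ 𝔅.- h a
      h-𝟙    : h 𝔄.𝟙 ≡ 𝔅.𝟙
      h-𝟘    : h 𝔄.𝟘 ≡ 𝔅.𝟘
      h-c    : ∀ i a → h (𝔄.c i a) ≡ 𝔅.c i (h a)
      h-d    : ∀ i j → h (𝔄.d i j) ≡ 𝔅.d i j

    h-eval : ∀ {X : Set} (ρ : X → 𝔄.Carrier) t → h (eval 𝔄 ρ t) ≡ eval 𝔅 (h ∘ ρ) t
    h-eval ρ (var x)  = refl
    h-eval ρ (s ∨ᵗ t) = trans (h-∨ _ _) (cong₂ 𝔅._∨_ (h-eval ρ s) (h-eval ρ t))
    h-eval ρ (s ∧ᵗ t) = trans (h-∧ _ _) (cong₂ 𝔅._∧_ (h-eval ρ s) (h-eval ρ t))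
    h-eval ρ (-ᵗ t)   = trans (h-- _) (cong 𝔅.-_ (h-eval ρ t))
    h-eval ρ 𝟙ᵗ       = h-𝟙
    h-eval ρ 𝟘ᵗ       = h-𝟘
    h-eval ρ (cᵗ i t) = trans (h-c i _) (cong (𝔅.c i) (h-eval ρ t))
    h-eval ρ (dᵗ i j) = h-d i j

    HasSmooth-sub : ∀ {n} → HasSmooth m n 𝔅 → HasSmooth m n 𝔄
    HasSmooth-sub {n} (ca , R , sm) =
        axioms⇒IsCA 𝔄 (λ { e@(s , t) ax ρ → h-inj (subst₂ 𝔅._≈_ (sym (h-eval ρ s)) (sym (h-eval ρ t))
                                                  (IsCA⇒axioms 𝔅 ca e ax (h ∘ ρ))) })
      , R′ , square⇒smooth R′ (λ x cl a i l k k≢ hx →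
          IsSmooth.square sm x cl (h a) i l k k≢ (subst (λ b → x ∘ l ∈ R.f b) (h-c i a) hx))
      where
      module R = RelativizedRepresentation R

      rewrite-f : ∀ {a b} {X : Pred (Fin m → R.M) ℓ} → a ≡ b → R.f b ≐ X → R.f a ≐ X
      rewrite-f refl e = e

      R′ : RelativizedRepresentation 𝔄
      R′ = record
        { M = R.M ; V = R.V ; f = R.f ∘ h ; cover = R.cover ; f-⊆ = λ a → R.f-⊆ (h a)
        ; f-cong = R.f-cong ∘ h-cong ; injective = h-inj ∘ R.injective
        ; f-∨ = λ a b → rewrite-f (h-∨ a b) (R.f-∨ _ _) ; f-∧ = λ a b → rewrite-f (h-∧ a b) (R.f-∧ _ _)
        ; f-- = λ a → rewrite-f (h-- a) (R.f-- _) ; f-𝟙 = rewrite-f h-𝟙 R.f-𝟙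
        ; f-𝟘 = (λ x → proj₁ R.f-𝟘 (subst (λ b → _ ∈ R.f b) h-𝟘 x)) , λ ()
        ; f-c = λ i a → rewrite-f (h-c i a) (R.f-c i _) ; f-d = λ i j → rewrite-f (h-d i j) (R.f-d i j) }

  diagonal : ∀ {m} (𝔄 : Structure m ℓ) (𝒰 : Ultrafilter ℕ) → Embedding 𝔄 (ultraproduct 𝒰 (λ _ → 𝔄))
  diagonal 𝔄 𝒰 = record
    { h = λ a _ → a ; h-cong = λ e → lift (U-pure λ _ → e) ; h-inj = λ (lift u) → proj₂ (U-∃ u)
    ; h-∨ = λ _ _ → refl ; h-∧ = λ _ _ → refl ; h-- = λ _ → refl ; h-𝟙 = refl ; h-𝟘 = refl
    ; h-c = λ _ _ → refl ; h-d = λ _ _ → refl }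
    where open Ultrafilter 𝒰

  module Values (d₂ κ₂ : ℕ) (H : ℕ → Set) where
    open Forcing d₂ κ₂ H
    open Rainbow d₂ κ

    complete⇒splitting : ∀ R → IsComplete R → Splitting R
    complete⇒splitting R complete {s} P Q h x =
      let (_ , (v , e) , y) = proj₁ (complete 𝒮 ⟦ P ⟧ (upper , least)) x
      in v , ⊩-map R (λ _ _ (_ , q) → q) (subst (λ b → s ∈ RelativizedRepresentation.f R b) e y)
      where
      open Structure (complex H) using (_≼_)

      𝒮 : Pred (Structure.Carrier (complex H)) ℓ
      𝒮 b = ∃[ v ] b ≡ ⟦ (λ α → P α × Q v α) ⟧

      upper : ∀ b → b ∈ 𝒮 → b ≼ ⟦ P ⟧
      upper b (v , refl) = lift λ α L → ∨-absorb λ e → ⌊⌋-intro (proj₁ (⌊⌋-elim e))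

      least : ∀ u → (∀ b → b ∈ 𝒮 → b ≼ u) → ⟦ P ⟧ ≼ u
      least u up = lift λ α L → ∨-absorb λ e →
        let (v , q , _) = h α L (⌊⌋-elim e)
        in trans (sym (lower (up _ (v , refl)) α L)) (left (⌊⌋-intro (⌊⌋-elim e , q)))
        where
        left : ∀ {x y} → x ≡ true → x Bool.∨ y ≡ true
        left refl = refl

  bounded⇒splitting : ∀ d₂ κ₂ B R → Forcing.Splitting d₂ κ₂ (_< B) R
  bounded⇒splitting d₂ κ₂ B R {s} P Q h x =
    let (c , x₁)  = ⊩-some R {P = Q₁} (⊩-map R (λ α L p → locate α (h α L p)) x)
        (b , x₂)  = ⊩-some R {P = Q₂ c} x₁
        (c′ , x₃) = ⊩-some R {P = Q₃ c b} x₂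
        (b′ , x₄) = ⊩-some R {P = Q₄ c b c′} x₃
    in ((c , toℕ b) , (c′ , toℕ b′)) , x₄
    where
    open Forcing d₂ κ₂ (_< B)
    open Rainbow d₂ κ

    Q₄ : Fin κ → Fin B → Fin κ → Fin B → Str (Fin m) → Set
    Q₄ c b c′ b′ = Q ((c , toℕ b) , (c′ , toℕ b′))

    Q₃ : Fin κ → Fin B → Fin κ → Str (Fin m) → Set
    Q₃ c b c′ α = ∃[ b′ ] Q₄ c b c′ b′ α

    Q₂ : Fin κ → Fin B → Str (Fin m) → Set
    Q₂ c b α = ∃[ c′ ] Q₃ c b c′ α

    Q₁ : Fin κ → Str (Fin m) → Set
    Q₁ c α = ∃[ b ] Q₂ c b α

    locate : ∀ α → ∃[ v ] (Q v α × height (proj₁ v) < B × height (proj₂ v) < B) → ∃[ c ] Q₁ c α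
    locate α (((c , b) , (c′ , b′)) , q , lt , lt′) =
      c , fromℕ< lt , c′ , fromℕ< lt′ ,
      subst₂ (λ y z → Q ((c , y) , (c′ , z)) α) (sym (toℕ-fromℕ< lt)) (sym (toℕ-fromℕ< lt′)) q

  module Results (d₂ κ₂ : ℕ) where
    κ : ℕ
    κ = suc (suc κ₂)

    open Rainbow d₂ κ

    private
      q : ℕ
      q = m + κ

      c₀ : Fin κ
      c₀ = zero

      𝒰 = proj₁ cofinite-ultrafilter
      free = proj₂ cofinite-ultrafilter
      open Ultrafilter 𝒰

    not-square′ : ∀ H R → Forcing.Splitting d₂ κ₂ H R → ¬ IsSquare R q
    not-square′ H R sp sq =
      Forcing.not-square d₂ κ₂ H R (subst (IsSquare R) (sym (ℕₚ.+-suc d κ)) sq) sp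

    not-elementary : ¬ IsElementary (HasCompleteSmooth {ℓ} m q)
    not-elementary (Th , axiomatize) =
      let (_ , R , complete , smooth) = from (axiomatize 𝔄) λ σ σ∈ →
            proj₂ (U-∃ (to (łoś-sentence 𝒰 (λ _ → 𝔄) σ) (to (axiomatize power) power∈ σ σ∈)))
      in not-square′ H R (Values.complete⇒splitting d₂ κ₂ H R complete) (IsSmooth.square smooth)
      where
      H : ℕ → Set
      H _ = ⊤

      𝔄 = complex H
      power = ultraproduct 𝒰 (λ _ → 𝔄)

      power∈ : HasCompleteSmooth m q power
      power∈ = limit-complete (strategy d₂ κ c₀ (λ _ → H) (λ _ → tt) (m≤m+n m κ)
        (λ j → spaced-heights d₂ κ c₀ H tt (suc j) (λ _ → tt)) (λ j → ≤-refl)) 𝒰 free (s≤s (ℕₚ.m<m+n d (s≤s z≤n)))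

    not-finitely-axiomatizable :
      ¬ FinitelyAxiomatizableOver (HasSmooth {ℓ} m (m + suc κ₂)) (HasSmooth m (suc (m + suc κ₂)))
    not-finitely-axiomatizable (Th , axiomatize) =
      let (j , sat) = U-∃ (holds Th (proj₂ (to (axiomatize _) limit∈)))
          (_ , R , smooth) = from (axiomatize (𝔄 j)) (𝔄∈ j , sat)
      in not-square′ (H j) R (bounded⇒splitting d₂ κ₂ (2 ^ suc j) R)
           (subst (IsSquare R) (sym (ℕₚ.+-suc m (suc κ₂))) (IsSmooth.square smooth))
      where
      H : ℕ → ℕ → Set
      H j = _< 2 ^ suc j

      H₀ : ∀ j → H j 0
      H₀ j = ℕₚ.m^n>0 2 (suc j)

      𝔄 : ℕ → Structure m ℓ
      𝔄 j = complex (H j)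

      𝔄∈ : ∀ j → HasSmooth m (m + suc κ₂) (𝔄 j)
      𝔄∈ j = Embedding.HasSmooth-sub (diagonal (𝔄 j) 𝒰)
        (limit-smooth (strategy d₂ κ c₀ (λ _ → H j) (λ _ → H₀ j) (m≤m+n m (suc κ₂))
          (λ _ → fresh-colours d₂ κ c₀ (H j) (H₀ j) few) (λ _ → tt)) 𝒰 free (s≤s (ℕₚ.m<m+n d (s≤s z≤n))))
        where
        few : d + suc κ₂ < κ + d
        few = subst (_< κ + d) (ℕₚ.+-comm (suc κ₂) d) ≤-refl

      limit∈ : HasSmooth m (suc (m + suc κ₂)) (ultraproduct 𝒰 𝔄)
      limit∈ = limit-smooth (strategy d₂ κ c₀ H H₀ (≤-trans (m≤m+n m (suc κ₂)) (n≤1+n _))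
        (λ j → spaced-heights d₂ κ c₀ (H j) (H₀ j) (suc j) id) (λ j → ≤-refl)) 𝒰 free (s≤s (m≤m+n m (suc κ₂)))

      holds : ∀ Th → All (ultraproduct 𝒰 𝔄 ⊨_) Th → U (λ j → All (𝔄 j ⊨_) Th)
      holds []       []       = U-pure λ _ → []
      holds (σ ∷ Th) (x ∷ xs) = U-map₂ (λ j → _∷_) (to (łoś-sentence 𝒰 𝔄 σ) x) (holds Th xs)

  -- The class of algebras with n-square representations is a variety

  -- The terms of Defs have small sets of variables only, but here the variables
  -- are the elements of an algebra.
  data Tm (m : ℕ) (X : Set ℓ) : Set ℓ where
    var           : X → Tm m X
    _∨ˣ_ _∧ˣ_     : Tm m X → Tm m X → Tm m X
    -ˣ_           : Tm m X → Tm m X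
    𝟙ˣ 𝟘ˣ         : Tm m X
    cˣ            : Fin m → Tm m X → Tm m X
    dˣ            : Fin m → Fin m → Tm m X

  module _ {X : Set ℓ} where

    index : List X → X → ℕ
    index []       x = 0
    index (v ∷ vs) x = by-cases {P = x ≡ v} (λ _ → 0) (λ _ → suc (index vs x))

    lookup : X → List X → ℕ → X
    lookup x₀ []       _       = x₀
    lookup x₀ (v ∷ vs) zero    = v
    lookup x₀ (v ∷ vs) (suc k) = lookup x₀ vs k

    lookup-index : ∀ x₀ vs → All (λ x → lookup x₀ vs (index vs x) ≡ x) vs
    lookup-index x₀ []       = []
    lookup-index x₀ (v ∷ vs) =
      by-cases-elim {P = v ≡ v} (λ k → lookup x₀ (v ∷ vs) k ≡ v) {λ _ → 0} {λ _ → suc (index vs v)} (λ _ → refl) (λ n → ⊥-elim (n refl))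
      ∷ weaken (lookup-index x₀ vs)
      where
      weaken : ∀ {xs} → All (λ x → lookup x₀ vs (index vs x) ≡ x) xs →
               All (λ x → lookup x₀ (v ∷ vs) (index (v ∷ vs) x) ≡ x) xs
      weaken [] = []
      weaken {x ∷ _} (e ∷ es) =
        by-cases-elim {P = x ≡ v} (λ k → lookup x₀ (v ∷ vs) k ≡ x) {λ _ → 0} {λ _ → suc (index vs x)} sym (λ _ → e) ∷ weaken es

  module Terms {m : ℕ} {X : Set ℓ} where

    vars : Tm m X → List X
    vars (var x)  = x ∷ []
    vars (s ∨ˣ t) = vars s ++ vars t
    vars (s ∧ˣ t) = vars s ++ vars t
    vars (-ˣ t)   = vars t
    vars 𝟙ˣ       = []
    vars 𝟘ˣ       = []
    vars (cˣ i t) = vars t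
    vars (dˣ i j) = []

    rename : (X → ℕ) → Tm m X → Term m ℕ
    rename ν (var x)  = var (ν x)
    rename ν (s ∨ˣ t) = rename ν s ∨ᵗ rename ν t
    rename ν (s ∧ˣ t) = rename ν s ∧ᵗ rename ν t
    rename ν (-ˣ t)   = -ᵗ rename ν t
    rename ν 𝟙ˣ       = 𝟙ᵗ
    rename ν 𝟘ˣ       = 𝟘ᵗ
    rename ν (cˣ i t) = cᵗ i (rename ν t)
    rename ν (dˣ i j) = dᵗ i j

    value : (𝔅 : Structure m ℓ) → (X → Structure.Carrier 𝔅) → Tm m X → Structure.Carrier 𝔅
    value 𝔅 σ = λ where
        (var x)  → σ x
        (s ∨ˣ t) → value 𝔅 σ s ∨ value 𝔅 σ t
        (s ∧ˣ t) → value 𝔅 σ s ∧ value 𝔅 σ t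
        (-ˣ t)   → - value 𝔅 σ t
        𝟙ˣ       → 𝟙
        𝟘ˣ       → 𝟘
        (cˣ i t) → c i (value 𝔅 σ t)
        (dˣ i j) → d i j
      where open Structure 𝔅

    module _ (𝔅 : Structure m ℓ) where
      open Structure 𝔅

      value-rename : ∀ ν (ρ : ℕ → Carrier) {σ} t → All (λ x → ρ (ν x) ≡ σ x) (vars t) →
                     eval 𝔅 ρ (rename ν t) ≡ value 𝔅 σ t
      value-rename ν ρ (var x)  (e ∷ []) = e
      value-rename ν ρ (s ∨ˣ t) es = let (l , r) = ++⁻ (vars s) es in cong₂ _∨_ (value-rename ν ρ s l) (value-rename ν ρ t r)
      value-rename ν ρ (s ∧ˣ t) es = let (l , r) = ++⁻ (vars s) es in cong₂ _∧_ (value-rename ν ρ s l) (value-rename ν ρ t r)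
      value-rename ν ρ (-ˣ t)   es = cong -_ (value-rename ν ρ t es)
      value-rename ν ρ 𝟙ˣ       es = refl
      value-rename ν ρ 𝟘ˣ       es = refl
      value-rename ν ρ (cˣ i t) es = cong (c i) (value-rename ν ρ t es)
      value-rename ν ρ (dˣ i j) es = refl

  module TermModels (m₂ n₂ : ℕ) (X : Set ℓ) where

    m n : ℕ
    m = suc (suc m₂)
    n = suc (suc n₂)

    -- An n-square relativized representation of the term algebra, except that it
    -- need not be faithful or covered by its tuples.
    record TermModel : Set (lsuc ℓ) where
      field
        M : Set ℓ
        V : Pred (Fin m → M) ℓ
        F : Tm m X → Pred (Fin m → M) ℓ

      Clique : ∀ {t} → (Fin t → M) → Set ℓ
      Clique x = ∀ (s : Fin m → M) → (∀ i → ∃[ j ] x j ≡ s i) → s ∈ V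

      field
        F-⊆    : ∀ t {s} → s ∈ F t → s ∈ V
        F-∨    : ∀ t u → F (t ∨ˣ u) ≐ F t ∪ F u
        F-∧    : ∀ t u → F (t ∧ˣ u) ≐ F t ∩ F u
        F--    : ∀ t → F (-ˣ t) ≐ (λ s → s ∈ V × ¬ s ∈ F t)
        F-𝟙    : F 𝟙ˣ ≐ V
        F-𝟘    : ∀ {s} → ¬ s ∈ F 𝟘ˣ
        F-c    : ∀ i t → F (cˣ i t) ≐ (λ s → s ∈ V × (∃[ u ] (u ∈ F t × (∀ j → j ≢ i → u j ≡ s j))))
        F-d    : ∀ i j → F (dˣ i j) ≐ (λ s → s ∈ V × s i ≡ s j)
        square : ∀ (x : Fin n → M) → Clique x → ∀ t i (l : Fin m → Fin n) k → (∀ j → j ≢ i → k ≢ l j) →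
                 x ∘ l ∈ F (cˣ i t) →
                 ∃[ y ] (Clique y × (∀ j → j ≢ k → y j ≡ x j) × y ∘ updateAt l i (const k) ∈ F t)

      clique-∘ : ∀ {t} {x : Fin t → M} → (∀ (l : Fin m → Fin t) → x ∘ l ∈ V) → Clique x
      clique-∘ h s r = subst (_∈ V) (fe λ i → proj₂ (r i)) (h λ i → proj₁ (r i))

      clique-at : ∀ {t} {x : Fin t → M} → Clique x → ∀ (l : Fin m → Fin t) → x ∘ l ∈ V
      clique-at cl l = cl _ λ i → l i , refl

    pullback : ∀ {𝔅 : Structure m ℓ} (R : RelativizedRepresentation 𝔅) → IsSquare R n →
               (X → Structure.Carrier 𝔅) → TermModel
    pullback {𝔅} R sq σ = record
      { M = R.M ; V = R.V ; F = λ t → R.f (Terms.value 𝔅 σ t)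
      ; F-⊆ = λ t → R.f-⊆ _ ; F-∨ = λ _ _ → R.f-∨ _ _ ; F-∧ = λ _ _ → R.f-∧ _ _ ; F-- = λ _ → R.f-- _
      ; F-𝟙 = R.f-𝟙 ; F-𝟘 = proj₁ R.f-𝟘 ; F-c = λ i _ → R.f-c i _ ; F-d = R.f-d
      ; square = λ x cl t → sq x cl (Terms.value 𝔅 σ t) }
      where module R = RelativizedRepresentation R

    -- As there are no quotients, the points are canonical representatives.
    module Ultra {J : Set ℓ} (𝒰 : Ultrafilter J) (𝔐 : J → TermModel) where
      open Ultrafilter 𝒰
      private module 𝔐 j = TermModel (𝔐 j)

      Seq : Set ℓ
      Seq = ∀ j → 𝔐.M j

      _~_ : Seq → Seq → Set
      x ~ y = U (λ j → x j ≡ y j)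

      ~-sym : ∀ {x y} → x ~ y → y ~ x
      ~-sym = U-map λ _ → sym

      ~-trans : ∀ {x y z} → x ~ y → y ~ z → x ~ z
      ~-trans = U-map₂ λ _ → trans

      class : Seq → 𝒫 Seq
      class x y = ⌊ y ~ x ⌋

      choose : (χ : 𝒫 Seq) → ∃[ y ] χ ∋ y → Seq
      choose χ ne = by-cases {P = ∃[ y ] χ ∋ y} proj₁ (λ ¬ne → ⊥-elim (¬ne ne))

      choose-∈ : ∀ χ ne → χ ∋ choose χ ne
      choose-∈ χ ne = by-cases-elim {P = ∃[ y ] χ ∋ y} (χ ∋_) {proj₁} {λ ¬ne → ⊥-elim (¬ne ne)}
                        proj₂ (λ ¬ne → ⊥-elim (¬ne ne))

      choose-irr : ∀ χ ne ne′ → choose χ ne ≡ choose χ ne′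
      choose-irr χ ne ne′ with em {P = ∃[ y ] χ ∋ y}
      ... | yes _  = refl
      ... | no ¬ne = ⊥-elim (¬ne ne)

      in-class : ∀ x → ∃[ y ] class x ∋ y
      in-class x = x , ⌊⌋-intro (U-pure λ _ → refl)

      canon : Seq → Seq
      canon x = choose (class x) (in-class x)

      canon-~ : ∀ x → canon x ~ x
      canon-~ x = ⌊⌋-elim (choose-∈ (class x) (in-class x))

      canon-≡ : ∀ {x y} → x ~ y → canon x ≡ canon y
      canon-≡ {x} {y} e = same {class x} {class y} (fe λ z → ⌊⌋-cong (λ q → ~-trans q e) (λ q → ~-trans q (~-sym e)))
                      (in-class x) (in-class y)
        where
        same : ∀ {χ χ′} → χ ≡ χ′ → ∀ ne ne′ → choose χ ne ≡ choose χ′ ne′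
        same {χ} refl = choose-irr χ

      M* : Set ℓ
      M* = Σ[ x ∈ Seq ] canon x ≡ x

      [_] : Seq → M*
      [ x ] = canon x , canon-≡ (canon-~ x)

      rep-~⇒≡ : ∀ {x y : M*} → proj₁ x ~ proj₁ y → x ≡ y
      rep-~⇒≡ {x , p} {y , q} e = same (trans (sym p) (trans (canon-≡ e) q))
        where
        same : ∀ {x y} {p : canon x ≡ x} {q : canon y ≡ y} → x ≡ y → (x , p) ≡ (y , q)
        same {p = p} {q} refl = cong (_ ,_) (uip p q)
          where
          uip : ∀ {x y : Seq} (p q : x ≡ y) → p ≡ q
          uip refl refl = refl

      at : ∀ {t} → (Fin t → M*) → ∀ j → Fin t → 𝔐.M j
      at s j i = proj₁ (s i) j

      F* : Tm m X → Pred (Fin m → M*) ℓ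
      F* t s = Lift ℓ (U (λ j → at s j ∈ 𝔐.F j t))

      V* : Pred (Fin m → M*) ℓ
      V* s = Lift ℓ (U (λ j → at s j ∈ 𝔐.V j))

      at-update : ∀ {t} (s : Fin t → M*) i (u : ∀ j → 𝔐.M j) →
                  U (λ j → at (updateAt s i (const [ u ])) j ≡ updateAt (at s j) i (const (u j)))
      at-update s i u = U-map (λ j e → fe λ b → by-cases {P = b ≡ i}
          (λ { refl → trans (cong (λ x → proj₁ x j) (updateAt-updates b s)) (trans e (sym (updateAt-updates b (at s j)))) })
          (λ n → trans (cong (λ x → proj₁ x j) (updateAt-old s n)) (sym (updateAt-old (at s j) n))))
        (canon-~ u)

      replace : ∀ {A : Set ℓ} {k} {t u : Fin k → A} {i} → (∀ j → j ≢ i → u j ≡ t j) → u ≡ updateAt t i (const (u i))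
      replace {t = t} {u} {i} e = fe λ b → by-cases {P = b ≡ i}
        (λ { refl → sym (updateAt-updates b t) }) (λ n → trans (e b n) (sym (updateAt-old t n)))

      ultra : TermModel
      ultra = record
        { M = M* ; V = V* ; F = F*
        ; F-⊆ = λ t (lift h) → lift (U-map (λ j → 𝔐.F-⊆ j t) h)
        ; F-∨ = λ t u →
            (λ (lift h) → by-cases {P = U (λ j → _ ∈ 𝔐.F j t)} (λ h₁ → inj₁ (lift h₁))
               (λ ¬h₁ → inj₂ (lift (U-map₂ (λ j x ¬y → [ (λ y → ⊥-elim (¬y y)) , id ]′ (proj₁ (𝔐.F-∨ j t u) x)) h (U-em ¬h₁)))))
          , [ (λ (lift h) → lift (U-map (λ j x → proj₂ (𝔐.F-∨ j t u) (inj₁ x)) h))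
            , (λ (lift h) → lift (U-map (λ j x → proj₂ (𝔐.F-∨ j t u) (inj₂ x)) h)) ]′
        ; F-∧ = λ t u →
            (λ (lift h) → lift (U-map (λ j x → proj₁ (proj₁ (𝔐.F-∧ j t u) x)) h)
                        , lift (U-map (λ j x → proj₂ (proj₁ (𝔐.F-∧ j t u) x)) h))
          , (λ (lift h , lift h′) → lift (U-map₂ (λ j x y → proj₂ (𝔐.F-∧ j t u) (x , y)) h h′))
        ; F-- = λ t →
            (λ (lift h) → lift (U-map (λ j x → proj₁ (proj₁ (𝔐.F-- j t) x)) h)
                        , λ (lift h′) → U-⊥ (λ j (x , y) → proj₂ (proj₁ (𝔐.F-- j t) x) y) (U-zip h h′))
          , (λ (lift v , ¬h) → lift (U-map₂ (λ j x ¬y → proj₂ (𝔐.F-- j t) (x , ¬y)) v (U-em λ h → ¬h (lift h))))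
        ; F-𝟙 = (λ (lift h) → lift (U-map (λ j → proj₁ (𝔐.F-𝟙 j)) h)) , (λ (lift h) → lift (U-map (λ j → proj₂ (𝔐.F-𝟙 j)) h))
        ; F-𝟘 = λ (lift h) → U-⊥ (λ j → 𝔐.F-𝟘 j) h
        ; F-c = λ i t → F-c₁ i t , F-c₂ i t
        ; F-d = λ a b →
            (λ (lift h) → lift (U-map (λ j x → proj₁ (proj₁ (𝔐.F-d j a b) x)) h)
                        , rep-~⇒≡ (U-map (λ j x → proj₂ (proj₁ (𝔐.F-d j a b) x)) h))
          , (λ (lift v , e) → lift (U-map (λ j x → proj₂ (𝔐.F-d j a b) (x , cong (λ y → proj₁ y j) e)) v))
        ; square = square*
        }
        where
        F-c₁ : ∀ i t {s} → s ∈ F* (cˣ i t) → s ∈ V* × ∃[ u ] (u ∈ F* t × (∀ j → j ≢ i → u j ≡ s j))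
        F-c₁ i t {s} (lift h) = lift (U-map (λ j → 𝔐.F-⊆ j (cˣ i t)) h)
          , updateAt s i (const [ u ])
          , lift (U-map₂ (λ j e x → subst (_∈ 𝔐.F j t) (sym e) (good j x)) (at-update s i u) h)
          , λ j j≢i → updateAt-old s j≢i
          where
          Move : J → Set ℓ
          Move j = ∃[ u ] (u ∈ 𝔐.F j t × (∀ b → b ≢ i → u b ≡ at s j b))

          u : Seq
          u j = by-cases {P = Move j} (λ (u , _) → u i) (λ _ → at s j i)

          good : ∀ j → at s j ∈ 𝔐.F j (cˣ i t) → updateAt (at s j) i (const (u j)) ∈ 𝔐.F j t
          good j x = by-cases-elim {P = Move j} (λ z → updateAt (at s j) i (const z) ∈ 𝔐.F j t)
            {λ (u , _) → u i} {λ _ → at s j i}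
            (λ (v , v∈ , e) → subst (_∈ 𝔐.F j t) (replace e) v∈)
            (λ ¬mv → ⊥-elim (¬mv (proj₂ (proj₁ (𝔐.F-c j i t) x))))

        F-c₂ : ∀ i t {s} → s ∈ V* × ∃[ u ] (u ∈ F* t × (∀ j → j ≢ i → u j ≡ s j)) → s ∈ F* (cˣ i t)
        F-c₂ i t (lift v , u , lift h , e) = lift (U-map₂ (λ j x y →
          proj₂ (𝔐.F-c j i t) (x , _ , y , λ b n → cong (λ z → proj₁ z j) (e b n))) v h)

        Clique* : (Fin n → M*) → Set ℓ
        Clique* x = ∀ (s : Fin m → M*) → (∀ i → ∃[ j ] x j ≡ s i) → s ∈ V*

        square* : ∀ (x : Fin n → M*) → Clique* x → ∀ t i (l : Fin m → Fin n) k → (∀ j → j ≢ i → k ≢ l j) →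
                  x ∘ l ∈ F* (cˣ i t) →
                  ∃[ y ] (Clique* y × (∀ j → j ≢ k → y j ≡ x j) × y ∘ updateAt l i (const k) ∈ F* t)
        square* x cl t i l k k≢ (lift h) =
          y , (λ s r → subst V* (fe λ b → proj₂ (r b)) (clique-y (λ b → proj₁ (r b))))
            , (λ j → updateAt-old x)
            , lift (U-map (λ j ((e , c) , h) → subst (_∈ 𝔐.F j t) (cong (_∘ updateAt l i (const k)) (sym e)) (proj₂ (good j c h)))
                          (U-zip (U-zip (at-update x k u) cliques) h))
          where
          cliques : U (λ j → 𝔐.Clique j (at x j))
          cliques = U-map (λ j → 𝔐.clique-∘ j) (U-finite→ λ l′ → lower (cl (x ∘ l′) λ b → l′ b , refl))

          Reply : J → Set ℓ
          Reply j = ∃[ y ] (𝔐.Clique j y × (∀ b → b ≢ k → y b ≡ at x j b) × y ∘ updateAt l i (const k) ∈ 𝔐.F j t)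

          u : Seq
          u j = by-cases {P = Reply j} (λ (y , _) → y k) (λ _ → at x j k)

          good : ∀ j → 𝔐.Clique j (at x j) → at x j ∘ l ∈ 𝔐.F j (cˣ i t) →
                 𝔐.Clique j (updateAt (at x j) k (const (u j)))
                 × updateAt (at x j) k (const (u j)) ∘ updateAt l i (const k) ∈ 𝔐.F j t
          good j c h = by-cases-elim {P = Reply j}
            (λ z → 𝔐.Clique j (updateAt (at x j) k (const z)) × updateAt (at x j) k (const z) ∘ updateAt l i (const k) ∈ 𝔐.F j t)
            {λ (y , _) → y k} {λ _ → at x j k}
            (λ (y , cy , off , hy) →
              let e = replace off
              in subst (𝔐.Clique j) e cy , subst (λ z → z ∘ updateAt l i (const k) ∈ 𝔐.F j t) e hy)
            (λ ¬r → ⊥-elim (¬r (𝔐.square j (at x j) c t i l k k≢ h)))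

          y : Fin n → M*
          y = updateAt x k (const [ u ])

          clique-y : ∀ (l′ : Fin m → Fin n) → V* (y ∘ l′)
          clique-y l′ = lift (U-map (λ j ((e , c) , h) →
            subst (_∈ 𝔐.V j) (cong (_∘ l′) (sym e)) (𝔐.clique-at j (proj₁ (good j c h)) l′))
            (U-zip (U-zip (at-update x k u) cliques) h))

      tuple : (∀ j → Fin m → 𝔐.M j) → Fin m → M*
      tuple s i = [ (λ j → s j i) ]

      at-tuple : ∀ s → U (λ j → at (tuple s) j ≡ s j)
      at-tuple s = U-map (λ j → fe) (U-finite λ i → canon-~ (λ j → s j i))

      tuple-F : ∀ {s t} → U (λ j → s j ∈ 𝔐.F j t) → tuple s ∈ F* t
      tuple-F {s} {t} h = lift (U-map₂ (λ j e → subst (_∈ 𝔐.F j t) (sym e)) (at-tuple s) h)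

      F-tuple : ∀ {s t} → tuple s ∈ F* t → U (λ j → s j ∈ 𝔐.F j t)
      F-tuple {s} {t} (lift h) = U-map₂ (λ j e → subst (_∈ 𝔐.F j t) e) (at-tuple s) h

    module Avoid (𝔐 : TermModel) (I : Pred (Tm m X) ℓ) (I-c : ∀ {t} i → t ∈ I → cˣ i t ∈ I) where
      open TermModel 𝔐

      V′ : Pred (Fin m → M) ℓ
      V′ s = s ∈ V × (∀ t → t ∈ I → ¬ s ∈ F t)

      V′-step : ∀ {s u} i → s ∈ V′ → u ∈ V → (∀ j → j ≢ i → s j ≡ u j) → u ∈ V′
      V′-step i (v , av) v′ e = v′ , λ t tI h →
        av (cˣ i t) (I-c i tI) (proj₂ (F-c i t) (v , _ , h , λ j n → sym (e j n)))

      avoid : TermModel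
      avoid = record
        { M = M ; V = V′ ; F = λ t s → s ∈ F t × s ∈ V′
        ; F-⊆ = λ t → proj₂
        ; F-∨ = λ t u → (λ (h , v) → [ (λ x → inj₁ (x , v)) , (λ x → inj₂ (x , v)) ]′ (proj₁ (F-∨ t u) h))
                      , [ (λ (h , v) → proj₂ (F-∨ t u) (inj₁ h) , v) , (λ (h , v) → proj₂ (F-∨ t u) (inj₂ h) , v) ]′
        ; F-∧ = λ t u → (λ (h , v) → (proj₁ (proj₁ (F-∧ t u) h) , v) , (proj₂ (proj₁ (F-∧ t u) h) , v))
                      , (λ ((h , v) , (h′ , _)) → proj₂ (F-∧ t u) (h , h′) , v)
        ; F-- = λ t → (λ (h , v) → v , λ (h′ , _) → proj₂ (proj₁ (F-- t) h) h′)
                    , (λ (v , ¬h) → proj₂ (F-- t) (proj₁ v , λ h → ¬h (h , v)) , v)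
        ; F-𝟙 = proj₂ , λ v → proj₂ F-𝟙 (proj₁ v) , v
        ; F-𝟘 = λ (h , _) → F-𝟘 h
        ; F-c = λ i t →
            (λ (h , v) → let (_ , u , u∈ , e) = proj₁ (F-c i t) h
                         in v , u , (u∈ , V′-step i v (F-⊆ t u∈) (λ j n → sym (e j n))) , e)
          , (λ (v , u , (u∈ , _) , e) → proj₂ (F-c i t) (proj₁ v , u , u∈ , e) , v)
        ; F-d = λ i j → (λ (h , v) → v , proj₂ (proj₁ (F-d i j) h)) , (λ (v , e) → proj₂ (F-d i j) (proj₁ v , e) , v)
        ; square = square′
        }
        where
        Clique′ : (Fin n → M) → Set ℓ
        Clique′ x = ∀ (s : Fin m → M) → (∀ i → ∃[ j ] x j ≡ s i) → s ∈ V′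

        square′ : ∀ (x : Fin n → M) → Clique′ x → ∀ t i (l : Fin m → Fin n) k → (∀ j → j ≢ i → k ≢ l j) →
                  (x ∘ l ∈ F (cˣ i t) × x ∘ l ∈ V′) →
                  ∃[ y ] (Clique′ y × (∀ j → j ≢ k → y j ≡ x j)
                          × (y ∘ updateAt l i (const k) ∈ F t × y ∘ updateAt l i (const k) ∈ V′))
        square′ x cl t i l k k≢ (h , _) =
          let (y , cly , off , hy) = square x (λ s r → proj₁ (cl s r)) t i l k k≢ h
              inside = connect y off (clique-at cly)
          in y , (λ s r → subst (_∈ V′) (fe λ b → proj₂ (r b)) (inside λ b → proj₁ (r b))) , off , hy , inside _
          where
          k′ : ∃[ k′ ] k′ ≢ k
          k′ = other-index k

          connect : ∀ y → (∀ j → j ≢ k → y j ≡ x j) → (∀ (l′ : Fin m → Fin n) → y ∘ l′ ∈ V) →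
                    ∀ (l′ : Fin m → Fin n) → y ∘ l′ ∈ V′
          connect y off v l′ = subst (λ z → y ∘ z ∈ V′) (mix-all {f = l′} {const (proj₁ k′)}) (go m)
            where
            go : ∀ t → y ∘ mix t l′ (const (proj₁ k′)) ∈ V′
            go zero = subst (λ z → y ∘ z ∈ V′) (sym (mix-zero {f = l′} {const (proj₁ k′)}))
              (subst (_∈ V′) (fe λ _ → sym (off (proj₁ k′) (proj₂ k′))) (cl (const (x (proj₁ k′))) λ _ → _ , refl))
            go (suc t) = by-cases {P = ∃[ b ] toℕ b ≡ t}
              (λ (b , eb) → V′-step b (go t) (v _) λ j n → cong y (mix-suc {f = l′} {const (proj₁ k′)} λ e →
                 ⊥-elim (n (toℕ-injective (trans e (sym eb))))))
              (λ none → subst (λ z → y ∘ z ∈ V′)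
                 (fe λ b → mix-suc {f = l′} {const (proj₁ k′)} λ e → ⊥-elim (none (b , e))) (go t))

    module Union {K : Set ℓ} (𝔐 : K → TermModel) where
      private module 𝔐 p = TermModel (𝔐 p)

      M⁺ : Set ℓ
      M⁺ = Σ K 𝔐.M

      Lifted : (∀ p → Pred (Fin m → 𝔐.M p) ℓ) → Pred (Fin m → M⁺) ℓ
      Lifted Y s = ∃[ p ] Σ[ u ∈ (Fin m → 𝔐.M p) ] (s ≡ (λ i → p , u i) × u ∈ Y p)

      same-tuple : ∀ {p q} {u : Fin m → 𝔐.M p} {u′ : Fin m → 𝔐.M q} →
                   _≡_ {A = Fin m → M⁺} (λ i → p , u i) (λ i → q , u′ i) →
                   Σ[ e ∈ p ≡ q ] subst (λ p → Fin m → 𝔐.M p) e u ≡ u′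
      same-tuple {p} {q} {u} {u′} e = go (cong (λ s → proj₁ (s zero)) e) λ i → cong (λ s → s i) e
        where
        go : ∀ {p q} {u : Fin m → 𝔐.M p} {u′ : Fin m → 𝔐.M q} → p ≡ q →
             (∀ i → _≡_ {A = M⁺} (p , u i) (q , u′ i)) →
             Σ[ e ∈ p ≡ q ] subst (λ p → Fin m → 𝔐.M p) e u ≡ u′
        go refl h = refl , fe λ i → second (h i)
          where
          second : ∀ {p} {a b : 𝔐.M p} → _≡_ {A = M⁺} (p , a) (p , b) → a ≡ b
          second refl = refl

      lifted : ∀ {Y p u} → Lifted Y (λ i → p , u i) → u ∈ Y p
      lifted (q , u′ , e , h) with same-tuple e
      ... | refl , refl = h

      lift⁺ : ∀ {Y : ∀ p → Pred (Fin m → 𝔐.M p) ℓ} {p u} → u ∈ Y p → Lifted Y (λ i → p , u i)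
      lift⁺ h = _ , _ , refl , h

      union : TermModel
      union = record
        { M = M⁺ ; V = Lifted 𝔐.V ; F = λ t → Lifted λ p → 𝔐.F p t
        ; F-⊆ = λ { t (p , u , refl , h) → lift⁺ {𝔐.V} (𝔐.F-⊆ p t h) }
        ; F-∨ = λ t v →
            (λ { (p , u , e , h) → [ (λ x → inj₁ (p , u , e , x)) , (λ x → inj₂ (p , u , e , x)) ]′ (proj₁ (𝔐.F-∨ p t v) h) })
          , [ (λ (p , u , e , h) → p , u , e , proj₂ (𝔐.F-∨ p t v) (inj₁ h))
            , (λ (p , u , e , h) → p , u , e , proj₂ (𝔐.F-∨ p t v) (inj₂ h)) ]′
        ; F-∧ = λ t v →
            (λ (p , u , e , h) → (p , u , e , proj₁ (proj₁ (𝔐.F-∧ p t v) h)) , (p , u , e , proj₂ (proj₁ (𝔐.F-∧ p t v) h)))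
          , (λ { ((p , u , refl , h) , h′) → p , u , refl , proj₂ (𝔐.F-∧ p t v) (h , lifted {λ p → 𝔐.F p v} h′) })
        ; F-- = λ t →
            (λ { (p , u , refl , h) → lift⁺ {𝔐.V} (proj₁ (proj₁ (𝔐.F-- p t) h))
                                    , λ h′ → proj₂ (proj₁ (𝔐.F-- p t) h) (lifted {λ p → 𝔐.F p t} h′) })
          , (λ { ((p , u , refl , v) , ¬h) → p , u , refl , proj₂ (𝔐.F-- p t) (v , λ h → ¬h (lift⁺ {λ p → 𝔐.F p t} h)) })
        ; F-𝟙 = (λ (p , u , e , h) → p , u , e , proj₁ (𝔐.F-𝟙 p) h) , (λ (p , u , e , h) → p , u , e , proj₂ (𝔐.F-𝟙 p) h)
        ; F-𝟘 = λ (p , u , e , h) → 𝔐.F-𝟘 p h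
        ; F-c = λ i t →
            (λ { (p , u , refl , h) → let (v , u′ , h′ , e) = proj₁ (𝔐.F-c p i t) h in
                   lift⁺ {𝔐.V} v , (λ j → p , u′ j) , lift⁺ {λ p → 𝔐.F p t} h′ , λ j n → cong (p ,_) (e j n) })
          , (λ { ((p , u , refl , v) , _ , (q , u′ , refl , h) , e) → down i t v h e })
        ; F-d = λ i j →
            (λ { (p , u , refl , h) → let (v , e) = proj₁ (𝔐.F-d p i j) h in lift⁺ {𝔐.V} v , cong (p ,_) e })
          , (λ { ((p , u , refl , v) , e) → p , u , refl , proj₂ (𝔐.F-d p i j) (v , second e) })
        ; square = square⁺
        }
        where
        second : ∀ {p} {a b : 𝔐.M p} → _≡_ {A = M⁺} (p , a) (p , b) → a ≡ b
        second refl = refl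

        down : ∀ i t {p q u u′} → u ∈ 𝔐.V p → u′ ∈ 𝔐.F q t → (∀ j → j ≢ i → _≡_ {A = M⁺} (q , u′ j) (p , u j)) →
               Lifted (λ p → 𝔐.F p (cˣ i t)) (λ j → p , u j)
        down i t v h e with cong proj₁ (e _ (proj₂ (other-index i)))
        ... | refl = lift⁺ {λ p → 𝔐.F p (cˣ i t)} (proj₂ (𝔐.F-c _ i t) (v , _ , h , λ j n → second (e j n)))

        Clique⁺ : (Fin n → M⁺) → Set ℓ
        Clique⁺ x = ∀ (s : Fin m → M⁺) → (∀ i → ∃[ j ] x j ≡ s i) → Lifted 𝔐.V s

        one-component : ∀ x → Clique⁺ x → ∃[ p ] Σ[ u ∈ (Fin n → 𝔐.M p) ] x ≡ (λ j → p , u j)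
        one-component x cl = proj₁ (x zero) , (λ j → subst 𝔐.M (sym (together j)) (proj₂ (x j))) , fe λ j → repack (together j)
          where
          together : ∀ j → proj₁ (x zero) ≡ proj₁ (x j)
          together j = let (p , u , e , _) = cl (x zero ▹ const (x j)) (λ { zero → zero , refl ; (suc _) → j , refl })
                   in trans (cong (λ s → proj₁ (s zero)) e) (sym (cong (λ s → proj₁ (s (suc zero))) e))

          repack : ∀ {p} {y : M⁺} (e : p ≡ proj₁ y) → y ≡ (p , subst 𝔐.M (sym e) (proj₂ y))
          repack refl = refl

        square⁺ : ∀ (x : Fin n → M⁺) → Clique⁺ x → ∀ t i (l : Fin m → Fin n) k → (∀ j → j ≢ i → k ≢ l j) →
                  Lifted (λ p → 𝔐.F p (cˣ i t)) (x ∘ l) →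
                  ∃[ y ] (Clique⁺ y × (∀ j → j ≢ k → y j ≡ x j) × Lifted (λ p → 𝔐.F p t) (y ∘ updateAt l i (const k)))
        square⁺ x cl t i l k k≢ h with one-component x cl
        ... | p , u , refl =
          let (y , cly , off , hy) = 𝔐.square p u
                (𝔐.clique-∘ p λ l′ → lifted {𝔐.V} (cl (λ b → p , u (l′ b)) λ b → l′ b , refl))
                t i l k k≢ (lifted {λ p → 𝔐.F p (cˣ i t)} h)
          in (λ j → p , y j)
           , (λ s r → subst (Lifted 𝔐.V) (fe λ b → proj₂ (r b)) (lift⁺ {𝔐.V} (𝔐.clique-at p cly λ b → proj₁ (r b))))
           , (λ j n → cong (p ,_) (off j n)) , lift⁺ {λ p → 𝔐.F p t} hy

  module _ {m₂ n₂ : ℕ} where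
    private
      m n : ℕ
      m = suc (suc m₂)
      n = suc (suc n₂)

    valid : Pred (Equation m) ℓ
    valid e = Lift ℓ (⌊ (∀ 𝔅 → HasSmooth {ℓ} m n 𝔅 → 𝔅 ⊨ᵉ e) ⌋ ≡ true)

    module Model (𝔄 : Structure m ℓ) (𝔄⊨ : ∀ e → e ∈ valid → 𝔄 ⊨ᵉ e) where
      open Structure 𝔄
      open TermModels m₂ n₂ Carrier hiding (m; n)
      open Terms

      ca : IsCA 𝔄
      ca = axioms⇒IsCA 𝔄 λ e ax → 𝔄⊨ e (lift (⌊⌋-intro λ 𝔅 (ca , _) → IsCA⇒axioms 𝔅 ca e ax))

      private
        𝔹 : BooleanAlgebra ℓ ℓ
        𝔹 = record { isBooleanAlgebra = IsCA.isBooleanAlgebra ca }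

        module 𝔹  = BooleanAlgebra 𝔹
        module 𝔹ₚ = BooleanAlgebraₚ 𝔹
        open 𝔹 using () renaming (refl to ≈-refl; sym to ≈-sym; trans to ≈-trans)

      ∖≈𝟘⇒≈∧ : ∀ {a b} → a ∧ - b ≈ 𝟘 → a ≈ a ∧ b
      ∖≈𝟘⇒≈∧ {a} {b} e = begin
        a                     ≈⟨ 𝔹ₚ.∧-identityʳ a ⟨
        a ∧ 𝟙                 ≈⟨ ∧-cong ≈-refl (𝔹.∨-complementʳ b) ⟨
        a ∧ (b ∨ - b)         ≈⟨ 𝔹.∧-distribˡ-∨ a b (- b) ⟩
        (a ∧ b) ∨ (a ∧ - b)   ≈⟨ ∨-cong ≈-refl e ⟩
        (a ∧ b) ∨ 𝟘           ≈⟨ 𝔹ₚ.∨-identityʳ (a ∧ b) ⟩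
        a ∧ b                 ∎
        where open SetoidReasoning 𝔹.setoid

      ∖-antisym : ∀ {a b} → a ∧ - b ≈ 𝟘 → b ∧ - a ≈ 𝟘 → a ≈ b
      ∖-antisym {a} {b} e e′ = ≈-trans (∖≈𝟘⇒≈∧ e) (≈-trans (𝔹.∧-comm a b) (≈-sym (∖≈𝟘⇒≈∧ e′)))

      val : Tm m Carrier → Carrier
      val = value 𝔄 id

      I : Pred (Tm m Carrier) ℓ
      I t = val t ≈ 𝟘

      I-c : ∀ {t} i → t ∈ I → cˣ i t ∈ I
      I-c i e = ≈-trans (c-cong i e) (IsCA.c-𝟘 ca i)

      J : Set ℓ
      J = List (Σ (Tm m Carrier) I)

      ⋁ : J → Tm m Carrier
      ⋁ []             = 𝟘ˣ
      ⋁ ((t , _) ∷ js) = t ∨ˣ ⋁ js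

      ⋁≈𝟘 : ∀ js → val (⋁ js) ≈ 𝟘
      ⋁≈𝟘 []             = ≈-refl
      ⋁≈𝟘 ((t , e) ∷ js) = ≈-trans (∨-cong e (⋁≈𝟘 js)) (𝔹ₚ.∨-identityʳ 𝟘)

      Pairs : Set ℓ
      Pairs = Σ[ a ∈ Carrier ] Σ[ b ∈ Carrier ] ¬ a ∧ - b ≈ 𝟘

      z : Pairs → Tm m Carrier
      z (a , b , _) = var a ∧ˣ (-ˣ var b)

      Witness : Pairs → J → Set (lsuc ℓ)
      Witness p js = Σ[ 𝔐 ∈ TermModel ] Σ[ s ∈ (Fin m → TermModel.M 𝔐) ]
        (s ∈ TermModel.F 𝔐 (z p) × (∀ t → t ∈ᴸ js → ¬ s ∈ TermModel.F 𝔐 (proj₁ t)))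

      witness : ∀ p js → Witness p js
      witness p@(a , b , a≰b) js = dne λ none → a≰b (≈-trans (≈-sym below) (not-valid none))
        where
        t : Tm m Carrier
        t = z p ∧ˣ (-ˣ ⋁ js)

        ν : Carrier → ℕ
        ν = index (vars t)

        below : val t ≈ val (z p)
        below = ≈-trans (∧-cong ≈-refl (≈-trans (-‿cong (⋁≈𝟘 js)) 𝔹ₚ.¬⊥≈⊤)) (𝔹ₚ.∧-identityʳ _)

        not-valid : ¬ Witness p js → val t ≈ 𝟘
        not-valid none = subst (_≈ 𝟘) (value-rename 𝔄 ν (lookup 𝟙 (vars t)) t (lookup-index 𝟙 (vars t)))
          (𝔄⊨ (rename ν t , 𝟘ᵗ) (lift (⌊⌋-intro λ 𝔅 𝔅∈ → holds 𝔅 𝔅∈)) (lookup 𝟙 (vars t)))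
          where
          holds : ∀ 𝔅 → HasSmooth m n 𝔅 → 𝔅 ⊨ᵉ (rename ν t , 𝟘ᵗ)
          holds 𝔅 (_ , R , sm) ρ = subst (λ x → Structure._≈_ 𝔅 x (Structure.𝟘 𝔅))
              (sym (value-rename 𝔅 ν ρ t (reflexive (vars t))))
              (injective ((λ {s} h → ⊥-elim (none (found s h))) , λ h → ⊥-elim (proj₁ f-𝟘 h)))
            where
            open RelativizedRepresentation R

            reflexive : ∀ xs → All (λ x → ρ (ν x) ≡ ρ (ν x)) xs
            reflexive []       = []
            reflexive (x ∷ xs) = refl ∷ reflexive xs

            𝔐 : TermModel
            𝔐 = pullback R (IsSmooth.square sm) (ρ ∘ ν)

            open TermModel 𝔐 using (F; F-∨; F-∧; F--)

            member : ∀ {s} js t → t ∈ᴸ js → s ∈ F (proj₁ t) → s ∈ F (⋁ js)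
            member (u ∷ js) t (here refl) h = proj₂ (F-∨ (proj₁ u) (⋁ js)) (inj₁ h)
            member (u ∷ js) t (there i)   h = proj₂ (F-∨ (proj₁ u) (⋁ js)) (inj₂ (member js t i h))

            found : ∀ s → s ∈ F t → Witness p js
            found s h = let (h₁ , h₂) = proj₁ (F-∧ (z p) (-ˣ ⋁ js)) h in
              𝔐 , s , h₁ , λ u u∈ x → proj₂ (proj₁ (F-- (⋁ js)) h₂) (member js u u∈ x)

      extending : Σ[ 𝒰 ∈ Ultrafilter J ] (∀ t → Ultrafilter.U 𝒰 (λ js → t ∈ᴸ js))
      extending =
        let (𝒰 , le) = ultrafilter (λ Y → ⌊ Large Y ⌋) fip
        in 𝒰 , λ t → le _ (⌊⌋-intro (t , λ js → ⌊⌋-intro))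
        where
        Large : 𝒫 J → Set ℓ
        Large Y = ∃[ t ] (∀ js → t ∈ᴸ js → Y ∋ js)

        fip : ∀ Ys → All (λ Y → ⌊ Large Y ⌋ ≡ true) Ys → ∃[ js ] All (_∋ js) Ys
        fip Ys large = let (js , h) = go Ys large in js , h js (λ _ → id)
          where
          go : ∀ Ys → All (λ Y → ⌊ Large Y ⌋ ≡ true) Ys →
               ∃[ js ] (∀ js′ → (∀ t → t ∈ᴸ js → t ∈ᴸ js′) → All (_∋ js′) Ys)
          go []       []       = [] , λ _ _ → []
          go (Y ∷ Ys) (y ∷ ys) =
            let (t , h) = ⌊⌋-elim y
                (js , h′) = go Ys ys
            in t ∷ js , λ js′ sub → h js′ (sub t (here refl)) ∷ h′ js′ (λ u u∈ → sub u (there u∈))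

      𝒰 : Ultrafilter J
      𝒰 = proj₁ extending

      open Ultrafilter 𝒰

      module _ (p : Pairs) where
        open Ultra 𝒰 (λ js → proj₁ (witness p js)) public using (ultra; tuple; tuple-F; F-tuple)
        open Avoid ultra I (λ {t} → I-c {t}) public using (avoid; V′)

        point : Fin m → TermModel.M avoid
        point = tuple (λ js → proj₁ (proj₂ (witness p js)))

        point∈ : point ∈ TermModel.F avoid (z p)
        point∈ = h , TermModel.F-⊆ ultra (z p) {point} h , λ t tI x →
          U-⊥ (λ js (q , t∈) → proj₂ (proj₂ (proj₂ (witness p js))) (t , tI) t∈ q)
              (U-zip (F-tuple {λ js → proj₁ (proj₂ (witness p js))} {t} x) (proj₂ extending (t , tI)))
          where
          h : point ∈ TermModel.F ultra (z p)
          h = tuple-F {λ js → proj₁ (proj₂ (witness p js))} {z p} (U-pure λ js → proj₁ (proj₂ (proj₂ (witness p js))))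

      open Union avoid using (union; lift⁺)
      open TermModel union

      F-ideal : ∀ {t s} → t ∈ I → ¬ s ∈ F t
      F-ideal {t} tI (p , u , _ , h , (_ , av)) = av t tI h

      F-≈ : ∀ t t′ → val t ≈ val t′ → F t ⊆ F t′
      F-≈ t t′ e {s} h = dne λ ¬h → F-ideal {t ∧ˣ (-ˣ t′)}
        (≈-trans (∧-cong e ≈-refl) (𝔹.∧-complementʳ (val t′)))
        (proj₂ (F-∧ t (-ˣ t′)) (h , proj₂ (F-- t′) (F-⊆ t h , ¬h)))

      via : ∀ {t t′} {Y : Pred (Fin m → M) ℓ} → val t ≈ val t′ → F t′ ≐ Y → F t ≐ Y
      via {t} {t′} e (f₁ , f₂) = (λ h → f₁ (F-≈ t t′ e h)) , λ y → F-≈ t′ t (≈-sym e) (f₂ y)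

      separates : ∀ {a b} → F (var a) ⊆ F (var b) → a ∧ - b ≈ 𝟘
      separates {a} {b} sub = dne λ n →
        let p = a , b , n
            (h₁ , h₂) = proj₁ (F-∧ (var a) (-ˣ var b)) (p , point p , refl , point∈ p)
        in proj₂ (proj₁ (F-- (var b)) h₂) (sub h₁)

      Occurs : M → Set ℓ
      Occurs x = ∃[ s ] (s ∈ V × ∃[ i ] s i ≡ x)

      M° : Set ℓ
      M° = Σ[ x ∈ M ] ⌊ Occurs x ⌋ ≡ true

      point-≡ : ∀ {x y : M°} → proj₁ x ≡ proj₁ y → x ≡ y
      point-≡ {x , p} {.x , q} refl = cong (x ,_) (uip p q)
        where
        uip : ∀ {x y : Bool} (p q : x ≡ y) → p ≡ q
        uip refl refl = refl

      tuple° : ∀ {s} → s ∈ V → Fin m → M°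
      tuple° {s} v i = s i , ⌊⌋-intro (s , v , i , refl)

      representation : RelativizedRepresentation 𝔄
      representation = record
        { M = M° ; V = λ s → proj₁ ∘ s ∈ V ; f = λ a s → proj₁ ∘ s ∈ F (var a)
        ; cover = λ (x , o) → let (s , v , i , e) = ⌊⌋-elim o in tuple° v , v , i , point-≡ e
        ; f-⊆ = λ a → F-⊆ (var a)
        ; f-cong = λ {a} {b} e → F-≈ (var a) (var b) e , F-≈ (var b) (var a) (≈-sym e)
        ; injective = λ (sub , sup) → ∖-antisym
            (separates λ h → sub {tuple° (F-⊆ _ h)} h) (separates λ h → sup {tuple° (F-⊆ _ h)} h)
        ; f-∨ = λ a b → on (via {var (a ∨ b)} {var a ∨ˣ var b} ≈-refl (F-∨ _ _))
        ; f-∧ = λ a b → on (via {var (a ∧ b)} {var a ∧ˣ var b} ≈-refl (F-∧ _ _))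
        ; f-- = λ a → on (via {var (- a)} { -ˣ var a} ≈-refl (F-- _))
        ; f-𝟙 = on (via {var 𝟙} {𝟙ˣ} ≈-refl F-𝟙)
        ; f-𝟘 = (λ h → ⊥-elim (F-𝟘 (F-≈ (var 𝟘) 𝟘ˣ ≈-refl h))) , λ ()
        ; f-c = λ i a → let (f₁ , f₂) = via {var (c i a)} {cˣ i (var a)} ≈-refl (F-c i (var a)) in
            (λ h → let (v , u , u∈ , e) = f₁ h in v , tuple° (F-⊆ _ u∈) , u∈ , λ j n → point-≡ (e j n))
          , (λ (v , u , u∈ , e) → f₂ (v , _ , u∈ , λ j n → cong proj₁ (e j n)))
        ; f-d = λ i j → let (f₁ , f₂) = via {var (d i j)} {dˣ i j} ≈-refl (F-d i j) in
            (λ h → let (v , e) = f₁ h in v , point-≡ e) , (λ (v , e) → f₂ (v , cong proj₁ e))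
        }
        where
        on : ∀ {Y Z : Pred (Fin m → M) ℓ} → Y ≐ Z →
             (λ (s : Fin m → M°) → Y (proj₁ ∘ s)) ≐ (λ s → Z (proj₁ ∘ s))
        on (g , h) = (λ {s} → g) , (λ {s} → h)

      representation-square : IsSquare representation n
      representation-square x cl a i l k k≢ h =
        let (y , cly , off , hy) = square (proj₁ ∘ x)
              (clique-∘ λ l′ → cl (x ∘ l′) λ b → l′ b , refl)
              (var a) i l k k≢ (F-≈ (var (c i a)) (cˣ i (var a)) ≈-refl h)
        in (λ j → y j , ⌊⌋-intro (const (y j) , clique-at cly (const j) , zero , refl))
         , (λ s r → subst V (fe λ b → cong proj₁ (proj₂ (r b))) (clique-at cly λ b → proj₁ (r b)))
         , (λ j n → point-≡ (off j n)) , hy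

      smooth : HasSmooth m n 𝔄
      smooth = ca , representation , square⇒smooth representation representation-square

    variety : IsVariety (HasSmooth {ℓ} m n)
    variety = valid , λ 𝔄 → mk⇔ (λ 𝔄∈ e (lift v) → ⌊⌋-elim v 𝔄 𝔄∈) (Model.smooth 𝔄)

  smooth-classes : ∀ m n → 2 < m → m < n →
                   IsVariety (HasSmooth {ℓ} m (suc n))
                   × HasSmooth {ℓ} m (suc n) ⊆ HasSmooth {ℓ} m n
                   × ¬ FinitelyAxiomatizableOver (HasSmooth {ℓ} m n) (HasSmooth {ℓ} m (suc n))
  smooth-classes (suc zero) n (s≤s ()) m<n
  smooth-classes (suc (suc zero)) n (s≤s (s≤s ())) m<n
  smooth-classes (suc (suc (suc d₂))) n 2<m m<n with ℕₚ.m≤n⇒∃[o]m+o≡n m<n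
  ... | κ₂ , refl = variety
                  , (λ {𝔄} → HasSmooth-pred {x = 𝔄})
                  , subst (λ n → ¬ FinitelyAxiomatizableOver (HasSmooth (suc (suc (suc d₂))) n) (HasSmooth (suc (suc (suc d₂))) (suc n)))
                          (ℕₚ.+-suc (suc (suc (suc d₂))) κ₂) (Results.not-finitely-axiomatizable d₂ κ₂)

  complete-smooth-class : ∀ m n → 2 < m → m + 3 ≤ n → ¬ IsElementary (HasCompleteSmooth {ℓ} m n)
  complete-smooth-class (suc zero) n (s≤s ()) le
  complete-smooth-class (suc (suc zero)) n (s≤s (s≤s ())) le
  complete-smooth-class (suc (suc (suc d₂))) n 2<m le with ℕₚ.m≤n⇒∃[o]m+o≡n le
  ... | o , refl = subst (λ n → ¬ IsElementary (HasCompleteSmooth (suc (suc (suc d₂))) n))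
                         (sym (ℕₚ.+-assoc (suc (suc (suc d₂))) 3 o)) (Results.not-elementary d₂ (suc o))

theorem8p2 : ∀ {ℓ} →
    (∀ {a} → ExcludedMiddle a) →
    (∀ {a b} → Extensionality a b) →
    (∀ (m n : ℕ) → 2 < m → m < n →
    IsVariety (HasSmooth {ℓ} m (suc n))
    × HasSmooth {ℓ} m (suc n) ⊆ HasSmooth {ℓ} m n
    × ¬ FinitelyAxiomatizableOver (HasSmooth {ℓ} m n) (HasSmooth {ℓ} m (suc n)))
    × (∀ (m n : ℕ) → 2 < m → m + 3 ≤ n →
    ¬ IsElementary (HasCompleteSmooth {ℓ} m n))
theorem8p2 em fe = smooth-classes em fe , complete-smooth-class em fe
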